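{- Let $n\ge 1$ and $\pi\in S_n$. There is a weight-preserving injection $\varphi:\mathrm{TSSCPP}^{red}(\pi)\to \mathrm{ASM}^{red}(\pi)$, i.e. $\mathrm{wt}(\varphi(b))=\mathrm{wt}(b)$ for all $b\in\mathrm{TSSCPP}^{red}(\pi)$. If moreover $\pi$ avoids the pattern $1432$, then $\varphi$ is a bijection.
   Context: Pattern avoidance: $\pi$ avoids $1432$ if there are no indices $a<b<c<d$ with $\pi(a)<\pi(d)<\pi(c)<\pi(b)$. TSSCPP. A totally symmetric self-complementary plane partition in a $2n\times2n\times2n$ box is identified, via a standard bijection, with a TSSCPP boolean triangle of order $n$: an array $b=(b_{i,j})$, $1\le i\le n-1$, $n-i\le j\le n-1$, with entries in $\{0,1\}$ such that for all $1\le j<i\le n-1$: $1+\sum_{k=j+1}^{i} b_{k,n-j-1}\ge \sum_{k=j}^{i} b_{k,n-j}$. We work with these triangles. The weight of $b$ is $\mathrm{wt}(b)=\prod_{(i,j):\,b_{i,j}=1} x_{n-i}$. Pipe dreams. A pipe dream of size $n$ is a tiling of the $n\times n$ grid (rows $1,\dots,n$ top to bottom, columns $1,\dots,n$ left to right) by cross tiles and elbow tiles (an elbow tile has one arc joining its north and west edges and one joining its south and east edges), such that every position $(i,j)$ with $i+j\ge n+1$ is an elbow tile. Pipes labelled $1,\dots,n$ enter through the north border (pipe $j$ above column $j$) and exit through the west border. It is reduced if no two pipes cross twice; then its permutation $\pi$ is given by letting $\pi(i)$ be the label of the pipe exiting the west edge of row $i$. The associated pipe dream of a TSSCPP boolean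 triangle $b$ is the pipe dream having, for $1\le i\le n-1$, $1\le j\le n-i$, a cross tile at $(i,j)$ iff $b_{n-i,\,i+j-1}=1$, and elbow tiles elsewhere. $\mathrm{TSSCPP}^{red}(\pi)$ is the set of TSSCPP boolean triangles of order $n$ whose associated pipe dream is reduced with permutation $\pi$. Bumpless pipe dreams. A bumpless pipe dream (BPD) of size $n$ is a tiling of the $n\times n$ grid by six tiles: cross, horizontal segment, vertical segment, r-tile (elbow joining south and east edges), j-tile (elbow joining north and west edges), and blank, such that $n$ pipes are formed, each entering through the south border (bottom of a column) and exiting through the east border (right of a row). It is reduced if no two pipes cross twice; then, labelling the pipes $1,\dots,n$ from left to right along the south border, its permutation $\pi$ has $\pi(i)$ equal to the label of the pipe exiting row $i$. Its weight is $\prod x_i$ over blank tiles $(i,j)$. ASM. An alternating sign matrix is an $n\times n$ matrix with entries in $\{0,1,-1\}$ whose rows and columns each sum to $1$ and whose nonzero entries alternate in sign along each row and column. Each ASM $A$ corresponds to the unique BPD whose r-tiles are exactly at the entries $1$ and whose j-tiles are exactly at the entries $-1$. $\mathrm{ASM}^{red}(\pi)$ is the set of ASMs whose BPD is reduced with permutation $\pi$. The weight is $\mathrm{wt}(A)=\prod x_i$ over positions $(i,j)$ with $A_{ij}=0$, $\sum_{i'\le i}A_{i'j}=0$ and $\sum_{j'\le j}A_{ij'}=0$ (this equals the weight of its BPD). -}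

module Defs where

open import Data.Bool using (Bool; true; false; _∧_; if_then_else_)
open import Data.Nat using (ℕ; zero; suc; _+_; _∸_; _*_; _≤_; _<_; _≤ᵇ_; _<ᵇ_; _≡ᵇ_)
open import Data.Integer as ℤ using (ℤ; +_; -[1+_])
open import Data.Fin using (Fin; toℕ; opposite)
open import Data.Fin.Permutation using (Permutation′; _⟨$⟩ʳ_; _⟨$⟩ˡ_)
open import Data.Vec using (Vec; []; _∷_; lookup; replicate; tabulate)
open import Data.List using (List; []; _∷_; length; filterᵇ; upTo; map; foldr)
open import Data.Nat.ListAction using (sum)
open import Data.Bool.ListAction using (any)
open import Data.Maybe using (Maybe; just; nothing)
open import Data.Product using (Σ; _×_; _,_; proj₁; proj₂; ∃; ∃-syntax)
open import Data.Sum using (_⊎_)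
open import Relation.Binary.PropositionalEquality using (_≡_; _≢_)
open import Relation.Nullary using (¬_)

at : ∀ {A : Set} {n : ℕ} → A → Vec A n → ℕ → A
at d []       _       = d
at d (x ∷ xs) zero    = x
at d (x ∷ xs) (suc k) = at d xs k

∑< : ℕ → (ℕ → ℕ) → ℕ
∑< m f = sum (map f (upTo m))

∑[_,_] : ℕ → ℕ → (ℕ → ℕ) → ℕ
∑[ a , b ] f = ∑< (suc b ∸ a) (λ t → f (a + t))

∑ℤ< : ℕ → (ℕ → ℤ) → ℤ
∑ℤ< m f = foldr (λ k s → f k ℤ.+ s) (+ 0) (upTo m)

b2n : Bool → ℕ
b2n true  = 1
b2n false = 0

-- Monomials in x_1,…,x_n are exponent vectors: position k (0-based) is the
-- exponent of x_{k+1}.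
Monomial : ℕ → Set
Monomial n = Vec ℕ n

Avoids1432 : ∀ {n} → Permutation′ n → Set
Avoids1432 {n} π = ¬ (Σ (Fin n) λ a → Σ (Fin n) λ b → Σ (Fin n) λ c → Σ (Fin n) λ d →
  (a Data.Fin.< b) × (b Data.Fin.< c) × (c Data.Fin.< d) ×
  ((π ⟨$⟩ʳ a) Data.Fin.< (π ⟨$⟩ʳ d)) × ((π ⟨$⟩ʳ d) Data.Fin.< (π ⟨$⟩ʳ c)) ×
  ((π ⟨$⟩ʳ c) Data.Fin.< (π ⟨$⟩ʳ b)))

-- Pipes: a traced pipe is the list of tiles (row , column) it visits
-- together with the row where it leaves the grid (nothing = ill-formed).

Tiles : Set
Tiles = List (ℕ × ℕ)

_∈ᵇ_ : ℕ × ℕ → Tiles → Bool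
(r , c) ∈ᵇ ts = any (λ { (r' , c') → (r ≡ᵇ r') ∧ (c ≡ᵇ c') }) ts

crossings : (ℕ → ℕ → Bool) → Tiles → Tiles → ℕ
crossings isX p q = length (filterᵇ (λ { (r , c) → isX r c ∧ ((r , c) ∈ᵇ q) }) p)

NoDoubleCrossing : (n : ℕ) → (ℕ → ℕ → Bool) → (Fin n → Tiles) → Set
NoDoubleCrossing n isX pipe = ∀ (p q : Fin n) → p ≢ q → crossings isX (pipe p) (pipe q) ≤ 1

-- TSSCPP boolean triangles of order n.
-- Stored as an n×n boolean matrix T; with 0-based vector indices equal to
-- the paper's indices, T[i][j] = b_{i,j}.  Entries outside the triangle
-- (1 ≤ i ≤ n-1, n-i ≤ j ≤ n-1) are required to be false.

BoolMat : ℕ → Set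
BoolMat n = Vec (Vec Bool n) n

bAt : ∀ {n} → BoolMat n → ℕ → ℕ → Bool
bAt {n} T i j = at false (at (replicate n false) T i) j

bN : ∀ {n} → BoolMat n → ℕ → ℕ → ℕ
bN T i j = b2n (bAt T i j)

IsTSSCPPTriangle : (n : ℕ) → BoolMat n → Set
IsTSSCPPTriangle n T =
  (∀ (i j : Fin n) → lookup (lookup T i) j ≡ true → (1 ≤ toℕ i) × (n ≤ toℕ i + toℕ j))
  × (∀ (i j : ℕ) → 1 ≤ j → j < i → i ≤ n ∸ 1 →
       ∑[ j , i ] (λ k → bN T k (n ∸ j)) ≤ 1 + ∑[ suc j , i ] (λ k → bN T k (n ∸ j ∸ 1)))

-- wt(b) = ∏_{b_{i,j}=1} x_{n-i}: exponent of x_{k+1} is #{j : b_{n-k-1, j} = 1}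
wtTri : ∀ {n} → BoolMat n → Monomial n
wtTri {n} T = tabulate (λ (k : Fin n) → ∑< n (λ j → bN T (n ∸ suc (toℕ k)) j))

-- Pipe dreams (coordinates 1-based as in the paper).

pdCross : ∀ {n} → BoolMat n → ℕ → ℕ → Bool
pdCross {n} T i j =
  (1 ≤ᵇ i) ∧ (i ≤ᵇ n ∸ 1) ∧ (1 ≤ᵇ j) ∧ (j ≤ᵇ n ∸ i) ∧ bAt T (n ∸ i) (i + j ∸ 1)

data PDDir : Set where
  fromN fromE : PDDir

pdTrace : ℕ → (n : ℕ) → (ℕ → ℕ → Bool) → PDDir → ℕ → ℕ → Tiles × Maybe ℕ
pdTrace zero n X d r c = [] , nothing
pdTrace (suc f) n X d r c = go (X r c) d
  where
  west south : Tiles × Maybe ℕ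
  west  = if c ≤ᵇ 1 then ((r , c) ∷ [] , just r)
          else (let t = pdTrace f n X fromE r (c ∸ 1) in ((r , c) ∷ proj₁ t) , proj₂ t)
  south = if n ≤ᵇ r then ((r , c) ∷ [] , nothing)
          else (let t = pdTrace f n X fromN (suc r) c in ((r , c) ∷ proj₁ t) , proj₂ t)
  go : Bool → PDDir → Tiles × Maybe ℕ
  go true  fromN = south
  go true  fromE = west
  go false fromN = west
  go false fromE = south

-- pipe with 0-based label j (paper label j+1) enters above column j+1
pdPipe : ∀ {n} → BoolMat n → Fin n → Tiles × Maybe ℕ
pdPipe {n} T j = pdTrace (2 * n + 2) n (pdCross T) fromN 1 (suc (toℕ j))

-- the associated pipe dream is reduced with permutation π:
-- π(i) = label of the pipe exiting row i, i.e. pipe π(i) exits row i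
PDReducedWith : ∀ {n} → BoolMat n → Permutation′ n → Set
PDReducedWith {n} T π =
  NoDoubleCrossing n (pdCross T) (λ p → proj₁ (pdPipe T p))
  × (∀ (j : Fin n) → proj₂ (pdPipe T j) ≡ just (suc (toℕ (π ⟨$⟩ˡ j))))

TSSCPPred : (n : ℕ) → Permutation′ n → Set
TSSCPPred n π = Σ (BoolMat n) λ T → IsTSSCPPTriangle n T × PDReducedWith T π

-- Bumpless pipe dreams (coordinates 0-based: row 0 is the top row,
-- column 0 the leftmost column).

data Tile : Set where
  cross hor ver rT jT blank : Tile

hasN hasS hasE hasW : Tile → Bool
hasN cross = true
hasN ver   = true
hasN jT    = true
hasN _     = false
hasS cross = true
hasS ver   = true
hasS rT    = true
hasS _     = false
hasE cross = true
hasE hor   = true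
hasE rT    = true
hasE _     = false
hasW cross = true
hasW hor   = true
hasW jT    = true
hasW _     = false

TileMat : ℕ → Set
TileMat n = Vec (Vec Tile n) n

tAt : ∀ {n} → TileMat n → ℕ → ℕ → Tile
tAt {n} D i j = at blank (at (replicate n blank) D i) j

-- The tiling forms n pipes, each entering through the bottom of a column
-- and exiting through the right of a row: pipe ends match along every
-- interior edge, no pipe crosses the north or west border, and every
-- edge of the south and east borders carries a pipe.
IsBPD : (n : ℕ) → TileMat n → Set
IsBPD n D =
  (∀ (i j : ℕ) → i < n → suc j < n → hasE (tAt D i j) ≡ hasW (tAt D i (suc j)))
  × (∀ (i j : ℕ) → suc i < n → j < n → hasS (tAt D i j) ≡ hasN (tAt D (suc i) j))
  × (∀ (j : ℕ) → j < n → hasN (tAt D 0 j) ≡ false)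
  × (∀ (j : ℕ) → j < n → hasS (tAt D (n ∸ 1) j) ≡ true)
  × (∀ (i : ℕ) → i < n → hasW (tAt D i 0) ≡ false)
  × (∀ (i : ℕ) → i < n → hasE (tAt D i (n ∸ 1)) ≡ true)

data BDir : Set where
  fromS fromW : BDir

data BMove : Set where
  up right stuck : BMove

bMove : Tile → BDir → BMove
bMove cross fromS = up
bMove cross fromW = right
bMove hor   fromW = right
bMove ver   fromS = up
bMove rT    fromS = right
bMove jT    fromW = up
bMove _     _     = stuck

bpdTrace : ℕ → (n : ℕ) → TileMat n → BDir → ℕ → ℕ → Tiles × Maybe ℕ
bpdTrace zero n D d r c = [] , nothing
bpdTrace (suc f) n D d r c = go (bMove (tAt D r c) d)
  where
  go : BMove → Tiles × Maybe ℕ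
  go up    = if r ≡ᵇ 0 then ((r , c) ∷ [] , nothing)
             else (let t = bpdTrace f n D fromS (r ∸ 1) c in ((r , c) ∷ proj₁ t) , proj₂ t)
  go right = if n ≤ᵇ suc c then ((r , c) ∷ [] , just r)
             else (let t = bpdTrace f n D fromW r (suc c) in ((r , c) ∷ proj₁ t) , proj₂ t)
  go stuck = (r , c) ∷ [] , nothing

isCrossTile : Tile → Bool
isCrossTile cross = true
isCrossTile _     = false

-- pipe with 0-based label j (paper label j+1) enters the bottom of column j
bpdPipe : ∀ {n} → TileMat n → Fin n → Tiles × Maybe ℕ
bpdPipe {n} D j = bpdTrace (2 * n + 2) n D fromS (n ∸ 1) (toℕ j)

-- reduced with permutation π: pipe π(i) exits row i (0-based rows here)
BPDReducedWith : ∀ {n} → TileMat n → Permutation′ n → Set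
BPDReducedWith {n} D π =
  NoDoubleCrossing n (λ r c → isCrossTile (tAt D r c)) (λ p → proj₁ (bpdPipe D p))
  × (∀ (j : Fin n) → proj₂ (bpdPipe D j) ≡ just (toℕ (π ⟨$⟩ˡ j)))

IntMat : ℕ → Set
IntMat n = Vec (Vec ℤ n) n

_!_!_ : ∀ {n} → IntMat n → Fin n → Fin n → ℤ
A ! i ! j = lookup (lookup A i) j

aAt : ∀ {n} → IntMat n → ℕ → ℕ → ℤ
aAt {n} A i j = at (+ 0) (at (replicate n (+ 0)) A i) j

IsASM : (n : ℕ) → IntMat n → Set
IsASM n A =
  (∀ (i j : Fin n) → (A ! i ! j ≡ + 0) ⊎ (A ! i ! j ≡ + 1) ⊎ (A ! i ! j ≡ -[1+ 0 ]))
  × (∀ (i : ℕ) → i < n → ∑ℤ< n (λ j → aAt A i j) ≡ + 1)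
  × (∀ (j : ℕ) → j < n → ∑ℤ< n (λ i → aAt A i j) ≡ + 1)
  × (∀ (i j j' : Fin n) → j Data.Fin.< j' → A ! i ! j ≢ + 0 → A ! i ! j' ≢ + 0 →
       (∀ (k : Fin n) → j Data.Fin.< k → k Data.Fin.< j' → A ! i ! k ≡ + 0) →
       A ! i ! j ≡ ℤ.- (A ! i ! j'))
  × (∀ (j i i' : Fin n) → i Data.Fin.< i' → A ! i ! j ≢ + 0 → A ! i' ! j ≢ + 0 →
       (∀ (k : Fin n) → i Data.Fin.< k → k Data.Fin.< i' → A ! k ! j ≡ + 0) →
       A ! i ! j ≡ ℤ.- (A ! i' ! j))

BPDOf : ∀ {n} → IntMat n → TileMat n → Set
BPDOf A D = ∀ i j →
  ((lookup (lookup D i) j ≡ rT → A ! i ! j ≡ + 1) × (A ! i ! j ≡ + 1 → lookup (lookup D i) j ≡ rT))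
  × ((lookup (lookup D i) j ≡ jT → A ! i ! j ≡ -[1+ 0 ]) × (A ! i ! j ≡ -[1+ 0 ] → lookup (lookup D i) j ≡ jT))

-- ASM^red(π): ASMs whose (unique) BPD is reduced with permutation π
ASMred : (n : ℕ) → Permutation′ n → Set
ASMred n π = Σ (IntMat n) λ A → IsASM n A ×
  (Σ (TileMat n) λ D → IsBPD n D × BPDOf A D × BPDReducedWith D π)

isZeroℤ : ℤ → Bool
isZeroℤ (+ zero) = true
isZeroℤ _        = false

wtASM : ∀ {n} → IntMat n → Monomial n
wtASM {n} A = tabulate (λ (i : Fin n) → ∑< n (λ j →
  b2n (isZeroℤ (aAt A (toℕ i) j)
       ∧ isZeroℤ (∑ℤ< (suc (toℕ i)) (λ i' → aAt A i' j))
       ∧ isZeroℤ (∑ℤ< (suc j) (λ j' → aAt A (toℕ i) j')))))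

{-# OPTIONS --safe #-}
module Submission where

-- Pipe dreams and bumpless pipe dreams are both read row by row, the pipes being labelled by the column
-- in which they start. A classic row and a bumpless row turned upside down carry their horizontal lines
-- in opposite directions, and the two tiles of a column satisfy a Yang–Baxter equation; moving its
-- braid through all columns shows that the two rows commute. So the bottom row of a pipe dream, where
-- one pipe is left and the two kinds of rows agree, can be made bumpless, then exchanged with the rows
-- above, and so on until all rows are bumpless. The generating functions of the reduced pipe dreams
-- and of the reduced bumpless pipe dreams with permutation π are therefore equal, and a
-- weight-preserving bijection follows by counting; it is restricted to the pipe dreams of triangles.
--
-- If the inequality of a triangle fails, choose the failure closest to the bottom. There a pipe q
-- crosses a pipe p < q, turns at the next tile, and runs down an antidiagonal until a pipe h > q
-- crosses it, so that h, q, p leave in this order. Some smaller label than p leaves above h, since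
-- otherwise all tiles in the upper left corner up to the row of h and the column p would be crosses,
-- including the tile where q turned. This is the pattern 1432.

open import Defs
open import Data.Bool using (Bool; true; false; if_then_else_; not; _∧_; T)
open import Data.Bool.Properties using (T?)
open import Data.Empty using (⊥; ⊥-elim)
open import Data.Fin as Fin using (Fin; toℕ; fromℕ; inject₁; opposite; fromℕ<; zero; suc)
import Data.Fin.Properties as Finₚ
open import Data.Fin.Permutation using (Permutation′; _⟨$⟩ʳ_; _⟨$⟩ˡ_; inverseˡ; inverseʳ)
open import Data.Integer as ℤ using (ℤ; 0ℤ; 1ℤ; -1ℤ)
import Data.Integer.Properties as ℤₚ
open import Data.Integer.Solver using (module +-*-Solver)
open import Data.List as List using (List; []; _∷_; _++_; cartesianProductWith; filterᵇ; foldr; length; upTo)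
import Data.List.Properties as Listₚ
open import Data.List.Membership.Propositional using (_∈_)
open import Data.List.Membership.Propositional.Properties
  using (∈-∃++; ∈-cartesianProductWith⁺; ∈-filter⁺; ∈-filter⁻; ∈-map⁺; ∈-map⁻)
open import Data.List.Relation.Binary.Permutation.Propositional
  using (_↭_; ↭-sym; ↭-trans; prep; ↭⇒↭ₛ) renaming (refl to ↭-refl)
import Data.List.Relation.Binary.Permutation.Propositional.Properties as ↭ₚ
import Data.List.Relation.Binary.Permutation.Setoid.Properties as ↭ₛ
open import Data.List.Relation.Unary.All as All using (All; []; _∷_)
import Data.List.Relation.Unary.All.Properties as Allₚ
open import Data.List.Relation.Unary.AllPairs using ([]; _∷_)
open import Data.List.Relation.Unary.Any using (here; there)
open import Data.List.Relation.Unary.Unique.Propositional using (Unique)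
import Data.List.Relation.Unary.Unique.Propositional.Properties as Uniqueₚ
open import Data.Maybe as Maybe using (Maybe; just; nothing)
import Data.Maybe.Properties as Maybeₚ
open import Data.Nat
open import Data.Nat.DivMod using ([m+kn]%n≡m%n; m<n⇒m%n≡m)
open import Data.Nat.ListAction using (sum)
open import Data.Nat.Properties
open import Data.Product using (Σ; ∃; ∃₂; _×_; _,_; proj₁; proj₂)
open import Data.Sum using (_⊎_; inj₁; inj₂; swap)
open import Data.Vec as Vec using (Vec; []; _∷_; _∷ʳ_; lookup; replicate; reverse; tabulate)
import Data.Vec.Properties as Vecₚ
open import Data.Vec.Relation.Unary.All as VAll using ([]; _∷_)
open import Function using (id; _∘_)
open import Relation.Binary.Definitions using (tri<; tri≈; tri>)
open import Relation.Binary.PropositionalEquality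
open import Relation.Nullary using (¬_; Dec; contradiction; yes; no)
open import Algebra.Properties.AbelianGroup ℤₚ.+-0-abelianGroup using (∙-cancelˡ)
open import Algebra.Properties.CommutativeSemigroup +-commutativeSemigroup using (x∙yz≈y∙xz)
open ≡-Reasoning
open +-*-Solver using (Polynomial; solve; con; _:+_; _:*_; _:-_; _:=_)

-- Reducedness concerns whole pipes, a row transfer only single tiles. After crossing once, two
-- pipes are out of order along the cut, so a second crossing is a tile whose incoming labels are
-- out of order; forbidding such tiles makes reducedness local, and prescribing the label that
-- leaves each row fixes π. The exit labels have a second use: being nonzero, they remove the
-- unwanted terms of the braid at both ends of the rows, among them the one with coefficient
-- `y - x`. The generating functions are never handled as polynomials. One evaluation suffices, at
-- x_i = N^((n+1)^(i-1)): a row has at most n weighted tiles, so base n + 1 encodes an exponent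
-- vector as one number, and N exceeds the number of pipe dreams of either kind, so the base-N
-- digits of the value count the pipe dreams of each weight. A pipe dream occurs in three forms: a
-- tiling with traced pipes as in the definitions, a filling accepted by a boolean test as in the
-- enumeration, and label functions `V`, `H` on the edges, which mediate between the other two.

private variable
  A E F : Set
  n m : ℕ

-- Row transfer and the Yang–Baxter equation

-- A formal ℤ-linear combination, with repetitions allowed; `⟦ s ⟧ f` is the linear extension of
-- `f`. Outcomes are passed to a continuation, so no set of intermediate states has to be summed
-- over.
Weighted : Set → Set
Weighted A = List (ℤ × A)

⟦_⟧ : Weighted A → (A → ℤ) → ℤ
⟦ [] ⟧ f = 0ℤ
⟦ (k , a) ∷ s ⟧ f = k ℤ.* f a ℤ.+ ⟦ s ⟧ f

⟦⟧-cong : ∀ (s : Weighted A) {f g} → (∀ a → f a ≡ g a) → ⟦ s ⟧ f ≡ ⟦ s ⟧ g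
⟦⟧-cong [] e = refl
⟦⟧-cong ((k , a) ∷ s) e = cong₂ ℤ._+_ (cong (k ℤ.*_) (e a)) (⟦⟧-cong s e)

⟦⟧-linear : ∀ (s : Weighted A) k f g →
  ⟦ s ⟧ (λ a → k ℤ.* f a ℤ.+ g a) ≡ k ℤ.* ⟦ s ⟧ f ℤ.+ ⟦ s ⟧ g
⟦⟧-linear [] k f g = solve 1 (λ k → con 0ℤ := k :* con 0ℤ :+ con 0ℤ) refl k
⟦⟧-linear ((c , a) ∷ s) k f g = trans (cong (λ z → c ℤ.* _ ℤ.+ z) (⟦⟧-linear s k f g))
  (solve 6 (λ c k u v p q → c :* (k :* u :+ v) :+ (k :* p :+ q) := k :* (c :* u :+ p) :+ (c :* v :+ q))
    refl c k (f a) (g a) (⟦ s ⟧ f) (⟦ s ⟧ g))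

⟦⟧-0 : ∀ (s : Weighted A) → ⟦ s ⟧ (λ _ → 0ℤ) ≡ 0ℤ
⟦⟧-0 [] = refl
⟦⟧-0 ((k , a) ∷ s) rewrite ℤₚ.*-zeroʳ k | ⟦⟧-0 s = refl

⟦⟧-comm : ∀ (s : Weighted A) (t : Weighted E) (f : A → E → ℤ) →
  ⟦ s ⟧ (λ a → ⟦ t ⟧ (f a)) ≡ ⟦ t ⟧ (λ b → ⟦ s ⟧ (λ a → f a b))
⟦⟧-comm s [] f = ⟦⟧-0 s
⟦⟧-comm s ((k , b) ∷ t) f = trans (⟦⟧-linear s k (λ a → f a b) (λ a → ⟦ t ⟧ (f a)))
  (cong (λ z → k ℤ.* ⟦ s ⟧ (λ a → f a b) ℤ.+ z) (⟦⟧-comm s t f))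

-- A tile receives the label v of its vertical and the label h of its horizontal incoming edge, with 0
-- for an edge without a pipe, and returns the labels of its vertical and horizontal outgoing edges.
TileRule : Set
TileRule = ℕ → ℕ → Weighted (ℕ × ℕ)

rowL rowR : TileRule → Vec ℕ n → ℕ → (Vec ℕ n → ℕ → ℤ) → ℤ
rowL t []       h f = f [] h
rowL t (v ∷ vs) h f = ⟦ t v h ⟧ λ (w , h₁) → rowL t vs h₁ λ ws h₂ → f (w ∷ ws) h₂
rowR t []       h f = f [] h
rowR t (v ∷ vs) h f = rowR t vs h λ ws h₁ → ⟦ t v h₁ ⟧ λ (w , h₂) → f (w ∷ ws) h₂

rowL-cong : ∀ t (vs : Vec ℕ n) h {f g} → (∀ ws k → f ws k ≡ g ws k) → rowL t vs h f ≡ rowL t vs h g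
rowL-cong t []       h e = e [] h
rowL-cong t (v ∷ vs) h e = ⟦⟧-cong (t v h) λ (w , h₁) → rowL-cong t vs h₁ λ ws k → e (w ∷ ws) k

rowR-cong : ∀ t (vs : Vec ℕ n) h {f g} → (∀ ws k → f ws k ≡ g ws k) → rowR t vs h f ≡ rowR t vs h g
rowR-cong t []       h e = e [] h
rowR-cong t (v ∷ vs) h e = rowR-cong t vs h λ ws h₁ → ⟦⟧-cong (t v h₁) λ (w , k) → e (w ∷ ws) k

-- Fubini for a row and an independent combination. `train` uses it to move the tiles of one column
-- past the tiles of all others.
rowL-comm : ∀ t (vs : Vec ℕ n) h (s : Weighted E) (f : Vec ℕ n → ℕ → E → ℤ) →
  rowL t vs h (λ ws k → ⟦ s ⟧ (f ws k)) ≡ ⟦ s ⟧ (λ b → rowL t vs h (λ ws k → f ws k b))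
rowL-comm t []       h s f = refl
rowL-comm t (v ∷ vs) h s f = trans
  (⟦⟧-cong (t v h) λ (w , h₁) → rowL-comm t vs h₁ s λ ws → f (w ∷ ws))
  (⟦⟧-comm (t v h) s _)

rowR-comm : ∀ t (vs : Vec ℕ n) h (s : Weighted E) (f : Vec ℕ n → ℕ → E → ℤ) →
  rowR t vs h (λ ws k → ⟦ s ⟧ (f ws k)) ≡ ⟦ s ⟧ (λ b → rowR t vs h (λ ws k → f ws k b))
rowR-comm t []       h s f = refl
rowR-comm t (v ∷ vs) h s f = trans
  (rowR-cong t vs h λ ws h₁ → ⟦⟧-comm (t v h₁) s _)
  (rowR-comm t vs h s _)

-- Pipes run downwards in both kinds of rows: a bumpless pipe dream is turned upside down. They leave
-- a bumpless row on the right (rowL) and a classic one on the left (rowR). Reducedness is local: two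
-- pipes may cross only if their labels are still in the initial order at the crossing.
classic bumpless : ℤ → TileRule
classic x v h = (1ℤ , h , v) ∷ ((if v <ᵇ h then x else 0ℤ) , v , h) ∷ []
bumpless y zero    zero    = (y , 0 , 0) ∷ []
bumpless y zero    (suc h) = (1ℤ , 0 , suc h) ∷ (1ℤ , suc h , 0) ∷ []
bumpless y (suc v) zero    = (1ℤ , suc v , 0) ∷ (1ℤ , 0 , suc v) ∷ []
bumpless y (suc v) (suc h) = ((if h <ᵇ v then 1ℤ else 0ℤ) , suc v , suc h) ∷ []

-- The horizontal lines of a classic row of weight x and a bumpless row of weight y cross with
-- these weights. The negative coefficient in y - x is why sums are taken in ℤ and the bijection is
-- obtained by counting instead of by a local rule.
braid : ℤ → ℤ → ℕ → ℕ → Weighted (ℕ × ℕ)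
braid x y zero    zero    = (y ℤ.- x , 0 , 0) ∷ []
braid x y zero    (suc c) = (1ℤ , suc c , 0) ∷ (1ℤ , 0 , suc c) ∷ []
braid x y (suc b) zero    = (1ℤ , 0 , suc b) ∷ (1ℤ , suc b , 0) ∷ []
braid x y (suc b) (suc c) = ((if b <ᵇ c then 1ℤ else 0ℤ) , suc c , suc b) ∷ []

-- These build the unsimplified sums to which `⟦_⟧` computes: `wt` for a rule with one outcome,
-- `two` for two outcomes of weight 1, `br` for a classic tile whose turn has weight 1 and whose
-- cross has weight `k`. The equations passed to `solve` then match the goals directly.
private
  Poly : ℕ → Set
  Poly = Polynomial
  𝟘 𝟙 : Poly n
  𝟘 = con 0ℤ
  𝟙 = con 1ℤ
  wt : Poly n → Poly n → Poly n
  wt k p = k :* p :+ 𝟘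
  two : Poly n → Poly n → Poly n
  two p q = 𝟙 :* p :+ wt 𝟙 q
  br : Poly n → Poly n → Poly n → Poly n
  br k p q = 𝟙 :* p :+ wt k q

≡ᵇ-refl : ∀ c → (c ≡ᵇ c) ≡ true
≡ᵇ-refl zero    = refl
≡ᵇ-refl (suc c) = ≡ᵇ-refl c

<ᵇ-asym : ∀ v c → (v <ᵇ c) ≡ true → (c <ᵇ v) ≢ true
<ᵇ-asym v c p q = <-asym (<ᵇ⇒< v c (subst T (sym p) _)) (<ᵇ⇒< c v (subst T (sym q) _))

rowL-vanish : ∀ t (vs : Vec ℕ n) h {f} → (∀ ws k → f ws k ≡ 0ℤ) → rowL t vs h f ≡ 0ℤ
rowL-vanish t []       h e = e [] h
rowL-vanish t (v ∷ vs) h e = trans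
  (⟦⟧-cong (t v h) λ (w , h₁) → rowL-vanish t vs h₁ λ ws → e (w ∷ ws)) (⟦⟧-0 (t v h))

rowR-vanish : ∀ t (vs : Vec ℕ n) h {f} → (∀ ws k → f ws k ≡ 0ℤ) → rowR t vs h f ≡ 0ℤ
rowR-vanish t []       h e = e [] h
rowR-vanish t (v ∷ vs) h e = rowR-vanish t vs h λ ws h₁ → trans
  (⟦⟧-cong (t v h₁) λ (w , k) → e (w ∷ ws) k) (⟦⟧-0 (t v h₁))

-- The values of `f` are independent unknowns, so each pattern of empty edges is a polynomial
-- identity. Where a comparison and its converse both occur, asymmetry excludes that both hold; if
-- the first fails, the second is left open, which covers equal labels as well. With three pipes
-- present, both sides contain the same three comparisons as factors.
yang-baxter : ∀ x y v b c (f : ℕ → ℕ → ℕ → ℤ) →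
  (⟦ classic x v c ⟧ λ (m , c₁) → ⟦ braid x y b c₁ ⟧ λ (c₂ , b₁) → ⟦ bumpless y m b₁ ⟧ λ (w , b₂) → f w b₂ c₂)
  ≡ (⟦ bumpless y v b ⟧ λ (m , b₁) → ⟦ braid x y b₁ c ⟧ λ (c₁ , b₂) → ⟦ classic x m c₁ ⟧ λ (w , c₂) → f w b₂ c₂)
yang-baxter x y zero zero zero f = solve 3 (λ x y p →
  br 𝟘 (wt (y :- x) (wt y p)) (wt (y :- x) (wt y p)) := wt y (wt (y :- x) (br 𝟘 p p))) refl x y (f 0 0 0)
yang-baxter x y zero zero (suc c) f = solve 5 (λ x y p q r →
  br x (wt (y :- x) (two p q)) (two (wt y r) (two q p)) := wt y (two (br x p r) (br 𝟘 q q)))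
  refl x y (f (suc c) 0 0) (f 0 (suc c) 0) (f 0 0 (suc c))
yang-baxter x y zero (suc b) zero f = solve 5 (λ x y p q r →
  br 𝟘 (two (two q p) (wt y r)) (two (two q p) (wt y r))
    := two (two (br 𝟘 q q) (br x p r)) (wt (y :- x) (br 𝟘 r p)))
  refl x y (f (suc b) 0 0) (f 0 (suc b) 0) (f 0 0 (suc b))
yang-baxter x y zero (suc b) (suc c) f with b <ᵇ c
... | true  = solve 7 (λ x p q r s t z →
  br x (two (wt 𝟙 p) (two q r)) (wt 𝟙 (two s t)) := two (wt 𝟙 (br x p s)) (two (br x q t) (br 𝟘 r z)))
  refl x (f (suc c) (suc b) 0) (f (suc c) 0 (suc b)) (f 0 (suc c) (suc b))
  (f 0 (suc b) (suc c)) (f (suc b) 0 (suc c)) (f (suc b) (suc c) 0)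
... | false = solve 7 (λ x p q r s t z →
  br x (two (wt 𝟘 p) (two q r)) (wt 𝟘 (two s t)) := two (wt 𝟘 (br x p s)) (two (br 𝟘 q t) (br 𝟘 r z)))
  refl x (f (suc c) (suc b) 0) (f (suc c) 0 (suc b)) (f 0 (suc c) (suc b))
  (f 0 (suc b) (suc c)) (f (suc b) 0 (suc c)) (f (suc b) (suc c) 0)
yang-baxter x y (suc v) zero zero f = solve 5 (λ x y p q r →
  br 𝟘 (two (wt y r) (two q p)) (wt (y :- x) (two p q))
    := two (wt (y :- x) (br 𝟘 r p)) (two (br 𝟘 q q) (br x p r)))
  refl x y (f (suc v) 0 0) (f 0 (suc v) 0) (f 0 0 (suc v))
yang-baxter x y (suc v) zero (suc c) f with v <ᵇ c | c <ᵇ v | <ᵇ-asym v c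
... | true | true | a = contradiction refl (a refl)
... | true | false | _ = solve 7 (λ x p q r s t z →
  br x (two (two q r) (wt 𝟙 p)) (two (two s t) (wt 𝟘 z)) := two (two (br x q s) (br 𝟘 r z)) (wt 𝟙 (br x p t)))
  refl x (f (suc c) (suc v) 0) (f (suc c) 0 (suc v)) (f 0 (suc c) (suc v))
  (f (suc v) 0 (suc c)) (f 0 (suc v) (suc c)) (f (suc v) (suc c) 0)
... | false | g | _ = solve 8 (λ x p q r s t z e →
  br 𝟘 (two (two q r) (wt 𝟘 p)) (two (two s t) (wt e z)) := two (two (br 𝟘 q s) (br 𝟘 r z)) (wt 𝟘 (br x p t)))
  refl x (f (suc c) (suc v) 0) (f (suc c) 0 (suc v)) (f 0 (suc c) (suc v))
  (f (suc v) 0 (suc c)) (f 0 (suc v) (suc c)) (f (suc v) (suc c) 0) (if g then 1ℤ else 0ℤ)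
yang-baxter x y (suc v) (suc b) zero f with b <ᵇ v | v <ᵇ b | <ᵇ-asym v b
... | true | true | a = contradiction refl (a refl)
... | true | false | _ = solve 6 (λ x p q r s t →
  br 𝟘 (wt 𝟙 (two p q)) (two (wt 𝟙 r) (two s t)) := wt 𝟙 (two (br 𝟘 p r) (br 𝟘 q s)))
  refl x (f 0 (suc b) (suc v)) (f (suc b) 0 (suc v)) (f (suc v) (suc b) 0)
  (f (suc v) 0 (suc b)) (f 0 (suc v) (suc b))
... | false | g | _ = solve 7 (λ x p q r s t e →
  br 𝟘 (wt 𝟘 (two p q)) (two (wt 𝟘 r) (two s t)) := wt 𝟘 (two (br 𝟘 p r) (br e q s)))
  refl x (f 0 (suc b) (suc v)) (f (suc b) 0 (suc v)) (f (suc v) (suc b) 0)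
  (f (suc v) 0 (suc b)) (f 0 (suc v) (suc b)) (if g then x else 0ℤ)
yang-baxter x y (suc v) (suc b) (suc c) f = solve 5 (λ h g e p q →
  br h (wt g (wt e p)) (wt e (wt g q)) := wt g (wt e (br h p q)))
  refl (if v <ᵇ c then x else 0ℤ) (if b <ᵇ v then 1ℤ else 0ℤ) (if b <ᵇ c then 1ℤ else 0ℤ)
  (f (suc c) (suc b) (suc v)) (f (suc v) (suc b) (suc c))

train : ∀ x y (vs : Vec ℕ n) b c (f : Vec ℕ n → ℕ → ℕ → ℤ) →
  (rowR (classic x) vs c λ ms c₁ → ⟦ braid x y b c₁ ⟧ λ (c₂ , b₁) →
    rowL (bumpless y) ms b₁ λ ws b₂ → f ws b₂ c₂)
  ≡ (rowL (bumpless y) vs b λ ms b₁ → ⟦ braid x y b₁ c ⟧ λ (c₁ , b₂) →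
    rowR (classic x) ms c₁ λ ws c₂ → f ws b₂ c₂)
train x y [] b c f = refl
train x y (v ∷ vs) b c f = begin
  (rowR C vs c λ ms c₁ → ⟦ C v c₁ ⟧ λ (m , c₂) → ⟦ braid x y b c₂ ⟧ λ (c₃ , b₁) → ⟦ B m b₁ ⟧ λ (w , b₂) →
    rowL B ms b₂ λ ws b₃ → f (w ∷ ws) b₃ c₃)
    ≡⟨ (rowR-cong C vs c λ ms c₁ → yang-baxter x y v b c₁ λ w b₂ c₃ → rowL B ms b₂ λ ws b₃ → f (w ∷ ws) b₃ c₃) ⟩
  (rowR C vs c λ ms c₁ → ⟦ B v b ⟧ λ (m , b₁) → ⟦ braid x y b₁ c₁ ⟧ λ (c₂ , b₂) → ⟦ C m c₂ ⟧ λ (w , c₃) →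
    rowL B ms b₂ λ ws b₃ → f (w ∷ ws) b₃ c₃)
    -- The bumpless tile of the first column now reads only `v` and `b`, so it can be evaluated
    -- before the classic tiles of the other columns.
    ≡⟨ rowR-comm C vs c (B v b) _ ⟩
  (⟦ B v b ⟧ λ (m , b₁) → rowR C vs c λ ms c₁ → ⟦ braid x y b₁ c₁ ⟧ λ (c₂ , b₂) → ⟦ C m c₂ ⟧ λ (w , c₃) →
    rowL B ms b₂ λ ws b₃ → f (w ∷ ws) b₃ c₃)
    ≡⟨ (⟦⟧-cong (B v b) λ (m , b₁) → rowR-cong C vs c λ ms c₁ → ⟦⟧-cong (braid x y b₁ c₁) λ (c₂ , b₂) →
      sym (rowL-comm B ms b₂ (C m c₂) λ ws b₃ (w , c₃) → f (w ∷ ws) b₃ c₃)) ⟩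
  (⟦ B v b ⟧ λ (m , b₁) → rowR C vs c λ ms c₁ → ⟦ braid x y b₁ c₁ ⟧ λ (c₂ , b₂) →
    rowL B ms b₂ λ ws b₃ → ⟦ C m c₂ ⟧ λ (w , c₃) → f (w ∷ ws) b₃ c₃)
    ≡⟨ (⟦⟧-cong (B v b) λ (m , b₁) → train x y vs b₁ c λ ws b₃ c₂ → ⟦ C m c₂ ⟧ λ (w , c₃) → f (w ∷ ws) b₃ c₃) ⟩
  (⟦ B v b ⟧ λ (m , b₁) → rowL B vs b₁ λ ms b₂ → ⟦ braid x y b₂ c ⟧ λ (c₁ , b₃) →
    rowR C ms c₁ λ ws c₂ → ⟦ C m c₂ ⟧ λ (w , c₃) → f (w ∷ ws) b₃ c₃) ∎
  where
  C B : TileRule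
  C = classic x
  B = bumpless y

-- The hypotheses on `f` say that a pipe leaves each of the two rows. One line of the braid is empty
-- at either end, so every term of the braid either gives one row the exit label 0, and is killed,
-- or has coefficient 1 and lets both lines through unchanged.
rows-commute : ∀ x y (vs : Vec ℕ n) (f : Vec ℕ n → ℕ → ℕ → ℤ) →
  (∀ ws b → f ws b 0 ≡ 0ℤ) → (∀ ws c → f ws 0 c ≡ 0ℤ) →
  (rowR (classic x) vs 0 λ ms c → rowL (bumpless y) ms 0 λ ws b → f ws b c)
  ≡ (rowL (bumpless y) vs 0 λ ms b → rowR (classic x) ms 0 λ ws c → f ws b c)
rows-commute x y vs f f-c0 f-b0 =
  trans (rowR-cong (classic x) vs 0 λ ms c → sym (west ms c))
  (trans (train x y vs 0 0 f) (rowL-cong (bumpless y) vs 0 east))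
  where
  west : ∀ ms c → (⟦ braid x y 0 c ⟧ λ (c₂ , b₁) → rowL (bumpless y) ms b₁ λ ws b → f ws b c₂)
                  ≡ (rowL (bumpless y) ms 0 λ ws b → f ws b c)
  west ms zero rewrite rowL-vanish (bumpless y) ms 0 (λ ws b → f-c0 ws b) = solve 1
    (λ k → k :* 𝟘 :+ 𝟘 := 𝟘) refl (y ℤ.- x)
  west ms (suc c) rewrite rowL-vanish (bumpless y) ms (suc c) (λ ws b → f-c0 ws b) =
    solve 1 (λ p → two p 𝟘 := p) refl _
  east : ∀ ms b → (⟦ braid x y b 0 ⟧ λ (c₁ , b₂) → rowR (classic x) ms c₁ λ ws c → f ws b₂ c)
                  ≡ (rowR (classic x) ms 0 λ ws c → f ws b c)
  east ms zero rewrite rowR-vanish (classic x) ms 0 (λ ws b → f-b0 ws b) = solve 1 (λ k → k :* 𝟘 :+ 𝟘 := 𝟘) refl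
    (y ℤ.- x)
  east ms (suc b) rewrite rowR-vanish (classic x) ms (suc b) (λ ws b → f-b0 ws b) =
    solve 1 (λ p → two p 𝟘 := p) refl _

-- Generating functions of stacked rows, and the exchange of all rows

[_]ℤ : Bool → ℤ
[ b ]ℤ = if b then 1ℤ else 0ℤ

empty : Vec ℕ n → Bool
empty []       = true
empty (v ∷ vs) = (v ≡ᵇ 0) ∧ empty vs

-- The exit label is `suc e`, so that label 0 is free to stand for an edge without a pipe.
runClassic runBumpless : Vec (ℕ × ℤ) m → Vec ℕ n → ℤ
runClassic []             v = [ empty v ]ℤ
runClassic ((e , x) ∷ es) v = rowR (classic x) v 0 λ w h → [ h ≡ᵇ suc e ]ℤ ℤ.* runClassic es w
runBumpless []             v = [ empty v ]ℤ
runBumpless ((e , x) ∷ es) v = rowL (bumpless x) v 0 λ w h → [ h ≡ᵇ suc e ]ℤ ℤ.* runBumpless es w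

-- A label that has been picked up must run straight to the end: dropping it, or crossing another
-- label, leaves a nonempty edge below the row.
rowL-carry-empty : ∀ x (v : Vec ℕ n) b (g : ℕ → ℤ) →
  rowL (bumpless x) v (suc b) (λ w h → g h ℤ.* [ empty w ]ℤ) ≡ g (suc b) ℤ.* [ empty v ]ℤ
rowL-carry-empty x [] b g = refl
rowL-carry-empty x (zero ∷ v) b g
  rewrite rowL-carry-empty x v b g
        | rowL-vanish (bumpless x) v 0 {λ w h → g h ℤ.* 0ℤ} (λ w h → ℤₚ.*-zeroʳ (g h))
  = solve 1 (λ p → con 1ℤ :* p :+ (con 1ℤ :* con 0ℤ :+ con 0ℤ) := p) refl _
rowL-carry-empty x (suc a ∷ v) b g
  rewrite rowL-vanish (bumpless x) v (suc b) {λ w h → g h ℤ.* 0ℤ} (λ w h → ℤₚ.*-zeroʳ (g h))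
  = solve 2 (λ k p → k :* con 0ℤ :+ con 0ℤ := p :* con 0ℤ) refl ([ b <ᵇ a ]ℤ) (g (suc b))

-- A label in `v` cannot disappear: it ends below the row or leaves it on the left, and the
-- indicators exclude both. `last-row` needs this for the columns to the right of its leftmost pipe.
rowR-no-exit : ∀ x (v : Vec ℕ n) k →
  rowR (classic x) v 0 (λ w h → k ℤ.* [ h ≡ᵇ 0 ]ℤ ℤ.* [ empty w ]ℤ) ≡ k ℤ.* [ empty v ]ℤ
rowR-no-exit x [] k = cong (ℤ._* 1ℤ) (ℤₚ.*-identityʳ k)
rowR-no-exit x (zero ∷ v) k = trans
  (rowR-cong (classic x) v 0 {g = λ w h → k ℤ.* [ h ≡ᵇ 0 ]ℤ ℤ.* [ empty w ]ℤ} λ where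
    w zero    → solve 2 (λ k p → con 1ℤ :* (k :* con 1ℤ :* p) :+ (con 0ℤ :* (k :* con 1ℤ :* p) :+ con 0ℤ)
                  := k :* con 1ℤ :* p) refl k ([ empty w ]ℤ)
    w (suc h) → solve 3 (λ k p x → con 1ℤ :* (k :* con 1ℤ :* con 0ℤ) :+ (x :* (k :* con 0ℤ :* p) :+ con 0ℤ)
                  := k :* con 0ℤ :* p) refl k ([ empty w ]ℤ) x)
  (rowR-no-exit x v k)
rowR-no-exit x (suc a ∷ v) k = trans
  (rowR-vanish (classic x) v 0 λ w h →
    solve 4 (λ k p q z → con 1ℤ :* (k :* con 0ℤ :* p) :+ (z :* (q :* con 0ℤ) :+ con 0ℤ)
                  := con 0ℤ) refl k ([ empty (h ∷ w) ]ℤ) (k ℤ.* [ h ≡ᵇ 0 ]ℤ) (if suc a <ᵇ h then x else 0ℤ))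
  (sym (ℤₚ.*-zeroʳ k))

-- A single pipe is left in the last row: both kinds of row give weight x to the tiles on its left.
last-row : ∀ x (v : Vec ℕ n) (g : ℕ → ℤ) → g 0 ≡ 0ℤ →
  rowR (classic x) v 0 (λ w h → g h ℤ.* [ empty w ]ℤ) ≡ rowL (bumpless x) v 0 (λ w h → g h ℤ.* [ empty w ]ℤ)
last-row x [] g g0 = refl
last-row x (zero ∷ v) g g0 = begin
  rowR (classic x) (zero ∷ v) 0 (λ w h → g h ℤ.* [ empty w ]ℤ)
    ≡⟨ (rowR-cong (classic x) v 0 λ where
      w zero    → trans (cong (λ z → 1ℤ ℤ.* (z ℤ.* [ empty w ]ℤ) ℤ.+ (0ℤ ℤ.* (z ℤ.* [ empty w ]ℤ) ℤ.+ 0ℤ)) g0)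
                   (trans (solve 2 (λ x p → con 1ℤ :* (con 0ℤ :* p) :+ (con 0ℤ :* (con 0ℤ :* p) :+ con 0ℤ)
                      := x :* (con 0ℤ :* p) :+ con 0ℤ) refl x ([ empty w ]ℤ))
                     (cong (λ z → x ℤ.* (z ℤ.* [ empty w ]ℤ) ℤ.+ 0ℤ) (sym g0)))
      w (suc h) → solve 4 (λ z p x g → con 1ℤ :* (z :* con 0ℤ) :+ (x :* (g :* p) :+ con 0ℤ)
                    := x :* (g :* p) :+ con 0ℤ) refl (g 0) ([ empty w ]ℤ) x (g (suc h))) ⟩
  rowR (classic x) v 0 (λ w h → ⟦ (x , h) ∷ [] ⟧ λ k → g k ℤ.* [ empty w ]ℤ)
    ≡⟨ rowR-scale ⟩
  x ℤ.* rowR (classic x) v 0 (λ w h → g h ℤ.* [ empty w ]ℤ) ℤ.+ 0ℤ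
    ≡⟨ cong (λ z → x ℤ.* z ℤ.+ 0ℤ) (last-row x v g g0) ⟩
  rowL (bumpless x) (zero ∷ v) 0 (λ w h → g h ℤ.* [ empty w ]ℤ) ∎
  where
  rowR-scale : rowR (classic x) v 0 (λ w h → ⟦ (x , h) ∷ [] ⟧ λ k → g k ℤ.* [ empty w ]ℤ)
    ≡ x ℤ.* rowR (classic x) v 0 (λ w h → g h ℤ.* [ empty w ]ℤ) ℤ.+ 0ℤ
  rowR-scale = rowR-comm (classic x) v 0 ((x , 0) ∷ []) (λ w h _ → g h ℤ.* [ empty w ]ℤ)
last-row x (suc a ∷ v) g g0 = begin
  rowR (classic x) (suc a ∷ v) 0 (λ w h → g h ℤ.* [ empty w ]ℤ)
    ≡⟨ (rowR-cong (classic x) v 0 λ w h → trans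
        (solve 4 (λ k p q z → con 1ℤ :* (k :* p) :+ (z :* (q :* con 0ℤ) :+ con 0ℤ) := k :* p) refl
          (g (suc a)) ([ (h ≡ᵇ 0) ∧ empty w ]ℤ) (g h) (if suc a <ᵇ h then x else 0ℤ))
        (trans (cong (λ z → g (suc a) ℤ.* z) ([∧] (h ≡ᵇ 0) (empty w)))
          (sym (ℤₚ.*-assoc (g (suc a)) ([ h ≡ᵇ 0 ]ℤ) ([ empty w ]ℤ))))) ⟩
  rowR (classic x) v 0 (λ w h → g (suc a) ℤ.* [ h ≡ᵇ 0 ]ℤ ℤ.* [ empty w ]ℤ)
    ≡⟨ rowR-no-exit x v (g (suc a)) ⟩
  g (suc a) ℤ.* [ empty v ]ℤ
    ≡⟨ solve 1 (λ p → p := con 1ℤ :* con 0ℤ :+ (con 1ℤ :* p :+ con 0ℤ)) refl (g (suc a) ℤ.* [ empty v ]ℤ) ⟩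
  1ℤ ℤ.* 0ℤ ℤ.+ (1ℤ ℤ.* (g (suc a) ℤ.* [ empty v ]ℤ) ℤ.+ 0ℤ)
    ≡⟨ cong₂ (λ p q → 1ℤ ℤ.* p ℤ.+ (1ℤ ℤ.* q ℤ.+ 0ℤ))
         (sym (rowL-vanish (bumpless x) v 0 {λ w h → g h ℤ.* 0ℤ} λ w h → ℤₚ.*-zeroʳ (g h)))
         (sym (rowL-carry-empty x v a g)) ⟩
  rowL (bumpless x) (suc a ∷ v) 0 (λ w h → g h ℤ.* [ empty w ]ℤ) ∎
  where
  [∧] : ∀ a b → [ a ∧ b ]ℤ ≡ [ a ]ℤ ℤ.* [ b ]ℤ
  [∧] true  b = sym (ℤₚ.*-identityˡ [ b ]ℤ)
  [∧] false b = refl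

rowL-scale : ∀ t (vs : Vec ℕ n) h k (f : Vec ℕ n → ℕ → ℤ) → rowL t vs h (λ ws c → k ℤ.* f ws c) ≡ k ℤ.* rowL t vs h f
rowL-scale t vs h k f = trans (rowL-cong t vs h λ ws c → sym (ℤₚ.+-identityʳ (k ℤ.* f ws c)))
  (trans (rowL-comm t vs h ((k , 0) ∷ []) (λ ws c _ → f ws c)) (ℤₚ.+-identityʳ _))

rowR-scale : ∀ t (vs : Vec ℕ n) h k (f : Vec ℕ n → ℕ → ℤ) → rowR t vs h (λ ws c → k ℤ.* f ws c) ≡ k ℤ.* rowR t vs h f
rowR-scale t vs h k f = trans (rowR-cong t vs h λ ws c → sym (ℤₚ.+-identityʳ (k ℤ.* f ws c)))
  (trans (rowR-comm t vs h ((k , 0) ∷ []) (λ ws c _ → f ws c)) (ℤₚ.+-identityʳ _))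

-- The row takes its exit label and its weight along to the bottom. This is why `reverse es` appears
-- once all rows are converted: the top row of the pipe dream becomes the last bumpless row, which
-- is the top row again after turning the picture over.
classic-sinks : ∀ e x (es : Vec (ℕ × ℤ) m) (v : Vec ℕ n) →
  rowR (classic x) v 0 (λ w h → [ h ≡ᵇ suc e ]ℤ ℤ.* runBumpless es w) ≡ runBumpless (es ∷ʳ (e , x)) v
classic-sinks e x [] v = last-row x v (λ h → [ h ≡ᵇ suc e ]ℤ) refl
classic-sinks e x ((e′ , y) ∷ es) v = begin
  (rowR C v 0 λ w h → [ h ≡ᵇ suc e ]ℤ ℤ.* rowL B w 0 λ u k → [ k ≡ᵇ suc e′ ]ℤ ℤ.* runBumpless es u)
    ≡⟨ (rowR-cong C v 0 λ w h → sym (rowL-scale B w 0 [ h ≡ᵇ suc e ]ℤ λ u k → [ k ≡ᵇ suc e′ ]ℤ ℤ.* runBumpless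
      es u)) ⟩
  (rowR C v 0 λ w h → rowL B w 0 λ u k → [ h ≡ᵇ suc e ]ℤ ℤ.* ([ k ≡ᵇ suc e′ ]ℤ ℤ.* runBumpless es u))
    -- Both exit labels are successors, so the indicators vanish at 0 as `rows-commute` requires.
    ≡⟨ rows-commute x y v (λ u k h → [ h ≡ᵇ suc e ]ℤ ℤ.* ([ k ≡ᵇ suc e′ ]ℤ ℤ.* runBumpless es u))
         (λ _ _ → refl) (λ u h → ℤₚ.*-zeroʳ [ h ≡ᵇ suc e ]ℤ) ⟩
  (rowL B v 0 λ w k → rowR C w 0 λ u h → [ h ≡ᵇ suc e ]ℤ ℤ.* ([ k ≡ᵇ suc e′ ]ℤ ℤ.* runBumpless es u))
    ≡⟨ (rowL-cong B v 0 λ w k → trans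
          (rowR-cong C w 0 λ u h → solve 3 (λ a b c → a :* (b :* c) := b :* (a :* c)) refl
            ([ h ≡ᵇ suc e ]ℤ) ([ k ≡ᵇ suc e′ ]ℤ) (runBumpless es u))
          (trans (rowR-scale C w 0 [ k ≡ᵇ suc e′ ]ℤ λ u h → [ h ≡ᵇ suc e ]ℤ ℤ.* runBumpless es u)
            (cong (λ z → [ k ≡ᵇ suc e′ ]ℤ ℤ.* z) (classic-sinks e x es w)))) ⟩
  (rowL B v 0 λ w k → [ k ≡ᵇ suc e′ ]ℤ ℤ.* runBumpless (es ∷ʳ (e , x)) w) ∎
  where
  C B : TileRule
  C = classic x
  B = bumpless y

runClassic≡runBumpless : ∀ (es : Vec (ℕ × ℤ) m) (v : Vec ℕ n) → runClassic es v ≡ runBumpless (reverse es) v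
runClassic≡runBumpless [] v = refl
runClassic≡runBumpless ((e , x) ∷ es) v = begin
  (rowR (classic x) v 0 λ w h → [ h ≡ᵇ suc e ]ℤ ℤ.* runClassic es w)
    ≡⟨ (rowR-cong (classic x) v 0 λ w h → cong (λ z → [ h ≡ᵇ suc e ]ℤ ℤ.* z) (runClassic≡runBumpless es w)) ⟩
  (rowR (classic x) v 0 λ w h → [ h ≡ᵇ suc e ]ℤ ℤ.* runBumpless (reverse es) w)
    ≡⟨ classic-sinks e x (reverse es) v ⟩
  runBumpless (reverse es ∷ʳ (e , x)) v
    ≡⟨ cong (λ z → runBumpless z v) (sym (Vecₚ.reverse-∷ (e , x) es)) ⟩
  runBumpless (reverse ((e , x) ∷ es)) v ∎

-- Pipe dreams as fillings of a grid

total : List A → (A → ℤ) → ℤ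
total []       f = 0ℤ
total (a ∷ as) f = f a ℤ.+ total as f

total-cong : ∀ (as : List A) {f g} → (∀ a → f a ≡ g a) → total as f ≡ total as g
total-cong []       e = refl
total-cong (a ∷ as) e = cong₂ ℤ._+_ (e a) (total-cong as e)

total-scale : ∀ (as : List A) k f → total as (λ a → k ℤ.* f a) ≡ k ℤ.* total as f
total-scale []       k f = sym (ℤₚ.*-zeroʳ k)
total-scale (a ∷ as) k f = trans (cong (λ z → k ℤ.* f a ℤ.+ z) (total-scale as k f))
  (sym (ℤₚ.*-distribˡ-+ k (f a) (total as f)))

total-++ : ∀ (as bs : List A) f → total (as ++ bs) f ≡ total as f ℤ.+ total bs f
total-++ []       bs f = sym (ℤₚ.+-identityˡ (total bs f))
total-++ (a ∷ as) bs f = trans (cong (λ z → f a ℤ.+ z) (total-++ as bs f))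
  (sym (ℤₚ.+-assoc (f a) (total as f) (total bs f)))

total-map : ∀ (g : A → E) as f → total (List.map g as) f ≡ total as (λ a → f (g a))
total-map g []       f = refl
total-map g (a ∷ as) f = cong (λ z → f (g a) ℤ.+ z) (total-map g as f)

total-product : ∀ (g : A → E → F) as bs f →
  total (cartesianProductWith g as bs) f ≡ total as (λ a → total bs (λ b → f (g a b)))
total-product g []       bs f = refl
total-product g (a ∷ as) bs f = trans (total-++ (List.map (g a) bs) _ f)
  (cong₂ ℤ._+_ (total-map (g a) bs f) (total-product g as bs f))

total-filter : ∀ (p : A → Bool) as f →
  total as (λ a → if p a then f a else 0ℤ) ≡ total (filterᵇ p as) f
total-filter p []       f = refl
total-filter p (a ∷ as) f with p a
... | true  = cong (λ z → f a ℤ.+ z) (total-filter p as f)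
... | false = trans (ℤₚ.+-identityˡ _) (total-filter p as f)

vecs : List A → ∀ n → List (Vec A n)
vecs as zero    = [] ∷ []
vecs as (suc n) = cartesianProductWith _∷_ as (vecs as n)

record TileSet : Set₁ where
  field
    Kind  : Set
    kinds : List Kind
    pass  : Kind → Bool
    legal : Kind → ℕ → ℕ → Bool
    heavy : Kind → Bool

move : Bool → ℕ → ℕ → ℕ × ℕ
move true  v h = v , h
move false v h = h , v

-- The classic kinds are listed with the turn first, so that `Rows.rule classicTiles` computes to
-- `classic`. For bumpless tiles every kind contributes a term, and `bumpless-rule` discards the
-- zeros. Empty edges count as labels going straight on, so `hor`, `ver` and `blank` pass like
-- `cross`.
classicTiles bumplessTiles : TileSet
classicTiles = record
  { Kind = Bool ; kinds = false ∷ true ∷ [] ; pass = id ; legal = legal ; heavy = id }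
  where
  legal : Bool → ℕ → ℕ → Bool
  legal true  v h = v <ᵇ h
  legal false v h = true
bumplessTiles = record
  { Kind = Tile ; kinds = cross ∷ hor ∷ ver ∷ rT ∷ jT ∷ blank ∷ [] ; pass = pass ; legal = legal ; heavy = heavy }
  where
  pass : Tile → Bool
  pass rT = false
  pass jT = false
  pass _  = true
  legal : Tile → ℕ → ℕ → Bool
  legal cross (suc v) (suc h) = h <ᵇ v
  legal hor   zero    (suc h) = true
  legal ver   (suc v) zero    = true
  legal rT    (suc v) zero    = true
  legal jT    zero    (suc h) = true
  legal blank zero    zero    = true
  legal _     _       _       = false
  heavy : Tile → Bool
  heavy blank = true
  heavy _     = false

module Rows (𝕋 : TileSet) where
  open TileSet 𝕋

  tileWeight : ℤ → Kind → ℕ → ℕ → ℤ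
  tileWeight x a v h = if legal a v h then (if heavy a then x else 1ℤ) else 0ℤ

  rule : ℤ → TileRule
  rule x v h = List.map (λ a → tileWeight x a v h , move (pass a) v h) kinds

  rowOut : Vec Kind n → Vec ℕ n → ℕ → Vec ℕ n × ℕ
  rowOut []       []       h = [] , h
  rowOut (a ∷ as) (v ∷ vs) h =
    let w , h₁ = move (pass a) v h ; ws , h₂ = rowOut as vs h₁ in w ∷ ws , h₂

  rowLegal : Vec Kind n → Vec ℕ n → ℕ → Bool
  rowLegal []       []       h = true
  rowLegal (a ∷ as) (v ∷ vs) h = legal a v h ∧ rowLegal as vs (proj₂ (move (pass a) v h))

  rowHeavy : Vec Kind n → ℕ
  rowHeavy []       = 0
  rowHeavy (a ∷ as) = b2n (heavy a) + rowHeavy as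

  -- One test for three conditions: reducedness through `legal`, the permutation through the exit
  -- labels `es`, and that every pipe has left the grid after the last row.
  valid : Vec ℕ m → Vec (Vec Kind n) m → Vec ℕ n → Bool
  valid []       []       v = empty v
  valid (e ∷ es) (r ∷ rs) v =
    rowLegal r v 0 ∧ ((proj₂ (rowOut r v 0) ≡ᵇ suc e) ∧ valid es rs (proj₁ (rowOut r v 0)))

  monomial : Vec (ℕ × ℤ) m → Vec (Vec Kind n) m → ℤ
  monomial []             []       = 1ℤ
  monomial ((_ , x) ∷ es) (r ∷ rs) = (x ℤ.^ rowHeavy r) ℤ.* monomial es rs

  run : Vec (ℕ × ℤ) m → Vec ℕ n → ℤ
  run []             v = [ empty v ]ℤ
  run ((e , x) ∷ es) v = rowL (rule x) v 0 λ w h → [ h ≡ᵇ suc e ]ℤ ℤ.* run es w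

  rule-total : ∀ x v h f → ⟦ rule x v h ⟧ f ≡ total kinds (λ a → tileWeight x a v h ℤ.* f (move (pass a) v h))
  rule-total x v h f = go kinds
    where
    go : ∀ ks → ⟦ List.map (λ a → tileWeight x a v h , move (pass a) v h) ks ⟧ f
       ≡ total ks (λ a → tileWeight x a v h ℤ.* f (move (pass a) v h))
    go []       = refl
    go (k ∷ ks) = cong (λ z → tileWeight x k v h ℤ.* f (move (pass k) v h) ℤ.+ z) (go ks)

  rowTerm : ℤ → Vec Kind n → Vec ℕ n → ℕ → ℤ → ℤ
  rowTerm x r v h z = if rowLegal r v h then (x ℤ.^ rowHeavy r) ℤ.* z else 0ℤ

  rowTerm-∷ : ∀ x a (r : Vec Kind n) v vs h z → 
    tileWeight x a v h ℤ.* rowTerm x r vs (proj₂ (move (pass a) v h)) z ≡ rowTerm x (a ∷ r) (v ∷ vs) h z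
  rowTerm-∷ x a r v vs h z with legal a v h
  ... | false = refl
  ... | true with heavy a | rowLegal r vs (proj₂ (move (pass a) v h))
  ...   | true  | true  = solve 3 (λ x y z → x :* (y :* z) := x :* y :* z) refl x (x ℤ.^ rowHeavy r) z
  ...   | false | true  = ℤₚ.*-identityˡ ((x ℤ.^ rowHeavy r) ℤ.* z)
  ...   | true  | false = ℤₚ.*-zeroʳ x
  ...   | false | false = refl

  rowL-total : ∀ x (v : Vec ℕ n) h f → rowL (rule x) v h f ≡
    total (vecs kinds n) (λ r → rowTerm x r v h (f (proj₁ (rowOut r v h)) (proj₂ (rowOut r v h))))
  rowL-total x [] h f = solve 1 (λ z → z := con 1ℤ :* z :+ con 0ℤ) refl (f [] h)
  rowL-total {suc n} x (v ∷ vs) h f = begin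
    (⟦ rule x v h ⟧ λ (w , h₁) → rowL (rule x) vs h₁ λ ws h₂ → f (w ∷ ws) h₂)
      ≡⟨ rule-total x v h _ ⟩
    (total kinds λ a → let w , h₁ = move (pass a) v h in
      tileWeight x a v h ℤ.* rowL (rule x) vs h₁ λ ws h₂ → f (w ∷ ws) h₂)
      ≡⟨ total-cong kinds (λ a → let w , h₁ = move (pass a) v h in trans
           (cong (λ z → tileWeight x a v h ℤ.* z) (rowL-total x vs h₁ λ ws h₂ → f (w ∷ ws) h₂))
           (trans (sym (total-scale (vecs kinds n) (tileWeight x a v h) _))
             (total-cong (vecs kinds n) λ r → rowTerm-∷ x a r v vs h
               (f (w ∷ proj₁ (rowOut r vs h₁)) (proj₂ (rowOut r vs h₁)))))) ⟩
    (total kinds λ a → total (vecs kinds n) λ r → rowTerm x (a ∷ r) (v ∷ vs) h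
      (f (proj₁ (rowOut (a ∷ r) (v ∷ vs) h)) (proj₂ (rowOut (a ∷ r) (v ∷ vs) h))))
      ≡⟨ sym (total-product _∷_ kinds (vecs kinds n) _) ⟩
    (total (vecs kinds (suc n)) λ r → rowTerm x r (v ∷ vs) h
      (f (proj₁ (rowOut r (v ∷ vs) h)) (proj₂ (rowOut r (v ∷ vs) h)))) ∎

  -- Distributivity: the nested choices of tiles become one choice of a whole filling, and the
  -- legality of the tiles and the indicators of the exits gather into `valid`.
  run-total : ∀ (es : Vec (ℕ × ℤ) m) (v : Vec ℕ n) → run es v ≡
    total (vecs (vecs kinds n) m) (λ X → if valid (Vec.map proj₁ es) X v then monomial es X else 0ℤ)
  run-total [] v = sym (ℤₚ.+-identityʳ [ empty v ]ℤ)
  run-total {suc m} {n} ((e , x) ∷ es) v = begin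
    (rowL (rule x) v 0 λ w h → [ h ≡ᵇ suc e ]ℤ ℤ.* run es w)
      ≡⟨ rowL-total x v 0 _ ⟩
    (total (vecs kinds n) λ r → rowTerm x r v 0
      ([ proj₂ (rowOut r v 0) ≡ᵇ suc e ]ℤ ℤ.* run es (proj₁ (rowOut r v 0))))
      ≡⟨ total-cong (vecs kinds n) (λ r → row r) ⟩
    (total (vecs kinds n) λ r → total Xs λ X → term (r ∷ X))
      ≡⟨ sym (total-product _∷_ (vecs kinds n) Xs term) ⟩
    (total (vecs (vecs kinds n) (suc m)) λ X → term X) ∎
    where
    Xs : List (Vec (Vec Kind n) m)
    Xs = vecs (vecs kinds n) m
    term : Vec (Vec Kind n) (suc m) → ℤ
    term X = if valid (e ∷ Vec.map proj₁ es) X v then monomial ((e , x) ∷ es) X else 0ℤ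
    total-0 : ∀ {A : Set} (as : List A) → 0ℤ ≡ total as (λ _ → 0ℤ)
    total-0 []       = refl
    total-0 (a ∷ as) = trans (total-0 as) (sym (ℤₚ.+-identityˡ _))
    row : ∀ r → rowTerm x r v 0 ([ proj₂ (rowOut r v 0) ≡ᵇ suc e ]ℤ ℤ.* run es (proj₁ (rowOut r v 0)))
      ≡ total Xs λ X → term (r ∷ X)
    row r with rowLegal r v 0 | proj₂ (rowOut r v 0) ≡ᵇ suc e
    ... | false | _     = total-0 Xs
    ... | true  | false = trans (ℤₚ.*-zeroʳ (x ℤ.^ rowHeavy r)) (total-0 Xs)
    ... | true  | true  = trans
      (cong (λ z → (x ℤ.^ rowHeavy r) ℤ.* z) (trans (ℤₚ.*-identityˡ _) (run-total es (proj₁ (rowOut r v 0)))))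
      (trans (sym (total-scale Xs (x ℤ.^ rowHeavy r) _)) (total-cong Xs λ X → scale X))
      where
      scale : ∀ X → (x ℤ.^ rowHeavy r) ℤ.*
          (if valid (Vec.map proj₁ es) X (proj₁ (rowOut r v 0)) then monomial es X else 0ℤ)
        ≡ (if valid (Vec.map proj₁ es) X (proj₁ (rowOut r v 0)) then (x ℤ.^ rowHeavy r) ℤ.* monomial es X else 0ℤ)
      scale X with valid (Vec.map proj₁ es) X (proj₁ (rowOut r v 0))
      ... | true  = refl
      ... | false = ℤₚ.*-zeroʳ (x ℤ.^ rowHeavy r)

  grids : Vec ℕ m → Vec ℕ n → List (Vec (Vec Kind n) m)
  grids es v = filterᵇ (λ X → valid es X v) (vecs (vecs kinds _) _)

  run-grids : ∀ (es : Vec (ℕ × ℤ) m) (v : Vec ℕ n) → run es v ≡ total (grids (Vec.map proj₁ es) v) (monomial es)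
  run-grids es v = trans (run-total es v) (total-filter _ (vecs (vecs kinds _) _) (monomial es))

bumpless-rule : ∀ x v h f → ⟦ bumpless x v h ⟧ f ≡ ⟦ Rows.rule bumplessTiles x v h ⟧ f
bumpless-rule x zero zero f = solve 1 (λ p → p :=
  con 0ℤ :+ (con 0ℤ :+ (con 0ℤ :+ (con 0ℤ :+ (con 0ℤ :+ p))))) refl (x ℤ.* f (0 , 0) ℤ.+ 0ℤ)
bumpless-rule x zero (suc h) f = solve 2 (λ p q → con 1ℤ :* p :+ (con 1ℤ :* q :+ con 0ℤ) :=
  con 0ℤ :+ (con 1ℤ :* p :+ (con 0ℤ :+ (con 0ℤ :+ (con 1ℤ :* q :+ (con 0ℤ :+ con 0ℤ)))))) refl (f (0 , suc h))
    (f (suc h , 0))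
bumpless-rule x (suc v) zero f = solve 2 (λ p q → con 1ℤ :* p :+ (con 1ℤ :* q :+ con 0ℤ) :=
  con 0ℤ :+ (con 0ℤ :+ (con 1ℤ :* p :+ (con 1ℤ :* q :+ (con 0ℤ :+ (con 0ℤ :+ con 0ℤ)))))) refl (f (suc v , 0))
    (f (0 , suc v))
bumpless-rule x (suc v) (suc h) f = solve 2 (λ p q → p :* q :+ con 0ℤ :=
  p :* q :+ (con 0ℤ :+ (con 0ℤ :+ (con 0ℤ :+ (con 0ℤ :+ (con 0ℤ :+ con 0ℤ)))))) refl [ h <ᵇ v ]ℤ (f (suc v , suc h))

runBumpless-run : ∀ (es : Vec (ℕ × ℤ) m) (v : Vec ℕ n) → runBumpless es v ≡ Rows.run bumplessTiles es v
runBumpless-run []             v = refl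
runBumpless-run ((e , x) ∷ es) v = trans
  (rowL-cong (bumpless x) v 0 λ w h → cong (λ z → [ h ≡ᵇ suc e ]ℤ ℤ.* z) (runBumpless-run es w))
  (rule-cong v 0 _)
  where
  rule-cong : ∀ {n} (v : Vec ℕ n) h f → rowL (bumpless x) v h f ≡ rowL (Rows.rule bumplessTiles x) v h f
  rule-cong []       h f = refl
  rule-cong (v ∷ vs) h f = trans (bumpless-rule x v h _)
    (⟦⟧-cong (Rows.rule bumplessTiles x v h) λ (w , h₁) → rule-cong vs h₁ λ ws k → f (w ∷ ws) k)

rowR-∷ʳ : ∀ t (vs : Vec ℕ n) v h f → rowR t (vs ∷ʳ v) h f ≡
  (⟦ t v h ⟧ λ (w , h₁) → rowR t vs h₁ λ ws h₂ → f (ws ∷ʳ w) h₂)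
rowR-∷ʳ t []       v h f = refl
rowR-∷ʳ t (u ∷ vs) v h f = rowR-∷ʳ t vs v h _

-- The enumeration is written for rightward rows only. Reversing the columns makes a classic row one
-- of them; hence classic grids are read from the right, with decreasing labels on top.
rowR-reverse : ∀ t (vs : Vec ℕ n) h f →
  rowR t (reverse vs) h f ≡ rowL t vs h (λ ws k → f (reverse ws) k)
rowR-reverse t []       h f = refl
rowR-reverse t (v ∷ vs) h f = begin
  rowR t (reverse (v ∷ vs)) h f
    ≡⟨ cong (λ z → rowR t z h f) (Vecₚ.reverse-∷ v vs) ⟩
  rowR t (reverse vs ∷ʳ v) h f
    ≡⟨ rowR-∷ʳ t (reverse vs) v h f ⟩
  (⟦ t v h ⟧ λ (w , h₁) → rowR t (reverse vs) h₁ λ ws k → f (ws ∷ʳ w) k)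
    ≡⟨ (⟦⟧-cong (t v h) λ (w , h₁) → trans (rowR-reverse t vs h₁ λ ws k → f (ws ∷ʳ w) k)
         (rowL-cong t vs h₁ λ ws k → cong (λ z → f z k) (sym (Vecₚ.reverse-∷ w ws)))) ⟩
  (⟦ t v h ⟧ λ (w , h₁) → rowL t vs h₁ λ ws k → f (reverse (w ∷ ws)) k) ∎

empty-∷ʳ : ∀ (vs : Vec ℕ n) v → empty (vs ∷ʳ v) ≡ (v ≡ᵇ 0) ∧ empty vs
empty-∷ʳ []             v       = refl
empty-∷ʳ (zero ∷ vs)    v       = empty-∷ʳ vs v
empty-∷ʳ (suc _ ∷ vs)   zero    = refl
empty-∷ʳ (suc _ ∷ vs)   (suc _) = refl

empty-reverse : ∀ (vs : Vec ℕ n) → empty (reverse vs) ≡ empty vs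
empty-reverse []       = refl
empty-reverse (v ∷ vs) = begin
  empty (reverse (v ∷ vs))     ≡⟨ cong empty (Vecₚ.reverse-∷ v vs) ⟩
  empty (reverse vs ∷ʳ v)      ≡⟨ empty-∷ʳ (reverse vs) v ⟩
  (v ≡ᵇ 0) ∧ empty (reverse vs) ≡⟨ cong ((v ≡ᵇ 0) ∧_) (empty-reverse vs) ⟩
  (v ≡ᵇ 0) ∧ empty vs          ∎

runClassic-run : ∀ (es : Vec (ℕ × ℤ) m) (v : Vec ℕ n) → runClassic es (reverse v) ≡ Rows.run classicTiles es v
runClassic-run []             v = cong [_]ℤ (empty-reverse v)
runClassic-run ((e , x) ∷ es) v = trans (rowR-reverse (classic x) v 0 _)
  (rowL-cong (classic x) v 0 λ w h → cong (λ z → [ h ≡ᵇ suc e ]ℤ ℤ.* z) (runClassic-run es w))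

classic-bumpless-total : ∀ (es : Vec (ℕ × ℤ) m) (v : Vec ℕ n) →
  total (Rows.grids classicTiles (Vec.map proj₁ es) (reverse v)) (Rows.monomial classicTiles es)
  ≡ total (Rows.grids bumplessTiles (Vec.map proj₁ (reverse es)) v) (Rows.monomial bumplessTiles (reverse es))
classic-bumpless-total es v = begin
  total (Rows.grids classicTiles (Vec.map proj₁ es) (reverse v)) (Rows.monomial classicTiles es)
    ≡⟨ sym (Rows.run-grids classicTiles es (reverse v)) ⟩
  Rows.run classicTiles es (reverse v)
    ≡⟨ sym (runClassic-run es (reverse v)) ⟩
  runClassic es (reverse (reverse v))
    ≡⟨ cong (runClassic es) (Vecₚ.reverse-involutive v) ⟩
  runClassic es v
    ≡⟨ runClassic≡runBumpless es v ⟩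
  runBumpless (reverse es) v
    ≡⟨ runBumpless-run (reverse es) v ⟩
  Rows.run bumplessTiles (reverse es) v
    ≡⟨ Rows.run-grids bumplessTiles (reverse es) v ⟩
  total (Rows.grids bumplessTiles (Vec.map proj₁ (reverse es)) v) (Rows.monomial bumplessTiles (reverse es)) ∎

-- Equality of generating functions yields a bijection

digit-unique : ∀ {a b} q r D → a < D → b < D → a + D * q ≡ b + D * r → (a ≡ b) × (q ≡ r)
digit-unique {a} {b} q r D@(suc _) a<D b<D eq = a≡b , *-cancelˡ-≡ q r D
  (+-cancelˡ-≡ b _ _ (trans (cong (_+ D * q) (sym a≡b)) eq))
  where
  mod : ∀ {a} q → a < D → (a + D * q) % D ≡ a
  mod {a} q a<D = trans (cong (λ z → (a + z) % D) (*-comm D q)) (trans ([m+kn]%n≡m%n a q D) (m<n⇒m%n≡m a<D))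
  a≡b : a ≡ b
  a≡b = trans (sym (mod q a<D)) (trans (cong (_% D) eq) (mod r b<D))

count : ℕ → List ℕ → ℕ
count k []       = 0
count k (c ∷ cs) = b2n (c ≡ᵇ k) + count k cs

count-++ : ∀ k cs ds → count k (cs ++ ds) ≡ count k cs + count k ds
count-++ k []       ds = refl
count-++ k (c ∷ cs) ds = trans (cong (b2n (c ≡ᵇ k) +_) (count-++ k cs ds))
  (sym (+-assoc (b2n (c ≡ᵇ k)) (count k cs) (count k ds)))

b2n≤1 : ∀ b → b2n b ≤ 1
b2n≤1 true  = ≤-refl
b2n≤1 false = z≤n

count≤length : ∀ k cs → count k cs ≤ length cs
count≤length k []       = z≤n
count≤length k (c ∷ cs) = +-mono-≤ (b2n≤1 (c ≡ᵇ k)) (count≤length k cs)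

count-positive : ∀ c ds → 0 < count c ds → c ∈ ds
count-positive c (d ∷ ds) p with d ≡ᵇ c in eq
... | true  = here (sym (≡ᵇ⇒≡ d c (subst T (sym eq) _)))
... | false = there (count-positive c ds p)

count-head : ∀ c cs → 0 < count c (c ∷ cs)
count-head c cs rewrite ≡ᵇ-refl c = s≤s z≤n

count⇒↭ : ∀ cs ds → (∀ k → count k cs ≡ count k ds) → cs ↭ ds
count⇒↭ [] []       e = ↭-refl
count⇒↭ [] (d ∷ ds) e with e d
... | e′ rewrite ≡ᵇ-refl d = contradiction e′ λ ()
count⇒↭ (c ∷ cs) ds e
  with ds₁ , ds₂ , refl ← ∈-∃++ (count-positive c ds (subst (0 <_) (e c) (count-head c cs)))
  = ↭-trans (prep c (count⇒↭ cs (ds₁ ++ ds₂) λ k → +-cancelˡ-≡ (b2n (c ≡ᵇ k)) _ _ (begin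
      b2n (c ≡ᵇ k) + count k cs                  ≡⟨ e k ⟩
      count k (ds₁ ++ c ∷ ds₂)                   ≡⟨ count-++ k ds₁ (c ∷ ds₂) ⟩
      count k ds₁ + (b2n (c ≡ᵇ k) + count k ds₂) ≡⟨ x∙yz≈y∙xz (count k ds₁) (b2n (c ≡ᵇ k)) (count k ds₂) ⟩
      b2n (c ≡ᵇ k) + (count k ds₁ + count k ds₂) ≡⟨ cong (b2n (c ≡ᵇ k) +_) (sym (count-++ k ds₁ ds₂)) ⟩
      b2n (c ≡ᵇ k) + count k (ds₁ ++ ds₂)        ∎)))
    (↭-sym (↭ₚ.shift c ds₁ ds₂))

powerSum : ℕ → List ℕ → ℕ
powerSum N cs = sum (List.map (N ^_) cs)

-- Removal of the lowest digit of a power sum: exponents 0 are dropped and all others lowered, which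
-- divides the rest by `N`.
preds : List ℕ → List ℕ
preds []           = []
preds (zero  ∷ cs) = preds cs
preds (suc c ∷ cs) = c ∷ preds cs

length-preds : ∀ cs → length (preds cs) ≤ length cs
length-preds []           = z≤n
length-preds (zero  ∷ cs) = m≤n⇒m≤1+n (length-preds cs)
length-preds (suc c ∷ cs) = s≤s (length-preds cs)

count-preds : ∀ k cs → count k (preds cs) ≡ count (suc k) cs
count-preds k []           = refl
count-preds k (zero  ∷ cs) = count-preds k cs
count-preds k (suc c ∷ cs) = cong (b2n (c ≡ᵇ k) +_) (count-preds k cs)

powerSum-preds : ∀ N cs → powerSum N cs ≡ count 0 cs + N * powerSum N (preds cs)
powerSum-preds N []           = sym (*-zeroʳ N)
powerSum-preds N (zero  ∷ cs) = cong suc (powerSum-preds N cs)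
powerSum-preds N (suc c ∷ cs) = begin
  N * N ^ c + powerSum N cs                                     ≡⟨ cong (N * N ^ c +_) (powerSum-preds N cs) ⟩
  N * N ^ c + (count 0 cs + N * powerSum N (preds cs))          ≡⟨ x∙yz≈y∙xz (N * N ^ c) (count 0 cs) _ ⟩
  count 0 cs + (N * N ^ c + N * powerSum N (preds cs))          ≡⟨ cong (count 0 cs +_)
    (sym (*-distribˡ-+ N (N ^ c) _)) ⟩
  count 0 cs + N * (N ^ c + powerSum N (preds cs))              ∎

-- The multiplicity of `k` is the digit of the power sum at `N ^ k`. It is a proper digit because it
-- is at most the length of the list, which is less than `N`.
powerSum-count : ∀ N k cs ds → length cs < N → length ds < N → powerSum N cs ≡ powerSum N ds →
  count k cs ≡ count k ds
powerSum-count N k cs ds cs<N ds<N eq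
  with digit-unique (powerSum N (preds cs)) (powerSum N (preds ds)) N
         (≤-<-trans (count≤length 0 cs) cs<N) (≤-<-trans (count≤length 0 ds) ds<N)
         (trans (sym (powerSum-preds N cs)) (trans eq (powerSum-preds N ds)))
powerSum-count N zero    cs ds cs<N ds<N eq | eq₀ , _ = eq₀
powerSum-count N (suc k) cs ds cs<N ds<N eq | _ , eq₁ = begin
  count (suc k) cs   ≡⟨ sym (count-preds k cs) ⟩
  count k (preds cs) ≡⟨ powerSum-count N k (preds cs) (preds ds) (≤-<-trans (length-preds cs) cs<N)
                          (≤-<-trans (length-preds ds) ds<N) eq₁ ⟩
  count k (preds ds) ≡⟨ count-preds k ds ⟩
  count (suc k) ds   ∎

-- Exponent vectors encoded as numbers

dot : Vec ℕ m → Vec ℕ m → ℕ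
dot []       []       = 0
dot (p ∷ ps) (k ∷ ks) = p * k + dot ps ks

dot-∷ʳ : ∀ (ps ks : Vec ℕ m) p k → dot (ps ∷ʳ p) (ks ∷ʳ k) ≡ p * k + dot ps ks
dot-∷ʳ []       []       p k = refl
dot-∷ʳ (q ∷ ps) (l ∷ ks) p k = trans (cong (q * l +_) (dot-∷ʳ ps ks p k)) (x∙yz≈y∙xz (q * l) (p * k) _)

dot-reverse : ∀ (ps ks : Vec ℕ m) → dot (reverse ps) (reverse ks) ≡ dot ps ks
dot-reverse []       []       = refl
dot-reverse (p ∷ ps) (k ∷ ks) rewrite Vecₚ.reverse-∷ p ps | Vecₚ.reverse-∷ k ks =
  trans (dot-∷ʳ (reverse ps) (reverse ks) p k) (cong (p * k +_) (dot-reverse ps ks))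

powers : ℕ → ∀ m → Vec ℕ m
powers D zero    = []
powers D (suc m) = 1 ∷ Vec.map (D *_) (powers D m)

dot-scale : ∀ D (ps ks : Vec ℕ m) → dot (Vec.map (D *_) ps) ks ≡ D * dot ps ks
dot-scale D []       []       = sym (*-zeroʳ D)
dot-scale D (p ∷ ps) (k ∷ ks) = trans (cong₂ _+_ (*-assoc D p k) (dot-scale D ps ks))
  (sym (*-distribˡ-+ D (p * k) (dot ps ks)))

dot-powers : ∀ D k (ks : Vec ℕ m) → k + D * dot (powers D m) ks ≡ dot (powers D (suc m)) (k ∷ ks)
dot-powers {m} D k ks = cong₂ _+_ (sym (*-identityˡ k)) (sym (dot-scale D (powers D m) ks))

-- Kronecker substitution: a digit vector is determined by its base-D value.
powers-injective : ∀ D (ks ls : Vec ℕ m) → VAll.All (_< D) ks → VAll.All (_< D) ls →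
  dot (powers D m) ks ≡ dot (powers D m) ls → ks ≡ ls
powers-injective D []       []       []       []       eq = refl
powers-injective {suc m} D (k ∷ ks) (l ∷ ls) (k< ∷ ks<) (l< ∷ ls<) eq
  with k≡l , eq′ ← digit-unique (dot (powers D m) ks) (dot (powers D m) ls) D k< l<
         (trans (dot-powers D k ks) (trans eq (sym (dot-powers D l ls))))
  = cong₂ _∷_ k≡l (powers-injective D ks ls ks< ls< eq′)

-- From equal multisets of weights to a bijection

vecs-unique : ∀ {as : List A} n → Unique as → Unique (vecs as n)
vecs-unique zero    u = [] ∷ []
vecs-unique (suc n) u = Uniqueₚ.cartesianProductWith⁺ _∷_ Vecₚ.∷-injective u (vecs-unique n u)

∈-vecs : ∀ {as : List A} → (∀ a → a ∈ as) → (xs : Vec A n) → xs ∈ vecs as n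
∈-vecs all []       = here refl
∈-vecs all (x ∷ xs) = ∈-cartesianProductWith⁺ _∷_ (all x) (∈-vecs all xs)

module Matching {A E : Set} (f : A → ℕ) (g : E → ℕ) where

  match : ∀ xs ys → List.map f xs ≡ List.map g ys → ∀ {a} → a ∈ xs → ∃ λ b → (b ∈ ys) × (g b ≡ f a)
  match (x ∷ xs) (y ∷ ys) eq (here refl) = y , here refl , sym (Listₚ.∷-injectiveˡ eq)
  match (x ∷ xs) (y ∷ ys) eq (there p) with b , q , e ← match xs ys (Listₚ.∷-injectiveʳ eq) p = b , there q , e

  match-injective : ∀ xs ys eq → Unique ys → ∀ {a b} (p : a ∈ xs) (q : b ∈ xs) →
    proj₁ (match xs ys eq p) ≡ proj₁ (match xs ys eq q) → a ≡ b
  match-injective (x ∷ xs) (y ∷ ys) eq u        (here refl) (here refl) e = refl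
  match-injective (x ∷ xs) (y ∷ ys) eq (y∉ ∷ u) (here refl) (there q)   e =
    contradiction e (All.lookup y∉ (proj₁ (proj₂ (match xs ys _ q))))
  match-injective (x ∷ xs) (y ∷ ys) eq (y∉ ∷ u) (there p)   (here refl) e =
    contradiction (sym e) (All.lookup y∉ (proj₁ (proj₂ (match xs ys _ p))))
  match-injective (x ∷ xs) (y ∷ ys) eq (y∉ ∷ u) (there p)   (there q)   e = match-injective xs ys _ u p q e

  match-surjective : ∀ xs ys eq → ∀ {b} → b ∈ ys → ∃ λ a → Σ (a ∈ xs) λ p → proj₁ (match xs ys eq p) ≡ b
  match-surjective (x ∷ xs) (y ∷ ys) eq (here refl) = x , here refl , refl
  match-surjective (x ∷ xs) (y ∷ ys) eq (there q)
    with a , p , e ← match-surjective xs ys (Listₚ.∷-injectiveʳ eq) q = a , there p , e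

  -- An element of a list without repetitions has only one position, so its partner does not depend
  -- on the membership proof. This lets `surjective` speak about all such proofs, as `φ-surjective`
  -- needs.
  match-irrelevant : ∀ xs ys eq → Unique xs → ∀ {a} (p q : a ∈ xs) →
    proj₁ (match xs ys eq p) ≡ proj₁ (match xs ys eq q)
  match-irrelevant (x ∷ xs) (y ∷ ys) eq u        (here refl) (here refl) = refl
  match-irrelevant (x ∷ xs) (y ∷ ys) eq (x∉ ∷ u) (here refl) (there q)   = contradiction refl (All.lookup x∉ q)
  match-irrelevant (x ∷ xs) (y ∷ ys) eq (x∉ ∷ u) (there p)   (here refl) = contradiction refl (All.lookup x∉ p)
  match-irrelevant (x ∷ xs) (y ∷ ys) eq (x∉ ∷ u) (there p)   (there q)   = match-irrelevant xs ys _ u p q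

record Bijection {A E : Set} (xs : List A) (ys : List E) (f : A → ℕ) (g : E → ℕ) : Set where
  field
    to         : ∀ {a} → a ∈ xs → E
    to-∈       : ∀ {a} (p : a ∈ xs) → to p ∈ ys
    to-value   : ∀ {a} (p : a ∈ xs) → g (to p) ≡ f a
    injective  : ∀ {a b} (p : a ∈ xs) (q : b ∈ xs) → to p ≡ to q → a ≡ b
    surjective : ∀ {b} → b ∈ ys → ∃ λ a → (a ∈ xs) × (∀ (p : a ∈ xs) → to p ≡ b)

-- `↭-map-inv` reorders `ys` into `zs` such that the two lists of weights are equal entry by entry;
-- elements at the same position are then partners.
↭⇒bijection : ∀ {A E : Set} (xs : List A) (ys : List E) f g → Unique xs → Unique ys →
  List.map f xs ↭ List.map g ys → Bijection xs ys f g
↭⇒bijection xs ys f g ux uy ρ with zs , eq , σ ← ↭ₚ.↭-map-inv g (↭-sym ρ) = record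
  { to         = λ p → proj₁ (match xs zs eq p)
  ; to-∈       = λ p → ↭ₚ.∈-resp-↭ (↭-sym σ) (proj₁ (proj₂ (match xs zs eq p)))
  ; to-value   = λ p → proj₂ (proj₂ (match xs zs eq p))
  ; injective  = match-injective xs zs eq (↭ₛ.Unique-resp-↭ (setoid _) (↭⇒↭ₛ σ) uy)
  ; surjective = λ q → let a , p , e = match-surjective xs zs eq (↭ₚ.∈-resp-↭ σ q) in
      a , p , λ p′ → trans (match-irrelevant xs zs eq ux p′ p) e
  }
  where open Matching f g

weigh : ℕ → ℕ × ℕ → ℕ × ℤ
weigh N (e , p) = e , (ℤ.+ N) ℤ.^ p

module _ (𝕋 : TileSet) where
  open TileSet 𝕋
  open Rows 𝕋

  code : Vec ℕ m → Vec (Vec Kind n) m → ℕ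
  code ps X = dot ps (Vec.map rowHeavy X)

  monomial-weigh : ∀ N (es : Vec (ℕ × ℕ) m) (X : Vec (Vec Kind n) m) →
    monomial (Vec.map (weigh N) es) X ≡ ℤ.+ (N ^ code (Vec.map proj₂ es) X)
  monomial-weigh N []             []      = refl
  monomial-weigh N ((e , p) ∷ es) (r ∷ X) = begin
    ((ℤ.+ N) ℤ.^ p) ℤ.^ rowHeavy r ℤ.* monomial (Vec.map (weigh N) es) X
      ≡⟨ cong₂ ℤ._*_ (trans (cong (ℤ._^ rowHeavy r) (pos-^ N p)) (pos-^ (N ^ p) (rowHeavy r)))
           (monomial-weigh N es X) ⟩
    ℤ.+ ((N ^ p) ^ rowHeavy r) ℤ.* ℤ.+ (N ^ code (Vec.map proj₂ es) X)
      ≡⟨ sym (ℤₚ.pos-* ((N ^ p) ^ rowHeavy r) _) ⟩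
    ℤ.+ ((N ^ p) ^ rowHeavy r * N ^ code (Vec.map proj₂ es) X)
      ≡⟨ cong (λ z → ℤ.+ (z * N ^ code (Vec.map proj₂ es) X)) (^-*-assoc N p (rowHeavy r)) ⟩
    ℤ.+ (N ^ (p * rowHeavy r) * N ^ code (Vec.map proj₂ es) X)
      ≡⟨ cong ℤ.+_ (sym (^-distribˡ-+-* N (p * rowHeavy r) _)) ⟩
    ℤ.+ (N ^ (p * rowHeavy r + code (Vec.map proj₂ es) X)) ∎
    where
    pos-^ : ∀ N p → (ℤ.+ N) ℤ.^ p ≡ ℤ.+ (N ^ p)
    pos-^ N zero    = refl
    pos-^ N (suc p) = trans (cong (λ z → ℤ.+ N ℤ.* z) (pos-^ N p)) (sym (ℤₚ.pos-* N (N ^ p)))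

  total-monomial : ∀ N (es : Vec (ℕ × ℕ) m) (Xs : List (Vec (Vec Kind n) m)) →
    total Xs (monomial (Vec.map (weigh N) es)) ≡ ℤ.+ powerSum N (List.map (code (Vec.map proj₂ es)) Xs)
  total-monomial N es []       = refl
  total-monomial N es (X ∷ Xs) = cong₂ ℤ._+_ (monomial-weigh N es X) (total-monomial N es Xs)

  grids-unique : Unique kinds → (es : Vec ℕ m) (v : Vec ℕ n) → Unique (grids es v)
  grids-unique u es v = Uniqueₚ.filter⁺ (λ X → T? _) (vecs-unique _ (vecs-unique _ u))

  ∈-grids⁺ : (∀ a → a ∈ kinds) → ∀ (es : Vec ℕ m) (v : Vec ℕ n) X → valid es X v ≡ true → X ∈ grids es v
  ∈-grids⁺ all es v X ok = ∈-filter⁺ (λ X → T? _) (∈-vecs (∈-vecs all) X) (subst T (sym ok) _)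

  ∈-grids⁻ : ∀ (es : Vec ℕ m) (v : Vec ℕ n) X → X ∈ grids es v → valid es X v ≡ true
  ∈-grids⁻ es v X p with valid es X v | proj₂ (∈-filter⁻ (λ X → T? (valid es X v)) {xs = vecs (vecs kinds _) _} p)
  ... | true | _ = refl

abstract
  -- `abstract` keeps the enumeration of all fillings from being unfolded; later proofs use only the
  -- fields of `Bijection`.
  grids-bijection : ∀ (es : Vec (ℕ × ℕ) m) (v : Vec ℕ n) → Bijection
    (Rows.grids classicTiles (Vec.map proj₁ es) (reverse v)) (Rows.grids bumplessTiles (Vec.map proj₁ (reverse es)) v)
    (code classicTiles (Vec.map proj₂ es)) (code bumplessTiles (Vec.map proj₂ (reverse es)))
  grids-bijection {m} {n} es v = ↭⇒bijection Xs Ys _ _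
    (grids-unique classicTiles (((λ ()) ∷ []) ∷ [] ∷ []) (Vec.map proj₁ es) (reverse v))
    (grids-unique bumplessTiles
      (((λ ()) ∷ (λ ()) ∷ (λ ()) ∷ (λ ()) ∷ (λ ()) ∷ []) ∷ ((λ ()) ∷ (λ ()) ∷ (λ ()) ∷ (λ ()) ∷ []) ∷
       ((λ ()) ∷ (λ ()) ∷ (λ ()) ∷ []) ∷ ((λ ()) ∷ (λ ()) ∷ []) ∷ ((λ ()) ∷ []) ∷ [] ∷ [])
         (Vec.map proj₁ (reverse es)) v)
    (count⇒↭ cs ds λ k → powerSum-count N k cs ds
      (s≤s (m≤m+n (length cs) (length ds))) (s≤s (m≤n+m (length ds) (length cs))) sums)
    where
    Xs : List (Vec (Vec Bool n) m)
    Xs = Rows.grids classicTiles (Vec.map proj₁ es) (reverse v)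
    Ys : List (Vec (Vec Tile n) m)
    Ys = Rows.grids bumplessTiles (Vec.map proj₁ (reverse es)) v
    cs ds : List ℕ
    cs = List.map (code classicTiles (Vec.map proj₂ es)) Xs
    ds = List.map (code bumplessTiles (Vec.map proj₂ (reverse es))) Ys
    N : ℕ
    N = suc (length cs + length ds)
    exits : ∀ {m} (es : Vec (ℕ × ℕ) m) → Vec.map proj₁ (Vec.map (weigh N) es) ≡ Vec.map proj₁ es
    exits es = trans (sym (Vecₚ.map-∘ proj₁ (weigh N) es)) (Vecₚ.map-cong (λ _ → refl) es)
    sums : powerSum N cs ≡ powerSum N ds
    sums = ℤₚ.+-injective (begin
      ℤ.+ powerSum N cs
        ≡⟨ sym (total-monomial classicTiles N es Xs) ⟩
      total Xs (Rows.monomial classicTiles (Vec.map (weigh N) es))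
        ≡⟨ cong (λ z → total (Rows.grids classicTiles z (reverse v)) (Rows.monomial classicTiles
          (Vec.map (weigh N) es)))
             (sym (exits es)) ⟩
      total (Rows.grids classicTiles (Vec.map proj₁ (Vec.map (weigh N) es)) (reverse v))
        (Rows.monomial classicTiles (Vec.map (weigh N) es))
        ≡⟨ classic-bumpless-total (Vec.map (weigh N) es) v ⟩
      total (Rows.grids bumplessTiles (Vec.map proj₁ (reverse (Vec.map (weigh N) es))) v)
        (Rows.monomial bumplessTiles (reverse (Vec.map (weigh N) es)))
        ≡⟨ cong (λ z → total (Rows.grids bumplessTiles (Vec.map proj₁ z) v) (Rows.monomial bumplessTiles z))
             (sym (Vecₚ.map-reverse (weigh N) es)) ⟩
      total (Rows.grids bumplessTiles (Vec.map proj₁ (Vec.map (weigh N) (reverse es))) v)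
        (Rows.monomial bumplessTiles (Vec.map (weigh N) (reverse es)))
        ≡⟨ cong (λ z → total (Rows.grids bumplessTiles z v) (Rows.monomial bumplessTiles
          (Vec.map (weigh N) (reverse es))))
             (exits (reverse es)) ⟩
      total Ys (Rows.monomial bumplessTiles (Vec.map (weigh N) (reverse es)))
        ≡⟨ total-monomial bumplessTiles N (reverse es) Ys ⟩
      ℤ.+ powerSum N ds ∎)

-- Labels of the edges of a pipe dream

data Port : Set where
  inV inH : Port

Before : ℕ → ℕ → ℕ → ℕ → Set
Before i k i′ k′ = (i < i′) ⊎ ((i ≡ i′) × (k ≤ k′))

-- Rows and the tiles of a row are numbered in the order in which the pipes traverse them.
module Labels (n : ℕ) (pass : ℕ → ℕ → Bool) (init : ℕ → ℕ) where

  V H : ℕ → ℕ → ℕ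
  V zero    k = init k
  V (suc i) k = if pass i k then V i k else H i k
  H i zero    = 0
  H i (suc k) = if pass i k then H i k else V i k

  -- The labels met along the cut that separates the tiles processed before (i , k) from the
  -- others, in order: V (suc i) 0 , … , V (suc i) (k - 1) , H i k , V i k , … , V i (n - 1).
  record Ordered (Q : ℕ → ℕ → Set) (i k : ℕ) : Set where
    field
      done-done : ∀ {p q} → p < q → q < k → Q (V (suc i) p) (V (suc i) q)
      done-H    : ∀ {p} → p < k → Q (V (suc i) p) (H i k)
      done-todo : ∀ {p q} → p < k → k ≤ q → q < n → Q (V (suc i) p) (V i q)
      H-todo    : ∀ {q} → k ≤ q → q < n → Q (H i k) (V i q)
      todo-todo : ∀ {p q} → k ≤ p → p < q → q < n → Q (V i p) (V i q)
  open Ordered public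

  -- A turn leaves the word along the cut unchanged, a pass exchanges two neighbours.
  ordered-step : ∀ {Q Q′ : ℕ → ℕ → Set} {i k} → k < n → (∀ {a b} → Q a b → Q′ a b) →
    (pass i k ≡ true → Q′ (V i k) (H i k)) → Ordered Q i k → Ordered Q′ i (suc k)
  ordered-step {Q} {Q′} {i} {k} k<n mono new O with pass i k in eq
  ... | true = record
    { done-done = λ p<q q<1+k → dd p<q (m<1+n⇒m<n∨m≡n q<1+k)
    ; done-H    = λ p<1+k → dh (m<1+n⇒m<n∨m≡n p<1+k)
    ; done-todo = λ p<1+k k<q q<n → dt (m<1+n⇒m<n∨m≡n p<1+k) k<q q<n
    ; H-todo    = λ k<q q<n → subst (λ z → Q′ z _) (sym h≡) (mono (O .H-todo (<⇒≤ k<q) q<n))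
    ; todo-todo = λ k<p p<q q<n → mono (O .todo-todo (<⇒≤ k<p) p<q q<n)
    }
    where
    v≡ : V (suc i) k ≡ V i k
    v≡ rewrite eq = refl
    h≡ : H i (suc k) ≡ H i k
    h≡ rewrite eq = refl
    dd : ∀ {p q} → p < q → (q < k) ⊎ (q ≡ k) → Q′ (V (suc i) p) (V (suc i) q)
    dd p<q (inj₁ q<k)  = mono (O .done-done p<q q<k)
    dd p<q (inj₂ refl) = subst (Q′ _) (sym v≡) (mono (O .done-todo p<q ≤-refl k<n))
    dh : ∀ {p} → (p < k) ⊎ (p ≡ k) → Q′ (V (suc i) p) (H i (suc k))
    dh (inj₁ p<k)  = subst (Q′ _) (sym h≡) (mono (O .done-H p<k))
    dh (inj₂ refl) = subst₂ Q′ (sym v≡) (sym h≡) (new refl)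
    dt : ∀ {p q} → (p < k) ⊎ (p ≡ k) → k < q → q < n → Q′ (V (suc i) p) (V i q)
    dt (inj₁ p<k)  k<q q<n = mono (O .done-todo p<k (<⇒≤ k<q) q<n)
    dt (inj₂ refl) k<q q<n = subst (λ z → Q′ z _) (sym v≡) (mono (O .todo-todo ≤-refl k<q q<n))
  ... | false = record
    { done-done = λ p<q q<1+k → dd p<q (m<1+n⇒m<n∨m≡n q<1+k)
    ; done-H    = λ p<1+k → dh (m<1+n⇒m<n∨m≡n p<1+k)
    ; done-todo = λ p<1+k k<q q<n → dt (m<1+n⇒m<n∨m≡n p<1+k) k<q q<n
    ; H-todo    = λ k<q q<n → subst (λ z → Q′ z _) (sym h≡) (mono (O .todo-todo ≤-refl k<q q<n))
    ; todo-todo = λ k<p p<q q<n → mono (O .todo-todo (<⇒≤ k<p) p<q q<n)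
    }
    where
    v≡ : V (suc i) k ≡ H i k
    v≡ rewrite eq = refl
    h≡ : H i (suc k) ≡ V i k
    h≡ rewrite eq = refl
    dd : ∀ {p q} → p < q → (q < k) ⊎ (q ≡ k) → Q′ (V (suc i) p) (V (suc i) q)
    dd p<q (inj₁ q<k)  = mono (O .done-done p<q q<k)
    dd p<q (inj₂ refl) = subst (Q′ _) (sym v≡) (mono (O .done-H p<q))
    dh : ∀ {p} → (p < k) ⊎ (p ≡ k) → Q′ (V (suc i) p) (H i (suc k))
    dh (inj₁ p<k)  = subst (Q′ _) (sym h≡) (mono (O .done-todo p<k ≤-refl k<n))
    dh (inj₂ refl) = subst₂ Q′ (sym v≡) (sym h≡) (mono (O .H-todo ≤-refl k<n))
    dt : ∀ {p q} → (p < k) ⊎ (p ≡ k) → k < q → q < n → Q′ (V (suc i) p) (V i q)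
    dt (inj₁ p<k)  k<q q<n = mono (O .done-todo p<k (<⇒≤ k<q) q<n)
    dt (inj₂ refl) k<q q<n = subst (λ z → Q′ z _) (sym v≡) (mono (O .H-todo (<⇒≤ k<q) q<n))

  ordered-row : ∀ {Q Q′ : ℕ → ℕ → Set} {i} → (∀ {a b} → Q a b → Q′ a b) → (∀ {b} → Q′ 0 b) →
    Ordered Q i n → Ordered Q′ (suc i) 0
  ordered-row mono zeroˡ O = record
    { done-done = λ _ ()
    ; done-H    = λ ()
    ; done-todo = λ ()
    ; H-todo    = λ _ _ → zeroˡ
    ; todo-todo = λ _ p<q q<n → mono (O .done-done p<q q<n)
    }

  -- The induction principle for pairs of labels along a cut. A pass creates a single new ordered
  -- pair, and `new` may use the whole preceding cut to justify it; `zeroˡ` serves the empty edge at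
  -- which each row starts. The start is an arbitrary cut, so that facts can be propagated from a
  -- given crossing onwards.
  ordered-run : ∀ (Q : ℕ → ℕ → ℕ → ℕ → Set) →
    (∀ {i k a b} → k < n → Q i k a b → Q i (suc k) a b) →
    (∀ {i k} → k < n → pass i k ≡ true → Ordered (Q i k) i k → Q i (suc k) (V i k) (H i k)) →
    (∀ {i a b} → Q i n a b → Q (suc i) 0 a b) → (∀ {i b} → Q i 0 0 b) →
    ∀ {i₀ k₀} → k₀ ≤ n → Ordered (Q i₀ k₀) i₀ k₀ → ∀ i k → k ≤ n → Before i₀ k₀ i k → Ordered (Q i k) i k
  ordered-run Q mono new row zeroˡ {i₀} {k₀} k₀≤n O₀ = go
    where
    go : ∀ i k → k ≤ n → Before i₀ k₀ i k → Ordered (Q i k) i k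
    step : ∀ i k → k < n → Before i₀ k₀ i k → Ordered (Q i (suc k)) i (suc k)
    step i k k<n b = let O = go i k (<⇒≤ k<n) b in ordered-step k<n (mono k<n) (λ p → new k<n p O) O
    go i zero k≤n (inj₂ (refl , z≤n)) = O₀
    go (suc i) zero k≤n (inj₁ i₀<1+i) with m<1+n⇒m<n∨m≡n i₀<1+i
    ... | inj₁ i₀<i = ordered-row row zeroˡ (go i n ≤-refl (inj₁ i₀<i))
    ... | inj₂ refl = ordered-row row zeroˡ (go i n ≤-refl (inj₂ (refl , k₀≤n)))
    go i (suc k) k<n (inj₁ i₀<i) = step i k k<n (inj₁ i₀<i)
    go i (suc k) k<n (inj₂ (refl , k₀≤1+k)) with m≤n⇒m<n∨m≡n k₀≤1+k
    ... | inj₁ k₀<1+k = step i k k<n (inj₂ (refl , s≤s⁻¹ k₀<1+k))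
    ... | inj₂ refl   = O₀

  ordered-init : ∀ {Q : ℕ → ℕ → Set} → (∀ {p q} → p < q → q < n → Q (init p) (init q)) → (∀ {b} → Q 0 b) →
    Ordered Q 0 0
  ordered-init sorted zeroˡ = record
    { done-done = λ _ ()
    ; done-H    = λ ()
    ; done-todo = λ ()
    ; H-todo    = λ _ _ → zeroˡ
    ; todo-todo = λ _ → sorted
    }

  from-start : ∀ {i k} → Before 0 0 i k
  from-start {zero}  = inj₂ (refl , z≤n)
  from-start {suc i} = inj₁ (s≤s z≤n)

  H-ancestor : ∀ i k → k ≤ n → H i k ≢ 0 → ∃ λ k₀ → (k₀ < n) × (V i k₀ ≡ H i k)
  H-ancestor i zero    _   h≢0 = contradiction refl h≢0
  H-ancestor i (suc k) k<n h≢0 with pass i k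
  ... | true  = H-ancestor i k (<⇒≤ k<n) h≢0
  ... | false = k , k<n , refl

  -- Backwards, a label can always be followed to an earlier row: horizontal edges start with 0, so
  -- no pipe begins inside the grid.
  V-ancestor : ∀ i k i₀ → i₀ ≤ i → k < n → V i k ≢ 0 → ∃ λ k₀ → (k₀ < n) × (V i₀ k₀ ≡ V i k)
  V-ancestor i k i₀ i₀≤i k<n v≢0 with m≤n⇒m<n∨m≡n i₀≤i
  ... | inj₂ refl = k , k<n , refl
  V-ancestor (suc i) k i₀ _ k<n v≢0 | inj₁ i₀<1+i with pass i k
  ... | true  = V-ancestor i k i₀ (s≤s⁻¹ i₀<1+i) k<n v≢0
  ... | false with k₁ , k₁<n , e ← H-ancestor i k (<⇒≤ k<n) v≢0
              with k₀ , k₀<n , e₀ ← V-ancestor i k₁ i₀ (s≤s⁻¹ i₀<1+i) k₁<n (λ z → v≢0 (trans (sym e) z))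
    = k₀ , k₀<n , trans e₀ e

  Crossing : ℕ → ℕ → Set
  Crossing i k = (i < n) × (k < n) × (pass i k ≡ true) × (H i k ≢ 0) × (V i k ≢ 0)

  -- `_≺_` is the order in which the labels stand on the initial cut: `_>_` for classic and `_<_`
  -- for bumpless pipe dreams.
  module Order (_≺_ : ℕ → ℕ → Set) (≺-asym : ∀ {a b} → a ≺ b → ¬ (b ≺ a))
               (≺-compare : ∀ {a b} → a ≢ b → (a ≺ b) ⊎ (b ≺ a))
               (sorted : ∀ {p q} → p < q → q < n → init p ≺ init q) where

    distinct : ∀ i k → k ≤ n → Ordered (λ a b → a ≢ 0 → b ≢ 0 → a ≢ b) i k
    distinct i k k≤n = ordered-run (λ _ _ a b → a ≢ 0 → b ≢ 0 → a ≢ b) (λ _ q → q)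
      (λ k<n _ O v≢0 h≢0 → ≢-sym (O .H-todo ≤-refl k<n h≢0 v≢0)) (λ q → q) (λ 0≢0 → contradiction refl 0≢0)
      z≤n (ordered-init (λ p<q q<n _ _ e → ≺-asym (sorted p<q q<n)
        (subst₂ _≺_ e (sym e) (sorted p<q q<n))) (λ 0≢0 → contradiction refl 0≢0))
      i k k≤n from-start

    Reduced : Set
    Reduced = ∀ {i k} → Crossing i k → H i k ≺ V i k

    -- To get in front of `v` again, `h` would have to pass vertically through a crossing with `v`
    -- horizontal, and there `red` gives the opposite order. The invariant carries `i₁ < n` because
    -- `Crossing` only speaks of rows inside the grid.
    not-before : ∀ {i k} → Reduced → Crossing i k → ∀ i′ k′ → k′ ≤ n → Before i (suc k) i′ k′ → i′ < n →
      Ordered (λ a b → ¬ ((a ≡ H i k) × (b ≡ V i k))) i′ k′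
    not-before {i} {k} red X@(i<n , k<n , px , h≢0 , v≢0) i′ k′ k′≤n b i′<n = weaken
      (ordered-run (λ i₁ _ a b → i₁ < n → ¬ ((a ≡ h) × (b ≡ v))) (λ _ q → q)
        (λ {i₁} {k₁} k₁<n p _ i₁<n (eV , eH) → ≺-asym (red X)
          (subst₂ _≺_ eH eV (red (i₁<n , k₁<n , p , (λ z → v≢0 (trans (sym eH) z)) ,
            (λ z → h≢0 (trans (sym eV) z))))))
        (λ q 1+i<n → q (<⇒≤ 1+i<n)) (λ _ (e , _) → h≢0 (sym e)) k<n start i′ k′ k′≤n b)
      where
      h v : ℕ
      h = H i k
      v = V i k
      D : Ordered (λ a b → a ≢ 0 → b ≢ 0 → a ≢ b) i (suc k)
      D = distinct i (suc k) k<n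
      v≡ : V (suc i) k ≡ v
      v≡ rewrite px = refl
      h≡ : H i (suc k) ≡ h
      h≡ rewrite px = refl
      distinct-at : ∀ {a b c} → a ≡ c → c ≢ 0 → b ≡ c → ¬ (a ≢ 0 → b ≢ 0 → a ≢ b)
      distinct-at refl c≢0 refl ne = ne c≢0 c≢0 refl
      start : Ordered (λ a b → i < n → ¬ ((a ≡ h) × (b ≡ v))) i (suc k)
      -- Just after the crossing `v` stands directly before `h`; by `distinct` neither label occurs
      -- elsewhere on the cut.
      start = record
        { done-done = λ p<q q<1+k _ (e , _) → distinct-at e h≢0 h≡ (D .done-H (<-trans p<q q<1+k))
        ; done-H    = λ p<1+k _ (e , _) → distinct-at e h≢0 h≡ (D .done-H p<1+k)
        ; done-todo = λ _ k<q q<n _ (_ , e) → distinct-at v≡ v≢0 e (D .done-todo ≤-refl k<q q<n)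
        ; H-todo    = λ k<q q<n _ (_ , e) → distinct-at v≡ v≢0 e (D .done-todo ≤-refl k<q q<n)
        ; todo-todo = λ k<p p<q q<n _ (_ , e) → distinct-at v≡ v≢0 e
          (D .done-todo ≤-refl (<⇒≤ (<-≤-trans (s≤s k<p) p<q)) q<n)
        }
      weaken : Ordered (λ a b → i′ < n → ¬ ((a ≡ h) × (b ≡ v))) i′ k′ → Ordered (λ a b → ¬ ((a ≡ h) × (b ≡ v))) i′ k′
      weaken O = record
        { done-done = λ x y → O .done-done x y i′<n
        ; done-H    = λ x → O .done-H x i′<n
        ; done-todo = λ x y z → O .done-todo x y z i′<n
        ; H-todo    = λ x y → O .H-todo x y i′<n
        ; todo-todo = λ x y z → O .todo-todo x y z i′<n
        }

    Same : ℕ → ℕ → ℕ → ℕ → Set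
    Same i k i′ k′ = ((H i k ≡ H i′ k′) × (V i k ≡ V i′ k′)) ⊎ ((H i k ≡ V i′ k′) × (V i k ≡ H i′ k′))

    -- If the pipes exchange their roles at the second crossing, `red` holds there in the opposite
    -- order. If they keep them, the later crossing shows `h` before `v` again, against
    -- `not-before`.
    crossing-unique : Reduced → ∀ {i k i′ k′} → Crossing i k → Crossing i′ k′ → Same i k i′ k′ → (i ≡ i′) × (k ≡ k′)
    crossing-unique red {i} {k} {i′} {k′} X X′ (inj₂ (e , e′)) =
      contradiction (subst₂ _≺_ (sym e′) (sym e) (red X′)) (≺-asym (red X))
    crossing-unique red {i} {k} {i′} {k′} X@(i<n , k<n , _) X′@(i′<n , k′<n , _) (inj₁ (e , e′))
      with <-cmp i i′ | <-cmp k k′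
    ... | tri≈ _ refl _ | tri≈ _ refl _ = refl , refl
    ... | tri< i<i′ _ _ | _ = contradiction (sym e , sym e′) (not-before red X i′ k′ (<⇒≤ k′<n)
      (inj₁ i<i′) i′<n .H-todo ≤-refl k′<n)
    ... | tri> _ _ i′<i | _ = contradiction (e , e′) (not-before red X′ i k (<⇒≤ k<n)
      (inj₁ i′<i) i<n .H-todo ≤-refl k<n)
    ... | tri≈ _ refl _ | tri< k<k′ _ _ = contradiction (sym e , sym e′) (not-before red X i′ k′ (<⇒≤ k′<n)
      (inj₂ (refl , k<k′)) i′<n .H-todo ≤-refl k′<n)
    ... | tri≈ _ refl _ | tri> _ _ k′<k = contradiction (e , e′) (not-before red X′ i k (<⇒≤ k<n)
      (inj₂ (refl , k′<k)) i<n .H-todo ≤-refl k<n)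

    -- The initial cut is sorted, so a pair in the wrong order was exchanged at some earlier tile;
    -- the invariant carries that tile along.
    inverted⇒crossed : ∀ {i k} → Crossing i k → V i k ≺ H i k →
      ∃₂ λ i₀ k₀ → Crossing i₀ k₀ × Before i₀ (suc k₀) i k × (H i₀ k₀ ≡ V i k) × (V i₀ k₀ ≡ H i k)
    inverted⇒crossed {i} {k} (i<n , k<n , _ , h≢0 , v≢0) v≺h =
      ordered-run (λ i₁ k₁ a b → i₁ < n → a ≡ H i k → b ≡ V i k → Crossed i₁ k₁)
        (λ _ q l e e′ → later (q l e e′))
        (λ {i₁} {k₁} k₁<n p _ i₁<n e e′ → i₁ , k₁ ,
          (i₁<n , k₁<n , p , (λ z → v≢0 (trans (sym e′) z)) , (λ z → h≢0 (trans (sym e) z))) ,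
          inj₂ (refl , ≤-refl) , e′ , e)
        (λ q l e e′ → next-row (q (<⇒≤ l) e e′))
        (λ _ e → contradiction (sym e) h≢0) z≤n
        (ordered-init (λ p<q q<n _ e e′ → contradiction (subst₂ _≺_ e e′ (sorted p<q q<n)) (≺-asym v≺h))
          (λ _ e → contradiction (sym e) h≢0))
        i k (<⇒≤ k<n) from-start .H-todo ≤-refl k<n i<n refl refl
      where
      Crossed : ℕ → ℕ → Set
      Crossed i₁ k₁ = ∃₂ λ i₀ k₀ → Crossing i₀ k₀ × Before i₀ (suc k₀) i₁ k₁ × (H i₀ k₀ ≡ V i k) × (V i₀ k₀ ≡ H i k)
      later : ∀ {i₁ k₁} → Crossed i₁ k₁ → Crossed i₁ (suc k₁)
      later (i₀ , k₀ , X₀ , inj₁ l , e) = i₀ , k₀ , X₀ , inj₁ l , e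
      later (i₀ , k₀ , X₀ , inj₂ (q , l) , e) = i₀ , k₀ , X₀ , inj₂ (q , m≤n⇒m≤1+n l) , e
      next-row : ∀ {i₁} → Crossed i₁ n → Crossed (suc i₁) 0
      next-row (i₀ , k₀ , X₀ , inj₁ l , e) = i₀ , k₀ , X₀ , inj₁ (m≤n⇒m≤1+n l) , e
      next-row (i₀ , k₀ , X₀ , inj₂ (refl , l) , e) = i₀ , k₀ , X₀ , inj₁ ≤-refl , e

    unique⇒reduced : (∀ {i k i′ k′} → Crossing i k → Crossing i′ k′ → Same i k i′ k′ → (i ≡ i′) × (k ≡ k′)) → Reduced
    unique⇒reduced uniq {i} {k} X@(i<n , k<n , px , h≢0 , v≢0)
      with ≺-compare (distinct i k (<⇒≤ k<n) .H-todo ≤-refl k<n h≢0 v≢0)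
    ... | inj₁ h≺v = h≺v
    ... | inj₂ v≺h with i₀ , k₀ , X₀ , b , e , e′ ← inverted⇒crossed X v≺h
                   with refl , refl ← uniq X₀ X (inj₂ (e , e′)) | b
    ...   | inj₁ i<i         = contradiction i<i (<-irrefl refl)
    ...   | inj₂ (_ , k+1≤k) = contradiction k+1≤k (<-irrefl refl)

    -- Suppose the vertical pipe `v` leaves first, in row `s`. If the crossing lies in row `s` or
    -- above, then `h` stands before `v` on the cut at the end of row `s`, against `not-before`. If
    -- it lies below, `v` occurs below the row it has left, against `distinct`.
    exit-order : Reduced → ∀ {i k r s} → Crossing i k → r < n → s < n → H r n ≡ H i k → H s n ≡ V i k → r < s
    exit-order red {i} {k} {r} {s} X@(i<n , k<n , _ , h≢0 , v≢0) r<n s<n er es with <-cmp r s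
    ... | tri< r<s _ _  = r<s
    ... | tri≈ _ refl _ = contradiction (trans (sym er) es) (distinct i k (<⇒≤ k<n) .H-todo ≤-refl k<n h≢0 v≢0)
    ... | tri> _ _ s<r with k₁ , k₁<n , e₁ ← H-ancestor r n ≤-refl (λ z → h≢0 (trans (sym er) z))
                       with k₀ , k₀<n , e₀ ← V-ancestor r k₁ (suc s) s<r k₁<n
                         (λ z → h≢0 (trans (sym er) (trans (sym e₁) z)))
                       with i ≤? s
    ...   | yes i≤s = contradiction (trans e₀ (trans e₁ er) , es)
                        (not-before red X s n ≤-refl (before (m≤n⇒m<n∨m≡n i≤s)) s<n .done-H k₀<n)
      where
      before : (i < s) ⊎ (i ≡ s) → Before i (suc k) s n
      before (inj₁ l)    = inj₁ l
      before (inj₂ refl) = inj₂ (refl , k<n)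
    ...   | no i≰s with k₂ , k₂<n , e₂ ← V-ancestor i k (suc s) (≰⇒> i≰s) k<n v≢0
      = contradiction (trans e₂ (sym es)) (distinct s n ≤-refl .done-H k₂<n (λ z → v≢0 (trans (sym e₂) z))
        (λ z → v≢0 (trans (sym es) z)))

-- Traced pipes

module Paths (n : ℕ) (pass : ℕ → ℕ → Bool) (init : ℕ → ℕ) where
  open Labels n pass init

  port : Port → ℕ → ℕ → ℕ
  port inV i k = V i k
  port inH i k = H i k

  down : Port → Bool → Bool
  down inV b = b
  down inH b = not b

  -- A fuel-free description of the results of `pdTrace` and `bpdTrace`, common to both models.
  data Path : Port → ℕ → ℕ → List (ℕ × ℕ) → Maybe ℕ → Set where
    bottom : ∀ {d i k} → down d (pass i k) ≡ true → suc i ≡ n → Path d i k ((i , k) ∷ []) nothing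
    exit   : ∀ {d i k} → down d (pass i k) ≡ false → suc k ≡ n → Path d i k ((i , k) ∷ []) (just i)
    south  : ∀ {d i k ts e} → down d (pass i k) ≡ true → suc i < n → Path inV (suc i) k ts e → Path d i k
      ((i , k) ∷ ts) e
    side   : ∀ {d i k ts e} → down d (pass i k) ≡ false → suc k < n → Path inH i (suc k) ts e → Path d i k
      ((i , k) ∷ ts) e

  port-down : ∀ d i k → down d (pass i k) ≡ true → V (suc i) k ≡ port d i k
  port-down d i k e with pass i k
  port-down inV i k e  | true  = refl
  port-down inH i k () | true
  port-down inV i k () | false
  port-down inH i k e  | false = refl

  port-side : ∀ d i k → down d (pass i k) ≡ false → H i (suc k) ≡ port d i k
  port-side d i k e with pass i k
  port-side inV i k () | true
  port-side inH i k e  | true  = refl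
  port-side inV i k e  | false = refl
  port-side inH i k () | false

  path-tiles : ∀ {d i k ts e} → Path d i k ts e → i < n → k < n → ∀ {i′ k′} → (i′ , k′) ∈ ts →
    (i′ < n) × (k′ < n) × ∃ λ d′ → port d′ i′ k′ ≡ port d i k
  path-tiles {d} (bottom _ _)  i<n k<n (here refl) = i<n , k<n , d , refl
  path-tiles {d} (exit _ _)    i<n k<n (here refl) = i<n , k<n , d , refl
  path-tiles {d} (south _ _ _) i<n k<n (here refl) = i<n , k<n , d , refl
  path-tiles {d} (side _ _ _)  i<n k<n (here refl) = i<n , k<n , d , refl
  path-tiles {d} {i} {k} (south e i+1<n p) i<n k<n (there t)
    with a , b , d′ , q ← path-tiles p i+1<n k<n t = a , b , d′ , trans q (port-down d i k e)
  path-tiles {d} {i} {k} (side e k+1<n p) i<n k<n (there t)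
    with a , b , d′ , q ← path-tiles p i<n k+1<n t = a , b , d′ , trans q (port-side d i k e)

  path-exit : ∀ {d i k ts r} → Path d i k ts (just r) → H r n ≡ port d i k
  path-exit {d} {i} {k} (exit e refl)   = port-side d i k e
  path-exit {d} {i} {k} (south e _ p) = trans (path-exit p) (port-down d i k e)
  path-exit {d} {i} {k} (side e _ p)  = trans (path-exit p) (port-side d i k e)

  path-exit-row : ∀ {d i k ts r} → Path d i k ts (just r) → i < n → r < n
  path-exit-row (exit _ _)        i<n = i<n
  path-exit-row (south _ i+1<n p) i<n = path-exit-row p i+1<n
  path-exit-row (side _ _ p)      i<n = path-exit-row p i<n

  path-exits : (∀ k → k < n → V n k ≡ 0) → ∀ {d i k ts e} → Path d i k ts e → k < n → port d i k ≢ 0 → ∃ λ r → e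
    ≡ just r
  path-exits empty {d} {i} {k} (bottom e refl) k<n l≢0 = contradiction (trans (sym (port-down d i k e))
    (empty k k<n)) l≢0
  path-exits empty (exit _ _) k<n l≢0 = _ , refl
  path-exits empty {d} {i} {k} (south e _ p) k<n l≢0 = path-exits empty p k<n
    (λ z → l≢0 (trans (sym (port-down d i k e)) z))
  path-exits empty {d} {i} {k} (side e k+1<n p) k<n l≢0 = path-exits empty p k+1<n
    (λ z → l≢0 (trans (sym (port-side d i k e)) z))

  -- `i + k` grows by one with each step. Hence no tile is visited twice, and the same quantity
  -- bounds the fuel of the tracers.
  path-later : ∀ {d i k ts e} → Path d i k ts e → ∀ {i′ k′} → (i′ , k′) ∈ ts → i + k ≤ i′ + k′
  path-later (bottom _ _)  (here refl) = ≤-refl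
  path-later (exit _ _)    (here refl) = ≤-refl
  path-later (south _ _ p) (here refl) = ≤-refl
  path-later (side _ _ p)  (here refl) = ≤-refl
  path-later (south _ _ p) (there t) = ≤-trans (n≤1+n _) (path-later p t)
  path-later {i = i} {k} (side _ _ p)  (there t) = ≤-trans (≤-trans (n≤1+n _) (≤-reflexive (sym (+-suc i k))))
    (path-later p t)

  path-unique : ∀ {d i k ts e} → Path d i k ts e → Unique ts
  path-unique (bottom _ _)  = [] ∷ []
  path-unique (exit _ _)    = [] ∷ []
  path-unique (south _ _ p) = All.tabulate (λ t → λ { refl → <-irrefl refl (path-later p t) }) ∷ path-unique p
  path-unique {i = i} {k} (side _ _ p)  =
    All.tabulate (λ t → λ { refl → <-irrefl refl (≤-trans (≤-reflexive (sym (+-suc i k))) (path-later p t)) }) ∷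
      path-unique p

  Through : List (ℕ × ℕ) → Port → ℕ → ℕ → Set
  Through ts d i k = ∃₂ λ ts′ e → Path d i k ts′ e × (∀ {t} → t ∈ ts′ → t ∈ ts)

  go-south : ∀ {ts d i k} → down d (pass i k) ≡ true → suc i < n → Through ts d i k → Through ts inV (suc i) k
  go-south e l (_ , _ , bottom _ refl , _)    = contradiction l (<-irrefl refl)
  go-south e l (_ , _ , exit e′ _ , _)        = contradiction (trans (sym e) e′) λ ()
  go-south e l (_ , _ , south _ _ p , inc)    = _ , _ , p , λ t → inc (there t)
  go-south e l (_ , _ , side e′ _ _ , _)      = contradiction (trans (sym e) e′) λ ()

  go-side : ∀ {ts d i k} → down d (pass i k) ≡ false → suc k < n → Through ts d i k → Through ts inH i (suc k)
  go-side e l (_ , _ , bottom e′ _ , _)      = contradiction (trans (sym e) e′) λ ()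
  go-side e l (_ , _ , exit _ refl , _)      = contradiction l (<-irrefl refl)
  go-side e l (_ , _ , south e′ _ _ , _)     = contradiction (trans (sym e) e′) λ ()
  go-side e l (_ , _ , side _ _ p , inc)     = _ , _ , p , λ t → inc (there t)

  -- The induction follows the label backwards from the given edge to the top row and then replays
  -- the steps on the path that starts there.
  path-through : ∀ {k₀ ts e} → (∀ {k} → k < n → init k ≡ init k₀ → k ≡ k₀) → init k₀ ≢ 0 → Path inV 0 k₀ ts e →
    ∀ d i k → i < n → k < n → port d i k ≡ init k₀ → Through ts d i k
  path-through inj l≢0 p inV zero k i<n k<n q with refl ← inj k<n q = _ , _ , p , λ t → t
  path-through inj l≢0 p inV (suc i) k i<n k<n q with pass i k in eq
  ... | true  = go-south {d = inV} eq i<n (path-through inj l≢0 p inV i k (<⇒≤ i<n) k<n q)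
  ... | false = go-south {d = inH} (cong not eq) i<n (path-through inj l≢0 p inH i k (<⇒≤ i<n) k<n q)
  path-through inj l≢0 p inH i zero i<n k<n q = contradiction (sym q) l≢0
  path-through inj l≢0 p inH i (suc k) i<n k<n q with pass i k in eq
  ... | true  = go-side {d = inH} (cong not eq) k<n (path-through inj l≢0 p inH i k i<n (<⇒≤ k<n) q)
  ... | false = go-side {d = inV} eq k<n (path-through inj l≢0 p inV i k i<n (<⇒≤ k<n) q)

  through-∈ : ∀ {ts d i k} → Through ts d i k → (i , k) ∈ ts
  through-∈ (_ , _ , bottom _ _ , inc)  = inc (here refl)
  through-∈ (_ , _ , exit _ _ , inc)    = inc (here refl)
  through-∈ (_ , _ , south _ _ _ , inc) = inc (here refl)
  through-∈ (_ , _ , side _ _ _ , inc)  = inc (here refl)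

-- Counting the crossings of two pipes

∈ᵇ⇒∈ : ∀ t ts → (t ∈ᵇ ts) ≡ true → t ∈ ts
∈ᵇ⇒∈ (r , c) ((r′ , c′) ∷ ts) e with r ≡ᵇ r′ in er | c ≡ᵇ c′ in ec
... | true  | true
  rewrite ≡ᵇ⇒≡ r r′ (subst T (sym er) _) | ≡ᵇ⇒≡ c c′ (subst T (sym ec) _) = here refl
... | true  | false = there (∈ᵇ⇒∈ (r , c) ts e)
... | false | _     = there (∈ᵇ⇒∈ (r , c) ts e)

∈⇒∈ᵇ : ∀ {t ts} → t ∈ ts → (t ∈ᵇ ts) ≡ true
∈⇒∈ᵇ {r , c} (here refl) rewrite ≡ᵇ-refl r | ≡ᵇ-refl c = refl
∈⇒∈ᵇ {r , c} {(r′ , c′) ∷ ts} (there t) with (r ≡ᵇ r′) ∧ (c ≡ᵇ c′)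
... | true  = refl
... | false = ∈⇒∈ᵇ t

length-filter≤1 : ∀ {A : Set} (P : A → Bool) ts → Unique ts →
  (∀ {s t} → s ∈ ts → t ∈ ts → P s ≡ true → P t ≡ true → s ≡ t) → length (filterᵇ P ts) ≤ 1
length-filter≤1 P [] u f = z≤n
length-filter≤1 P (t ∷ ts) (t∉ ∷ u) f with P t in eq
... | false = length-filter≤1 P ts u λ a b → f (there a) (there b)
... | true  = s≤s (none ts λ s∈ Ps → All.lookup t∉ s∈ (f (here refl) (there s∈) eq Ps))
  where
  none : ∀ ss → (∀ {s} → s ∈ ss → P s ≢ true) → length (filterᵇ P ss) ≤ 0
  none []       g = z≤n
  none (s ∷ ss) g with P s in eq
  ... | true  = contradiction eq (g (here refl))
  ... | false = none ss λ s∈ → g (there s∈)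

length-filter≥1 : ∀ {A : Set} (P : A → Bool) {s} ts → s ∈ ts → P s ≡ true → 1 ≤ length (filterᵇ P ts)
length-filter≥1 P (t ∷ ts) (here refl) Ps rewrite Ps = s≤s z≤n
length-filter≥1 P (t ∷ ts) (there s∈) Ps with P t
... | true  = s≤s z≤n
... | false = length-filter≥1 P ts s∈ Ps

length-filter≥2 : ∀ {A : Set} (P : A → Bool) {s t} ts → s ∈ ts → t ∈ ts → P s ≡ true → P t ≡ true → s ≢ t →
  2 ≤ length (filterᵇ P ts)
length-filter≥2 P (u ∷ ts) (here refl) (here refl) Ps Pt s≢t = contradiction refl s≢t
length-filter≥2 P (u ∷ ts) (here refl) (there t∈) Ps Pt s≢t rewrite Ps = s≤s (length-filter≥1 P ts t∈ Pt)
length-filter≥2 P (u ∷ ts) (there s∈) (here refl) Ps Pt s≢t rewrite Pt = s≤s (length-filter≥1 P ts s∈ Ps)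
length-filter≥2 P (u ∷ ts) (there s∈) (there t∈) Ps Pt s≢t with P u
... | true  = m≤n⇒m≤1+n (length-filter≥2 P ts s∈ t∈ Ps Pt s≢t)
... | false = length-filter≥2 P ts s∈ t∈ Ps Pt s≢t

∧-true : ∀ a {b} → a ∧ b ≡ true → (a ≡ true) × (b ≡ true)
∧-true true {true} refl = refl , refl

module Pipes (n : ℕ) (pass : ℕ → ℕ → Bool) (init : ℕ → ℕ)
             (_≺_ : ℕ → ℕ → Set) (≺-asym : ∀ {a b} → a ≺ b → ¬ (b ≺ a))
             (≺-compare : ∀ {a b} → a ≢ b → (a ≺ b) ⊎ (b ≺ a))
             (sorted : ∀ {p q} → p < q → q < n → init p ≺ init q)
             (init≢0 : ∀ {p} → p < n → init p ≢ 0) where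
  open Labels n pass init public
  open Order _≺_ ≺-asym ≺-compare sorted public
  open Paths n pass init public

  init-injective : ∀ {p q} → p < n → q < n → init p ≡ init q → p ≡ q
  init-injective {p} {q} p<n q<n e with <-cmp p q
  ... | tri< p<q _ _ = contradiction (subst₂ _≺_ e (sym e) (sorted p<q q<n)) (≺-asym (sorted p<q q<n))
  ... | tri≈ _ e′ _  = e′
  ... | tri> _ _ q<p = contradiction (subst₂ _≺_ (sym e) e (sorted q<p p<n)) (≺-asym (sorted q<p p<n))

  -- `κ` translates traversal coordinates into those of the tracer. `isX` is kept apart from `pass`
  -- because a bumpless tile that labels pass straight is no crossing if one of its edges is empty.
  module _ (isX : ℕ → ℕ → Bool) (pipe : Fin n → Tiles) (κ : ℕ × ℕ → ℕ × ℕ)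
           (κ-injective : ∀ {i k i′ k′} → i < n → k < n → i′ < n → k′ < n → κ (i , k) ≡ κ (i′ , k′) → (i ≡ i′) ×
             (k ≡ k′))
           (idx : Fin n → ℕ) (idx<n : ∀ p → idx p < n) (idx-surjective : ∀ {k} → k < n → ∃ λ p → idx p ≡ k)
           (idx-injective : ∀ {p q} → idx p ≡ idx q → p ≡ q)
           (paths : ∀ p → ∃₂ λ ts e → Path inV 0 (idx p) ts e × (pipe p ≡ List.map κ ts))
           (X⇒pass : ∀ {i k} → i < n → k < n → isX (proj₁ (κ (i , k))) (proj₂ (κ (i , k))) ≡ true → pass i k ≡ true)
           (crossing⇒X : ∀ {i k} → Crossing i k → isX (proj₁ (κ (i , k))) (proj₂ (κ (i , k))) ≡ true) where

    pipe-tile : ∀ p {t} → t ∈ pipe p → ∃₂ λ i k → (i < n) × (k < n) × (t ≡ κ (i , k)) × ∃ λ d → port d i k ≡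
      init (idx p)
    pipe-tile p t∈ with ts , e , π , eq ← paths p
                   with (i , k) , t∈ts , refl ← ∈-map⁻ κ (subst (_ ∈_) eq t∈)
                   with i<n , k<n , d , q ← path-tiles π (≤-trans (s≤s z≤n) (idx<n p)) (idx<n p) t∈ts
      = i , k , i<n , k<n , refl , d , q

    tile-pipe : ∀ p d {i k} → i < n → k < n → port d i k ≡ init (idx p) → κ (i , k) ∈ pipe p
    tile-pipe p d {i} {k} i<n k<n q with ts , e , π , eq ← paths p = subst (_ ∈_) (sym eq)
      (∈-map⁺ κ (through-∈ (path-through (λ k<n → init-injective k<n (idx<n p)) (init≢0 (idx<n p)) π d i k i<n
        k<n q)))

    label-pipe : ∀ d {i k} → i < n → k < n → port d i k ≢ 0 → ∃ λ p → port d i k ≡ init (idx p)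
    label-pipe inV {i} {k} i<n k<n l≢0 with k₀ , k₀<n , e ← V-ancestor i k 0 z≤n k<n l≢0
                                       with p , refl ← idx-surjective k₀<n = p , sym e
    label-pipe inH {i} {k} i<n k<n l≢0 with k₁ , k₁<n , e₁ ← H-ancestor i k (<⇒≤ k<n) l≢0
                                       with k₀ , k₀<n , e ← V-ancestor i k₁ 0 z≤n k₁<n (λ z → l≢0 (trans (sym e₁) z))
                                       with p , refl ← idx-surjective k₀<n = p , sym (trans e e₁)

    pipe-unique : ∀ p → Unique (pipe p)
    pipe-unique p with ts , e , π , eq ← paths p = subst Unique (sym eq) (go ts (path-unique π)
      (λ t∈ → let i<n , k<n , _ = path-tiles π (≤-trans (s≤s z≤n) (idx<n p)) (idx<n p) t∈ in i<n , k<n))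
      where
      go : ∀ ts → Unique ts → (∀ {i k} → (i , k) ∈ ts → (i < n) × (k < n)) → Unique (List.map κ ts)
      go []       u b = []
      go ((i , k) ∷ ts) (t∉ ∷ u) b = Allₚ.map⁺ (All.tabulate λ { {i′ , k′} s∈ e → All.lookup t∉ s∈
        (let i≡ , k≡ = κ-injective (proj₁ (b (here refl))) (proj₂ (b (here refl))) (proj₁ (b (there s∈))) (proj₂ (b (there s∈))) e
         in cong₂ _,_ i≡ k≡) }) ∷ go ts u λ s∈ → b (there s∈)

    reduced⇒noDoubleCrossing : Reduced → NoDoubleCrossing n isX pipe
    reduced⇒noDoubleCrossing red p q p≢q = length-filter≤1 _ (pipe p) (pipe-unique p) same
      where
      same : ∀ {s t} → s ∈ pipe p → t ∈ pipe p →
        isX (proj₁ s) (proj₂ s) ∧ (s ∈ᵇ pipe q) ≡ true → isX (proj₁ t) (proj₂ t) ∧ (t ∈ᵇ pipe q) ≡ true → s ≡ t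
      same {s} {t} s∈ t∈ Ps Pt
        with Xs , s∈q ← ∧-true (isX (proj₁ s) (proj₂ s)) Ps | Xt , t∈q ← ∧-true (isX (proj₁ t) (proj₂ t)) Pt
        with i , k , i<n , k<n , refl , d , e ← pipe-tile p s∈ | i′ , k′ , i′<n , k′<n , refl , d′ ,
          e′ ← pipe-tile p t∈
        with j , l , j<n , l<n , eκ , c , f ← pipe-tile q (∈ᵇ⇒∈ _ (pipe q) s∈q)
           | j′ , l′ , j′<n , l′<n , eκ′ , c′ , f′ ← pipe-tile q (∈ᵇ⇒∈ _ (pipe q) t∈q)
        with refl , refl ← κ-injective i<n k<n j<n l<n eκ | refl , refl ← κ-injective i′<n k′<n j′<n l′<n eκ′
        = finish d c e f d′ c′ e′ f′
        where
        a b : ℕ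
        a = init (idx p)
        b = init (idx q)
        a≢b : a ≢ b
        a≢b z = p≢q (idx-injective (init-injective (idx<n p) (idx<n q) z))
        X : ∀ {h v} → H i k ≡ h → V i k ≡ v → h ≢ 0 → v ≢ 0 → Crossing i k
        X e e′ h v = i<n , k<n , X⇒pass i<n k<n Xs , (λ z → h (trans (sym e) z)) , (λ z → v (trans (sym e′) z))
        X′ : ∀ {h v} → H i′ k′ ≡ h → V i′ k′ ≡ v → h ≢ 0 → v ≢ 0 → Crossing i′ k′
        X′ e e′ h v = i′<n , k′<n , X⇒pass i′<n k′<n Xt , (λ z → h (trans (sym e) z)) , (λ z → v (trans (sym e′) z))
        a≢0 : a ≢ 0
        a≢0 = init≢0 (idx<n p)
        b≢0 : b ≢ 0
        b≢0 = init≢0 (idx<n q)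
        done : (i ≡ i′) × (k ≡ k′) → κ (i , k) ≡ κ (i′ , k′)
        done (refl , refl) = refl
        -- Different labels on one tile use different ports. What remains is which pipe is
        -- horizontal at each of the two tiles, and this decides between the two forms of `Same`.
        finish : ∀ d c → port d i k ≡ a → port c i k ≡ b → ∀ d′ c′ → port d′ i′ k′ ≡ a → port c′ i′ k′ ≡ b → κ
          (i , k) ≡ κ (i′ , k′)
        finish inV inV e f _ _ _ _ = contradiction (trans (sym e) f) a≢b
        finish inH inH e f _ _ _ _ = contradiction (trans (sym e) f) a≢b
        finish _ _ _ _ inV inV e f = contradiction (trans (sym e) f) a≢b
        finish _ _ _ _ inH inH e f = contradiction (trans (sym e) f) a≢b
        finish inV inH e f inV inH e′ f′ = done (crossing-unique red (X f e b≢0 a≢0) (X′ f′ e′ b≢0 a≢0)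
          (inj₁ (trans f (sym f′) , trans e (sym e′))))
        finish inH inV e f inH inV e′ f′ = done (crossing-unique red (X e f a≢0 b≢0) (X′ e′ f′ a≢0 b≢0)
          (inj₁ (trans e (sym e′) , trans f (sym f′))))
        finish inV inH e f inH inV e′ f′ = done (crossing-unique red (X f e b≢0 a≢0) (X′ e′ f′ a≢0 b≢0)
          (inj₂ (trans f (sym f′) , trans e (sym e′))))
        finish inH inV e f inV inH e′ f′ = done (crossing-unique red (X e f a≢0 b≢0) (X′ f′ e′ b≢0 a≢0)
          (inj₂ (trans e (sym e′) , trans f (sym f′))))

    crossing-twice : ∀ {i k i′ k′} → Crossing i k → Crossing i′ k′ → Same i k i′ k′ →
      ∀ p q → H i k ≡ init (idx p) → V i k ≡ init (idx q) → κ (i , k) ≢ κ (i′ , k′) →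
      2 ≤ crossings isX (pipe p) (pipe q)
    crossing-twice {i} {k} {i′} {k′} X@(i<n , k<n , _) X′@(i′<n , k′<n , _) S p q ep eq ne =
      length-filter≥2 _ (pipe p) (tile-pipe p inH i<n k<n ep) (other S)
        (cong₂ _∧_ (crossing⇒X X) (∈⇒∈ᵇ (tile-pipe q inV i<n k<n eq)))
        (cong₂ _∧_ (crossing⇒X X′) (∈⇒∈ᵇ (other′ S))) ne
      where
      other : Same i k i′ k′ → κ (i′ , k′) ∈ pipe p
      other (inj₁ (e , _)) = tile-pipe p inH i′<n k′<n (trans (sym e) ep)
      other (inj₂ (e , _)) = tile-pipe p inV i′<n k′<n (trans (sym e) ep)
      other′ : Same i k i′ k′ → κ (i′ , k′) ∈ pipe q
      other′ (inj₁ (_ , e)) = tile-pipe q inV i′<n k′<n (trans (sym e) eq)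
      other′ (inj₂ (_ , e)) = tile-pipe q inH i′<n k′<n (trans (sym e) eq)

    noDoubleCrossing⇒reduced : NoDoubleCrossing n isX pipe → Reduced
    noDoubleCrossing⇒reduced ndc = unique⇒reduced same
      where
      same : ∀ {i k i′ k′} → Crossing i k → Crossing i′ k′ → Same i k i′ k′ → (i ≡ i′) × (k ≡ k′)
      same {i} {k} {i′} {k′} X@(i<n , k<n , _ , h≢0 , v≢0) X′@(i′<n , k′<n , _) S
        with p , ep ← label-pipe inH i<n k<n h≢0 | q , eq ← label-pipe inV i<n k<n v≢0
        = decide (i ≟ i′) (k ≟ k′)
        where
        p≢q : p ≢ q
        p≢q refl = distinct i k (<⇒≤ k<n) .H-todo ≤-refl k<n h≢0 v≢0 (trans ep (sym eq))
        absurd : ¬ ((i ≡ i′) × (k ≡ k′)) → ∀ {A : Set} → A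
        absurd ne = contradiction (crossing-twice X X′ S p q ep eq λ z → ne (κ-injective i<n k<n i′<n k′<n z))
          (≤⇒≯ (ndc p q p≢q))
        decide : Dec (i ≡ i′) → Dec (k ≡ k′) → (i ≡ i′) × (k ≡ k′)
        decide (yes e) (yes e′) = e , e′
        decide (no ne) _        = absurd λ z → ne (proj₁ z)
        decide (yes _) (no ne)  = absurd λ z → ne (proj₂ z)

-- The boolean test in terms of edge labels

≡ᵇ-sound : ∀ a b → (a ≡ᵇ b) ≡ true → a ≡ b
≡ᵇ-sound a b e = ≡ᵇ⇒≡ a b (subst T (sym e) _)

empty⇒0 : ∀ (v : Vec ℕ n) → empty v ≡ true → ∀ k → lookup v k ≡ 0
empty⇒0 (zero ∷ v) e zero    = refl
empty⇒0 (zero ∷ v) e (suc k) = empty⇒0 v e k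

0⇒empty : ∀ (v : Vec ℕ n) → (∀ k → lookup v k ≡ 0) → empty v ≡ true
0⇒empty []      e = refl
0⇒empty (x ∷ v) e rewrite e zero = 0⇒empty v λ k → e (suc k)

-- `Rows` hands a vector of labels from row to row, `Labels` defines the same labels as functions of
-- the position. Comparing the two turns `valid` into statements about `V` and `H`, in which the
-- geometry is expressed.
module Link (𝕋 : TileSet) where
  open TileSet 𝕋
  open Rows 𝕋

  record Labelled {n} (p : ℕ → Bool) (g hs : ℕ → ℕ) (r : Vec Kind n) (v : Vec ℕ n) (h : ℕ) : Set where
    field
      pass≡  : ∀ k → p (toℕ k) ≡ pass (lookup r k)
      label≡ : ∀ k → g (toℕ k) ≡ lookup v k
      enter  : hs 0 ≡ h
      carry  : ∀ k → hs (suc k) ≡ (if p k then hs k else g k)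
  open Labelled

  labelled-tail : ∀ {p g hs a} {r : Vec Kind n} {x v h} → Labelled p g hs (a ∷ r) (x ∷ v) h →
    Labelled (λ k → p (suc k)) (λ k → g (suc k)) (λ k → hs (suc k)) r v (proj₂ (move (pass a) x h))
  labelled-tail {p = p} {g} {hs} {a} {x = x} {h = h} L = record
    { pass≡ = λ k → L .pass≡ (suc k) ; label≡ = λ k → L .label≡ (suc k) ; enter = move-H ; carry = λ k →
      L .carry (suc k) }
    where
    move-H : hs 1 ≡ proj₂ (move (pass a) x h)
    move-H rewrite L .carry 0 | L .pass≡ zero | L .label≡ zero | L .enter with pass a
    ... | true  = refl
    ... | false = refl

  row-exit : ∀ {p g hs} {r : Vec Kind n} {v h} → Labelled p g hs r v h → proj₂ (rowOut r v h) ≡ hs n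
  row-exit {r = []}    {[]}    L = sym (L .enter)
  row-exit {r = a ∷ r} {x ∷ v} L = row-exit (labelled-tail L)

  row-bottom : ∀ {p g hs} {r : Vec Kind n} {v h} → Labelled p g hs r v h →
    ∀ k → (if p (toℕ k) then g (toℕ k) else hs (toℕ k)) ≡ lookup (proj₁ (rowOut r v h)) k
  row-bottom {p = p} {g} {hs} {r = a ∷ r} {x ∷ v} {h} L zero
    rewrite L .pass≡ zero | L .label≡ zero | L .enter with pass a
  ... | true  = refl
  ... | false = refl
  row-bottom {r = a ∷ r} {x ∷ v} L (suc k) = row-bottom (labelled-tail L) k

  row-legal⁻ : ∀ {p g hs} {r : Vec Kind n} {v h} → Labelled p g hs r v h → rowLegal r v h ≡ true →
    ∀ k → legal (lookup r k) (g (toℕ k)) (hs (toℕ k)) ≡ true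
  row-legal⁻ {r = a ∷ r} {x ∷ v} {h} L l zero    = trans (cong₂ (legal a) (L .label≡ zero) (L .enter))
    (proj₁ (∧-true (legal a x h) l))
  row-legal⁻ {r = a ∷ r} {x ∷ v} {h} L l (suc k) = row-legal⁻ (labelled-tail L) (proj₂ (∧-true (legal a x h) l)) k

  row-legal⁺ : ∀ {p g hs} {r : Vec Kind n} {v h} → Labelled p g hs r v h →
    (∀ k → legal (lookup r k) (g (toℕ k)) (hs (toℕ k)) ≡ true) → rowLegal r v h ≡ true
  row-legal⁺ {r = []}    {[]}    L l = refl
  row-legal⁺ {r = a ∷ r} {x ∷ v} L l = cong₂ _∧_
    (trans (cong₂ (legal a) (sym (L .label≡ zero)) (sym (L .enter))) (l zero))
    (row-legal⁺ (labelled-tail L) λ k → l (suc k))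

  record Valid {m} (es : Vec ℕ m) (X : Vec (Vec Kind n) m) (V H : ℕ → ℕ → ℕ) : Set where
    field
      legal-all : ∀ i k → legal (lookup (lookup X i) k) (V (toℕ i) (toℕ k)) (H (toℕ i) (toℕ k)) ≡ true
      exits     : ∀ i → H (toℕ i) n ≡ suc (lookup es i)
      emptied   : ∀ (k : Fin n) → V m (toℕ k) ≡ 0
  open Valid public

  record Labelling {m n} (p : ℕ → ℕ → Bool) (V H : ℕ → ℕ → ℕ) (X : Vec (Vec Kind n) m) (v : Vec ℕ n) : Set where
    field
      passes : ∀ i k → p (toℕ i) (toℕ k) ≡ pass (lookup (lookup X i) k)
      top    : ∀ k → V 0 (toℕ k) ≡ lookup v k
      left   : ∀ i → H i 0 ≡ 0
      H-next : ∀ i k → H i (suc k) ≡ (if p i k then H i k else V i k)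
      V-next : ∀ i k → V (suc i) k ≡ (if p i k then V i k else H i k)
  open Labelling

  first-row : ∀ {p V H r} {X : Vec (Vec Kind n) m} {v} → Labelling p V H (r ∷ X) v → Labelled (p 0) (V 0) (H 0) r v 0
  first-row L = record { pass≡ = L .passes zero ; label≡ = L .top ; enter = L .left 0 ; carry = L .H-next 0 }

  other-rows : ∀ {p V H r} {X : Vec (Vec Kind n) m} {v} → Labelling p V H (r ∷ X) v →
    Labelling (λ i → p (suc i)) (λ i → V (suc i)) (λ i → H (suc i)) X (proj₁ (rowOut r v 0))
  other-rows L = record
    { passes = λ i → L .passes (suc i)
    ; top    = λ k → trans (L .V-next 0 (toℕ k)) (row-bottom (first-row L) k)
    ; left   = λ i → L .left (suc i)
    ; H-next = λ i → L .H-next (suc i)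
    ; V-next = λ i → L .V-next (suc i)
    }

  valid⁻ : ∀ {p V H} (es : Vec ℕ m) (X : Vec (Vec Kind n) m) v → Labelling p V H X v → valid es X v ≡ true →
    Valid es X V H
  valid⁻ [] [] v L ok = record
    { legal-all = λ () ; exits = λ () ; emptied = λ k → trans (L .top k) (empty⇒0 v ok k) }
  valid⁻ {V = V} {H} (e ∷ es) (r ∷ X) v L ok
    with l , ok₁ ← ∧-true (rowLegal r v 0) ok
    with x , ok₂ ← ∧-true (proj₂ (rowOut r v 0) ≡ᵇ suc e) ok₁
    with rest ← valid⁻ es X (proj₁ (rowOut r v 0)) (other-rows L) ok₂
    = record
    { legal-all = λ where
        zero    k → row-legal⁻ (first-row L) l k
        (suc i) k → rest .legal-all i k
    ; exits = λ where
        zero    → trans (sym (row-exit (first-row L))) (≡ᵇ-sound _ _ x)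
        (suc i) → rest .exits i
    ; emptied = rest .emptied
    }

  valid⁺ : ∀ {p V H} (es : Vec ℕ m) (X : Vec (Vec Kind n) m) v → Labelling p V H X v → Valid es X V H →
    valid es X v ≡ true
  valid⁺ [] [] v L ok = 0⇒empty v λ k → trans (sym (L .top k)) (ok .emptied k)
  valid⁺ (e ∷ es) (r ∷ X) v L ok = cong₂ _∧_
    (row-legal⁺ (first-row L) (ok .legal-all zero))
    (cong₂ _∧_
      (trans (cong (_≡ᵇ suc e) (trans (row-exit (first-row L)) (ok .exits zero))) (≡ᵇ-refl e))
      (valid⁺ es X (proj₁ (rowOut r v 0)) (other-rows L)
        (record { legal-all = λ i → ok .legal-all (suc i) ; exits = λ i → ok .exits
          (suc i) ; emptied = ok .emptied })))

≤ᵇ-sound : ∀ m n → (m ≤ᵇ n) ≡ true → m ≤ n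
≤ᵇ-sound m n e = ≤ᵇ⇒≤ m n (subst T (sym e) _)

≤ᵇ-false : ∀ {m n} → (m ≤ᵇ n) ≡ false → n < m
≤ᵇ-false e = ≰⇒> λ m≤n → subst T e (≤⇒≤ᵇ m≤n)

≤ᵇ-complete : ∀ {m n} → m ≤ n → (m ≤ᵇ n) ≡ true
≤ᵇ-complete {m} {n} m≤n with m ≤ᵇ n | ≤⇒≤ᵇ m≤n
... | true | _ = refl

<ᵇ-sound : ∀ m n → (m <ᵇ n) ≡ true → m < n
<ᵇ-sound m n e = <ᵇ⇒< m n (subst T (sym e) _)

<ᵇ-complete : ∀ {m n} → m < n → (m <ᵇ n) ≡ true
<ᵇ-complete {m} {n} l with m <ᵇ n | <⇒<ᵇ l
... | true | _ = refl

≢⇒<⊎> : ∀ {a b} → a ≢ b → (a < b) ⊎ (b < a)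
≢⇒<⊎> {a} {b} a≢b with <-cmp a b
... | tri< a<b _ _ = inj₁ a<b
... | tri≈ _ a≡b _ = contradiction a≡b a≢b
... | tri> _ _ b<a = inj₂ b<a

n∸k≢0 : ∀ {n k} → k < n → n ∸ k ≢ 0
n∸k≢0 k<n = m>n⇒m∸n≢0 k<n

-- Pipe dreams of boolean triangles

module Classic {n : ℕ} (T : BoolMat n) where

  -- Rows are counted from the top and columns from the right, starting with 0.
  pass : ℕ → ℕ → Bool
  pass i k = pdCross T (suc i) (n ∸ k)

  open Pipes n pass (n ∸_) _>_ <-asym
    (λ a≢b → swap (≢⇒<⊎> a≢b)) (λ p<q q<n → ∸-monoʳ-< p<q (<⇒≤ q<n)) n∸k≢0 public

  -- Tile `(i , k)` lies in row `suc i` and column `n ∸ k`, so the bound on row plus column reads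
  -- `i < k`.
  pass-staircase : ∀ i k → k < n → pass i k ≡ true → i < k
  pass-staircase i k k<n e
    with _ , e₁ ← ∧-true (1 ≤ᵇ suc i) e
    with a , e₂ ← ∧-true (suc i ≤ᵇ n ∸ 1) e₁
    with _ , e₃ ← ∧-true (1 ≤ᵇ n ∸ k) e₂
    with b , _  ← ∧-true (n ∸ k ≤ᵇ n ∸ suc i) e₃
    = ≮⇒≥ λ k<1+i → <⇒≱ (∸-monoʳ-< k<1+i (≤-trans (≤ᵇ-sound (suc i) (n ∸ 1) a) (m∸n≤m n 1)))
      (≤ᵇ-sound (n ∸ k) (n ∸ suc i) b)

  -- All edges of the staircase are occupied, so every cross of a pipe dream is a `Crossing`. Below
  -- it all edges are empty, so every pipe has left after row `n`.
  mutual
    V≢0 : ∀ i k → i ≤ k → k < n → V i k ≢ 0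
    V≢0 zero k _ k<n = n∸k≢0 k<n
    V≢0 (suc i) k i<k k<n with pass i k
    ... | true  = V≢0 i k (<⇒≤ i<k) k<n
    ... | false = H≢0 i k i<k (<⇒≤ k<n)

    H≢0 : ∀ i k → i < k → k ≤ n → H i k ≢ 0
    H≢0 i (suc k) i<1+k k<n with pass i k in eq
    ... | true  = H≢0 i k (pass-staircase i k k<n eq) (<⇒≤ k<n)
    ... | false = V≢0 i k (s≤s⁻¹ i<1+k) k<n

  mutual
    V≡0 : ∀ i k → k < i → k < n → V i k ≡ 0
    V≡0 (suc i) k k<1+i k<n with pass i k in eq
    ... | true  = contradiction (pass-staircase i k k<n eq) (<⇒≱ k<1+i)
    ... | false = H≡0 i k (s≤s⁻¹ k<1+i) (<⇒≤ k<n)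

    H≡0 : ∀ i k → k ≤ i → k ≤ n → H i k ≡ 0
    H≡0 i zero    _   _ = refl
    H≡0 i (suc k) k<i k<n with pass i k in eq
    ... | true  = contradiction (pass-staircase i k k<n eq) (<⇒≱ (m≤n⇒m≤1+n k<i))
    ... | false = V≡0 i k k<i k<n

  dir : Port → PDDir
  dir inV = fromN
  dir inH = fromE

  κ : ℕ × ℕ → ℕ × ℕ
  κ (i , k) = suc i , n ∸ k

  κ-injective : ∀ {i k i′ k′} → i < n → k < n → i′ < n → k′ < n → κ (i , k) ≡ κ (i′ , k′) → (i ≡ i′) × (k ≡ k′)
  κ-injective _ k<n _ k′<n e = suc-injective (cong proj₁ e) , ∸-cancelˡ-≡ (<⇒≤ k<n) (<⇒≤ k′<n) (cong proj₂ e)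

  -- Each step moves one unit from `f` to `i + k`, which stays below `n + n` inside the grid; the
  -- fuel cannot run out.
  tracePath : ∀ f d i k → i < n → k < n → n + n ≤ f + (i + k) → ∃₂ λ ts e → Path d i k ts e ×
    (pdTrace f n (pdCross T) (dir d) (suc i) (n ∸ k) ≡ (List.map κ ts , Maybe.map suc e))
  tracePath zero d i k i<n k<n fuel = contradiction fuel (<⇒≱ (+-mono-< i<n k<n))
  tracePath (suc f) d i k i<n k<n fuel = step d (pass i k) refl refl
    where
    1<n∸k⇒1+k<n : 1 < n ∸ k → suc k < n
    1<n∸k⇒1+k<n l = ≤-trans (+-monoˡ-≤ k l) (≤-reflexive (m∸n+n≡m (<⇒≤ k<n)))
    Goal : Tiles × Maybe ℕ → Set
    Goal t = ∃₂ λ ts e → Path d i k ts e × (t ≡ (List.map κ ts , Maybe.map suc e))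
    goWest : down d (pass i k) ≡ false → Goal
      (if n ∸ k ≤ᵇ 1 then ((suc i , n ∸ k) ∷ [] , just (suc i))
       else ((suc i , n ∸ k) ∷ proj₁ (pdTrace f n (pdCross T) fromE (suc i) (n ∸ k ∸ 1)) ,
             proj₂ (pdTrace f n (pdCross T) fromE (suc i) (n ∸ k ∸ 1))))
    goWest eq with n ∸ k ≤ᵇ 1 in t
    ... | true  = _ , _ , exit eq (≤-antisym k<n (≤-trans (m≤n+m∸n n k)
                    (≤-trans (+-monoʳ-≤ k (≤ᵇ-sound (n ∸ k) 1 t)) (≤-reflexive (+-comm k 1))))) , refl
    ... | false with 1+k<n ← 1<n∸k⇒1+k<n (≤ᵇ-false {n ∸ k} {1} t)
                with ts , e , p , q ← tracePath f inH i (suc k) i<n 1+k<n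
                       (≤-trans fuel (≤-reflexive (trans (sym (+-suc f (i + k))) (cong (f +_) (sym (+-suc i k))))))
      = _ , _ , side eq 1+k<n p , cong (λ z → (suc i , n ∸ k) ∷ proj₁ z , proj₂ z)
          (trans (cong (pdTrace f n (pdCross T) fromE (suc i))
            (trans (∸-+-assoc n k 1) (cong (n ∸_) (+-comm k 1)))) q)
    goSouth : down d (pass i k) ≡ true → Goal
      (if n ≤ᵇ suc i then ((suc i , n ∸ k) ∷ [] , nothing)
       else ((suc i , n ∸ k) ∷ proj₁ (pdTrace f n (pdCross T) fromN (suc (suc i)) (n ∸ k)) ,
             proj₂ (pdTrace f n (pdCross T) fromN (suc (suc i)) (n ∸ k))))
    goSouth eq with n ≤ᵇ suc i in t
    ... | true  = _ , _ , bottom eq (≤-antisym i<n (≤ᵇ-sound n (suc i) t)) , refl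
    ... | false with ts , e , p , q ← tracePath f inV (suc i) k (≤ᵇ-false {n} {suc i} t) k<n
                       (≤-trans fuel (≤-reflexive (sym (+-suc f (i + k)))))
      = _ , _ , south eq (≤ᵇ-false {n} {suc i} t) p , cong (λ z → (suc i , n ∸ k) ∷ proj₁ z , proj₂ z) q
    step : ∀ d′ b → d ≡ d′ → pass i k ≡ b → Goal (pdTrace (suc f) n (pdCross T) (dir d) (suc i) (n ∸ k))
    step inV true  refl eq with goSouth eq
    ... | g rewrite eq = g
    step inV false refl eq with goWest eq
    ... | g rewrite eq = g
    step inH true  refl eq with goWest (cong not eq)
    ... | g rewrite eq = g
    step inH false refl eq with goSouth (cong not eq)
    ... | g rewrite eq = g

  idx : Fin n → ℕ
  idx p = n ∸ suc (toℕ p)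

  idx<n : ∀ p → idx p < n
  idx<n p = ∸-monoʳ-< (s≤s z≤n) (Finₚ.toℕ<n p)

  n∸idx : ∀ p → n ∸ idx p ≡ suc (toℕ p)
  n∸idx p = m∸[m∸n]≡n (Finₚ.toℕ<n p)

  idx-surjective : ∀ {k} → k < n → ∃ λ p → idx p ≡ k
  idx-surjective {k} k<n = fromℕ< (idx<n (fromℕ< k<n)) , trans (cong (λ z → n ∸ suc z) (Finₚ.toℕ-fromℕ< _))
    (trans (cong (λ z → n ∸ suc (n ∸ suc z)) (Finₚ.toℕ-fromℕ< k<n))
      (trans (cong (n ∸_) (sym (+-∸-assoc 1 k<n))) (m∸[m∸n]≡n (<⇒≤ k<n))))

  idx-injective : ∀ {p q} → idx p ≡ idx q → p ≡ q
  idx-injective {p} {q} e = Finₚ.toℕ-injective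
    (suc-injective (trans (sym (n∸idx p)) (trans (cong (n ∸_) e) (n∸idx q))))

  pipePath : ∀ p → ∃₂ λ ts e → Path inV 0 (idx p) ts e × (pdPipe T p ≡ (List.map κ ts , Maybe.map suc e))
  pipePath p with ts , e , π , q ← tracePath (2 * n + 2) inV 0 (idx p) (≤-trans (s≤s z≤n) (Finₚ.toℕ<n p)) (idx<n p)
                   (≤-trans (≤-reflexive (cong (n +_) (sym (+-identityʳ n)))) (≤-trans (m≤m+n (2 * n) 2)
                     (m≤m+n (2 * n + 2) (idx p))))
    = ts , e , π , trans (cong (pdTrace (2 * n + 2) n (pdCross T) fromN 1) (sym (n∸idx p))) q

  tilePath : ∀ p → ∃₂ λ ts e → Path inV 0 (idx p) ts e × (proj₁ (pdPipe T p) ≡ List.map κ ts)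
  tilePath p with ts , e , π , q ← pipePath p = ts , e , π , cong proj₁ q

  grid : Vec (Vec Bool n) n
  grid = tabulate λ i → tabulate λ k → pass (toℕ i) (toℕ k)

  grid-lookup : ∀ i k → lookup (lookup grid i) k ≡ pass (toℕ i) (toℕ k)
  grid-lookup i k = trans (cong (λ r → lookup r k) (Vecₚ.lookup∘tabulate (λ i → tabulate λ k → pass (toℕ i)
    (toℕ k)) i))
    (Vecₚ.lookup∘tabulate (λ k → pass (toℕ i) (toℕ k)) k)

  labelsTop : Vec ℕ n
  labelsTop = tabulate λ k → n ∸ toℕ k

  open Link classicTiles

  labelling : Labelling pass V H grid labelsTop
  labelling = record
    { passes = λ i k → sym (grid-lookup i k)
    ; top    = λ k → sym (Vecₚ.lookup∘tabulate (λ k → n ∸ toℕ k) k)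
    ; left   = λ _ → refl
    ; H-next = λ _ _ → refl
    ; V-next = λ _ _ → refl
    }

  module _ (π : Permutation′ n) where

    exitLabels : Vec ℕ n
    exitLabels = tabulate λ i → toℕ (π ⟨$⟩ʳ i)

    reduced⇒valid : PDReducedWith T π → Rows.valid classicTiles exitLabels grid labelsTop ≡ true
    reduced⇒valid (ndc , ex) = valid⁺ exitLabels grid labelsTop labelling record
      { legal-all = λ i k → legal i k
      ; exits = exits′
      ; emptied = λ k → V≡0 n (toℕ k) (Finₚ.toℕ<n k) (Finₚ.toℕ<n k)
      }
      where
      red : Reduced
      red = noDoubleCrossing⇒reduced (pdCross T) (λ p → proj₁ (pdPipe T p)) κ κ-injective idx idx<n
        idx-surjective idx-injective
        tilePath (λ _ _ e → e) (λ X → proj₁ (proj₂ (proj₂ X))) ndc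
      legal : ∀ i k → TileSet.legal classicTiles (lookup (lookup grid i) k) (V (toℕ i) (toℕ k))
        (H (toℕ i) (toℕ k)) ≡ true
      legal i k rewrite grid-lookup i k with pass (toℕ i) (toℕ k) in eq
      ... | false = refl
      ... | true with i<k ← pass-staircase (toℕ i) (toℕ k) (Finₚ.toℕ<n k) eq
        = <ᵇ-complete (red (Finₚ.toℕ<n i , Finₚ.toℕ<n k , eq ,
            H≢0 (toℕ i) (toℕ k) i<k (<⇒≤ (Finₚ.toℕ<n k)) , V≢0 (toℕ i) (toℕ k) (<⇒≤ i<k) (Finₚ.toℕ<n k)))
      exits′ : ∀ i → H (toℕ i) n ≡ suc (lookup exitLabels i)
      exits′ i with ts , e , p , q ← pipePath (π ⟨$⟩ʳ i) | ex (π ⟨$⟩ʳ i)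
      ... | eq with e | trans (sym (cong proj₂ q)) eq
      ...   | just r | eq′ rewrite Vecₚ.lookup∘tabulate (λ i → toℕ (π ⟨$⟩ʳ i)) i | inverseˡ π {i} =
        trans (cong (λ z → H z n) (sym (suc-injective (Maybeₚ.just-injective eq′))))
          (trans (path-exit p) (n∸idx (π ⟨$⟩ʳ i)))

    valid⇒Valid : Rows.valid classicTiles exitLabels grid labelsTop ≡ true → Valid exitLabels grid V H
    valid⇒Valid = valid⁻ exitLabels grid labelsTop labelling

    Valid⇒Reduced : Valid exitLabels grid V H → Reduced
    Valid⇒Reduced ok {i} {k} (i<n , k<n , px , _ , _)
      with l ← ok .legal-all (fromℕ< i<n) (fromℕ< k<n)
      rewrite grid-lookup (fromℕ< i<n) (fromℕ< k<n) | Finₚ.toℕ-fromℕ< i<n | Finₚ.toℕ-fromℕ< k<n | px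
      = <ᵇ-sound (V i k) (H i k) l

    valid⇒reduced : Rows.valid classicTiles exitLabels grid labelsTop ≡ true → PDReducedWith T π
    valid⇒reduced v = reduced⇒noDoubleCrossing (pdCross T) (λ p → proj₁ (pdPipe T p)) κ κ-injective idx idx<n
      idx-surjective idx-injective
        tilePath (λ _ _ e → e) (λ X → proj₁ (proj₂ (proj₂ X))) (Valid⇒Reduced ok) , exits′
      where
      ok : Valid exitLabels grid V H
      ok = valid⇒Valid v
      empty′ : ∀ k → k < n → V n k ≡ 0
      empty′ k k<n = trans (cong (V n) (sym (Finₚ.toℕ-fromℕ< k<n))) (ok .emptied (fromℕ< k<n))
      exits′ : ∀ j → proj₂ (pdPipe T j) ≡ just (suc (toℕ (π ⟨$⟩ˡ j)))
      exits′ j with ts , e , p , q ← pipePath j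
               -- The edges below the last row are empty, so a pipe cannot end at the bottom.
               with r , refl ← path-exits empty′ p (idx<n j) (n∸k≢0 (idx<n j))
               with r<n ← path-exit-row p (≤-trans (s≤s z≤n) (Finₚ.toℕ<n j))
        = trans (cong proj₂ q) (cong (λ z → just (suc z)) row)
        where
        i = fromℕ< r<n
        label : suc (toℕ j) ≡ suc (toℕ (π ⟨$⟩ʳ i))
        label = trans (sym (n∸idx j)) (trans (sym (path-exit p))
          (trans (cong (λ z → H z n) (sym (Finₚ.toℕ-fromℕ< r<n)))
          (trans (ok .exits i) (cong suc (Vecₚ.lookup∘tabulate (λ i → toℕ (π ⟨$⟩ʳ i)) i)))))
        row : r ≡ toℕ (π ⟨$⟩ˡ j)
        row = trans (sym (Finₚ.toℕ-fromℕ< r<n))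
          (cong toℕ (trans (sym (inverseˡ π)) (cong (π ⟨$⟩ˡ_) (sym (Finₚ.toℕ-injective (suc-injective label))))))

-- Bumpless pipe dreams

∸-flip : ∀ {n r} → r < n → n ∸ suc (n ∸ suc r) ≡ r
∸-flip {n} {r} r<n = trans (cong (n ∸_) (sym (+-∸-assoc 1 r<n))) (m∸[m∸n]≡n (<⇒≤ r<n))

∸-flip< : ∀ {n r} → r < n → n ∸ suc r < n
∸-flip< r<n = ∸-monoʳ-< (s≤s z≤n) r<n

occupied : ℕ → Bool
occupied zero    = false
occupied (suc _) = true

occupied-≢0 : ∀ {m} → m ≢ 0 → occupied m ≡ true
occupied-≢0 {zero}  ne = contradiction refl ne
occupied-≢0 {suc m} ne = refl

passes : Tile → Bool
passes = TileSet.pass bumplessTiles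

module Bumpless {n : ℕ} (D : TileMat n) where

  -- Rows are counted from the bottom and columns from the left, starting with 0.
  tile : ℕ → ℕ → Tile
  tile i k = tAt D (n ∸ suc i) k

  pass : ℕ → ℕ → Bool
  pass i k = passes (tile i k)

  open Pipes n pass suc _<_ <-asym ≢⇒<⊎> (λ p<q _ → s≤s p<q) (λ _ ()) public

  dir : Port → BDir
  dir inV = fromS
  dir inH = fromW

  hasPort : Port → Tile → Bool
  hasPort inV = hasS
  hasPort inH = hasW

  κ : ℕ × ℕ → ℕ × ℕ
  κ (i , k) = n ∸ suc i , k

  κ-injective : ∀ {i k i′ k′} → i < n → k < n → i′ < n → k′ < n → κ (i , k) ≡ κ (i′ , k′) → (i ≡ i′) × (k ≡ k′)
  κ-injective i<n _ i′<n _ e = suc-injective (∸-cancelˡ-≡ i<n i′<n (cong proj₁ e)) , cong proj₂ e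

  out-V : ∀ i k → occupied (V i k) ≡ hasS (tile i k) → occupied (H i k) ≡ hasW (tile i k) →
    occupied (V (suc i) k) ≡ hasN (tile i k)
  out-V i k ev eh with tile i k
  ... | cross = ev
  ... | hor   = ev
  ... | ver   = ev
  ... | rT    = eh
  ... | jT    = eh
  ... | blank = ev

  out-H : ∀ i k → occupied (V i k) ≡ hasS (tile i k) → occupied (H i k) ≡ hasW (tile i k) →
    occupied (H i (suc k)) ≡ hasE (tile i k)
  out-H i k ev eh with tile i k
  ... | cross = eh
  ... | hor   = eh
  ... | ver   = eh
  ... | rT    = ev
  ... | jT    = ev
  ... | blank = eh

  move-agrees : ∀ d t → hasPort d t ≡ true → bMove t (dir d) ≡ (if down d (passes t) then up else right)
  move-agrees inV cross _ = refl
  move-agrees inV ver   _ = refl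
  move-agrees inV rT    _ = refl
  move-agrees inH cross _ = refl
  move-agrees inH hor   _ = refl
  move-agrees inH jT    _ = refl

  isX : ℕ → ℕ → Bool
  isX r c = isCrossTile (tAt D r c)

  X⇒pass : ∀ {i k} → i < n → k < n → isX (n ∸ suc i) k ≡ true → pass i k ≡ true
  X⇒pass {i} {k} _ _ e with tile i k
  ... | cross = refl

  -- Labels are nonzero exactly on the edges that the tiles draw. This follows from `IsBPD` by
  -- propagation along the edges, and from `legal` tile by tile, so both directions of the
  -- translation can share what depends on it.
  Occupied : Set
  Occupied = ∀ i k → i < n → k < n → (occupied (V i k) ≡ hasS (tile i k)) × (occupied (H i k) ≡ hasW (tile i k))

  module WithOccupied (occ : Occupied) where

    hasPort-port : ∀ d i k → i < n → k < n → port d i k ≢ 0 → hasPort d (tile i k) ≡ true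
    hasPort-port inV i k i<n k<n ne = trans (sym (proj₁ (occ i k i<n k<n))) (occupied-≢0 ne)
    hasPort-port inH i k i<n k<n ne = trans (sym (proj₂ (occ i k i<n k<n))) (occupied-≢0 ne)

    crossing⇒X : ∀ {i k} → Crossing i k → isX (n ∸ suc i) k ≡ true
    crossing⇒X {i} {k} (i<n , k<n , px , h≢0 , v≢0)
      with tile i k | hasPort-port inV i k i<n k<n v≢0 | hasPort-port inH i k i<n k<n h≢0 | px
    ... | cross | _ | _ | _ = refl

    tracePath : ∀ f d i k → i < n → k < n → n + n ≤ f + (i + k) → port d i k ≢ 0 → ∃₂ λ ts e → Path d i k ts e ×
      (bpdTrace f n D (dir d) (n ∸ suc i) k ≡ (List.map κ ts , Maybe.map (λ i → n ∸ suc i) e))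
    tracePath zero d i k i<n k<n fuel ne = contradiction fuel (<⇒≱ (+-mono-< i<n k<n))
    tracePath (suc f) d i k i<n k<n fuel ne = by (down d (pass i k)) refl
      where
      r : ℕ
      r = n ∸ suc i
      Goal : Tiles × Maybe ℕ → Set
      Goal t = ∃₂ λ ts e → Path d i k ts e × (t ≡ (List.map κ ts , Maybe.map (λ i → n ∸ suc i) e))
      goRight : down d (pass i k) ≡ false → Goal
        (if n ≤ᵇ suc k then ((r , k) ∷ [] , just r)
         else ((r , k) ∷ proj₁ (bpdTrace f n D fromW r (suc k)) , proj₂ (bpdTrace f n D fromW r (suc k))))
      goRight eq with n ≤ᵇ suc k in t
      ... | true  = _ , _ , exit eq (≤-antisym k<n (≤ᵇ-sound n (suc k) t)) , refl
      ... | false with ts , e , p , q ← tracePath f inH i (suc k) i<n (≤ᵇ-false {n} {suc k} t)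
                         (≤-trans fuel (≤-reflexive (trans (sym (+-suc f (i + k))) (cong (f +_) (sym (+-suc i k))))))
                         (λ z → ne (trans (sym (port-side d i k eq)) z))
        = _ , _ , side eq (≤ᵇ-false {n} {suc k} t) p , cong (λ z → (r , k) ∷ proj₁ z , proj₂ z) q
      goUp : down d (pass i k) ≡ true → Goal
        (if r ≡ᵇ 0 then ((r , k) ∷ [] , nothing)
         else ((r , k) ∷ proj₁ (bpdTrace f n D fromS (r ∸ 1) k) , proj₂ (bpdTrace f n D fromS (r ∸ 1) k)))
      goUp eq with r ≡ᵇ 0 in t
      ... | true  = _ , _ , bottom eq (≤-antisym i<n (m∸n≡0⇒m≤n (≡ᵇ-sound r 0 t))) , refl
      ... | false with 1+i<n ← ≤∧≢⇒< i<n
        (λ z → contradiction (trans (sym t) (cong (_≡ᵇ 0) (trans (cong (n ∸_) z) (n∸n≡0 n)))) λ ())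
                  with ts , e , p , q ← tracePath f inV (suc i) k 1+i<n k<n
                    (≤-trans fuel (≤-reflexive (sym (+-suc f (i + k)))))
                         (λ z → ne (trans (sym (port-down d i k eq)) z))
        = _ , _ , south eq 1+i<n p , cong (λ z → (r , k) ∷ proj₁ z , proj₂ z)
            (trans (cong (λ z → bpdTrace f n D fromS z k) (trans (∸-+-assoc n (suc i) 1)
              (cong (n ∸_) (+-comm (suc i) 1)))) q)
      by : ∀ b → down d (pass i k) ≡ b → Goal (bpdTrace (suc f) n D (dir d) r k)
      by b eq with bMove (tile i k) (dir d) | trans (move-agrees d (tile i k) (hasPort-port d i k i<n k<n ne))
        (cong (if_then up else right) eq)
      by true  eq | up    | refl = goUp eq
      by false eq | right | refl = goRight eq

    pipePath : ∀ p → ∃₂ λ ts e → Path inV 0 (toℕ p) ts e ×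
      (bpdPipe D p ≡ (List.map κ ts , Maybe.map (λ i → n ∸ suc i) e))
    pipePath p = tracePath (2 * n + 2) inV 0 (toℕ p) (≤-trans (s≤s z≤n) (Finₚ.toℕ<n p)) (Finₚ.toℕ<n p)
      (≤-trans (≤-reflexive (cong (n +_) (sym (+-identityʳ n)))) (≤-trans (m≤m+n (2 * n) 2)
        (m≤m+n (2 * n + 2) (toℕ p)))) λ ()

    tilePath : ∀ p → ∃₂ λ ts e → Path inV 0 (toℕ p) ts e × (proj₁ (bpdPipe D p) ≡ List.map κ ts)
    tilePath p with ts , e , π , q ← pipePath p = ts , e , π , cong proj₁ q

    idx-surjective : ∀ {k} → k < n → ∃ λ (p : Fin n) → toℕ p ≡ k
    idx-surjective k<n = fromℕ< k<n , Finₚ.toℕ-fromℕ< k<n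

    noDoubleCrossing⁻ : NoDoubleCrossing n isX (λ p → proj₁ (bpdPipe D p)) → Reduced
    noDoubleCrossing⁻ = noDoubleCrossing⇒reduced isX (λ p → proj₁ (bpdPipe D p)) κ κ-injective toℕ Finₚ.toℕ<n
      idx-surjective
      Finₚ.toℕ-injective tilePath X⇒pass crossing⇒X

    noDoubleCrossing⁺ : Reduced → NoDoubleCrossing n isX (λ p → proj₁ (bpdPipe D p))
    noDoubleCrossing⁺ = reduced⇒noDoubleCrossing isX (λ p → proj₁ (bpdPipe D p)) κ κ-injective toℕ Finₚ.toℕ<n
      idx-surjective
      Finₚ.toℕ-injective tilePath X⇒pass crossing⇒X

  occupied-bpd : IsBPD n D → Occupied
  occupied-bpd (row , col , top , bot , left , _) i k i<n k<n = occ-V i k i<n k<n , occ-H i k i<n k<n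
    where
    occ-V : ∀ i k → i < n → k < n → occupied (V i k) ≡ hasS (tile i k)
    occ-H : ∀ i k → i < n → k < n → occupied (H i k) ≡ hasW (tile i k)
    occ-V zero k i<n k<n = sym (bot k k<n)
    occ-V (suc i) k i<n k<n = trans (out-V i k (occ-V i k (<⇒≤ i<n) k<n) (occ-H i k (<⇒≤ i<n) k<n))
      (sym (trans (col (n ∸ suc (suc i)) k (subst (_< n) (sym r) (∸-flip< (<⇒≤ i<n))) k<n)
        (cong (λ z → hasN (tAt D z k)) r)))
      where
      r : suc (n ∸ suc (suc i)) ≡ n ∸ suc i
      r = sym (+-∸-assoc 1 i<n)
    occ-H i zero i<n k<n = sym (left (n ∸ suc i) (∸-flip< i<n))
    occ-H i (suc k) i<n k<n = trans (out-H i k (occ-V i k i<n (<⇒≤ k<n)) (occ-H i k i<n (<⇒≤ k<n)))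
      (row (n ∸ suc i) k (∸-flip< i<n) k<n)

  grid : Vec (Vec Tile n) n
  grid = tabulate λ i → tabulate λ k → tile (toℕ i) (toℕ k)

  grid-lookup : ∀ i k → lookup (lookup grid i) k ≡ tile (toℕ i) (toℕ k)
  grid-lookup i k = trans (cong (λ r → lookup r k) (Vecₚ.lookup∘tabulate (λ i → tabulate λ k → tile (toℕ i)
    (toℕ k)) i))
    (Vecₚ.lookup∘tabulate (λ k → tile (toℕ i) (toℕ k)) k)

  labelsTop : Vec ℕ n
  labelsTop = tabulate λ k → suc (toℕ k)

  open Link bumplessTiles

  labelling : Labelling pass V H grid labelsTop
  labelling = record
    { passes = λ i k → cong passes (sym (grid-lookup i k))
    ; top    = λ k → sym (Vecₚ.lookup∘tabulate (λ k → suc (toℕ k)) k)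
    ; left   = λ _ → refl
    ; H-next = λ _ _ → refl
    ; V-next = λ _ _ → refl
    }

  legal : Tile → ℕ → ℕ → Bool
  legal = TileSet.legal bumplessTiles

  legal⁺ : ∀ t v h → occupied v ≡ hasS t → occupied h ≡ hasW t → (t ≡ cross → h < v) → legal t v h ≡ true
  legal⁺ cross (suc v) (suc h) _ _ l = <ᵇ-complete (s≤s⁻¹ (l refl))
  legal⁺ hor   zero    (suc h) _ _ _ = refl
  legal⁺ ver   (suc v) zero    _ _ _ = refl
  legal⁺ rT    (suc v) zero    _ _ _ = refl
  legal⁺ jT    zero    (suc h) _ _ _ = refl
  legal⁺ blank zero    zero    _ _ _ = refl

  legal⁻ : ∀ t v h → legal t v h ≡ true → (occupied v ≡ hasS t) × (occupied h ≡ hasW t) ×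
    (passes t ≡ true → h ≢ 0 → v ≢ 0 → h < v)
  legal⁻ cross (suc v) (suc h) l = refl , refl , λ _ _ _ → s≤s (<ᵇ-sound h v l)
  legal⁻ hor   zero    (suc h) l = refl , refl , λ _ _ z → contradiction refl z
  legal⁻ ver   (suc v) zero    l = refl , refl , λ _ z _ → contradiction refl z
  legal⁻ rT    (suc v) zero    l = refl , refl , λ _ z _ → contradiction refl z
  legal⁻ jT    zero    (suc h) l = refl , refl , λ _ _ z → contradiction refl z
  legal⁻ blank zero    zero    l = refl , refl , λ _ z _ → contradiction refl z

  occupied-0 : ∀ {m} → occupied m ≡ false → m ≡ 0
  occupied-0 {zero} _ = refl

  V-top : 0 < n → Occupied → ∀ k → k < n → occupied (V n k) ≡ hasN (tAt D 0 k)
  V-top 0<n occ k k<n = go n refl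
    where
    go : ∀ m → m ≡ n → occupied (V m k) ≡ hasN (tAt D 0 k)
    go zero    refl = contradiction 0<n λ ()
    go (suc m) refl = trans (out-V m k (proj₁ (occ m k ≤-refl k<n)) (proj₂ (occ m k ≤-refl k<n)))
      (cong (λ z → hasN (tAt D z k)) (n∸n≡0 m))

  module _ (π : Permutation′ n) where

    exitLabels : Vec ℕ n
    exitLabels = tabulate λ i → toℕ (π ⟨$⟩ʳ opposite i)

    opposite-∸ : ∀ (i : Fin n) → n ∸ suc (toℕ i) ≡ toℕ (opposite i)
    opposite-∸ i = sym (Finₚ.opposite-prop i)

    reduced⇒valid : IsBPD n D → BPDReducedWith D π → Rows.valid bumplessTiles exitLabels grid labelsTop ≡ true
    reduced⇒valid bpd@(_ , _ , top , _) (ndc , ex) = valid⁺ exitLabels grid labelsTop labelling record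
      { legal-all = λ i k → trans (cong (λ t → legal t (V (toℕ i) (toℕ k)) (H (toℕ i) (toℕ k)))
        (grid-lookup i k)) (ok i k)
      ; exits = exits′
      ; emptied = λ k → occupied-0 (trans (V-top (≤-trans (s≤s z≤n) (Finₚ.toℕ<n k)) occ (toℕ k) (Finₚ.toℕ<n k))
        (top (toℕ k) (Finₚ.toℕ<n k)))
      }
      where
      occ : Occupied
      occ = occupied-bpd bpd
      open WithOccupied occ
      ok : ∀ i k → legal (tile (toℕ i) (toℕ k)) (V (toℕ i) (toℕ k)) (H (toℕ i) (toℕ k)) ≡ true
      ok i k with oV , oH ← occ (toℕ i) (toℕ k) (Finₚ.toℕ<n i) (Finₚ.toℕ<n k) = legal⁺
        (tile (toℕ i) (toℕ k)) _ _ oV oH λ t≡cross →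
        noDoubleCrossing⁻ ndc (Finₚ.toℕ<n i , Finₚ.toℕ<n k , cong passes t≡cross ,
          (λ z → contradiction (trans (sym (cong occupied z)) (trans oH (cong hasW t≡cross))) λ ()) ,
          (λ z → contradiction (trans (sym (cong occupied z)) (trans oV (cong hasS t≡cross))) λ ()))
      exits′ : ∀ i → H (toℕ i) n ≡ suc (lookup exitLabels i)
      exits′ i with ts , e , p , q ← pipePath (π ⟨$⟩ʳ opposite i) | ex (π ⟨$⟩ʳ opposite i)
      ... | eq with e | trans (sym (cong proj₂ q)) eq
      ...   | just r | eq′ = trans (cong (λ z → H z n) (sym r≡i))
                (trans (path-exit p) (cong suc (sym (Vecₚ.lookup∘tabulate (λ i → toℕ (π ⟨$⟩ʳ opposite i)) i))))
        where
        r≡i : r ≡ toℕ i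
        r≡i = suc-injective (∸-cancelˡ-≡ (path-exit-row p (≤-trans (s≤s z≤n) (Finₚ.toℕ<n i))) (Finₚ.toℕ<n i)
          (trans (Maybeₚ.just-injective eq′) (trans (cong toℕ (inverseˡ π)) (sym (opposite-∸ i)))))

    module FromValid (v : Rows.valid bumplessTiles exitLabels grid labelsTop ≡ true) where
      ok : Valid exitLabels grid V H
      ok = valid⁻ exitLabels grid labelsTop labelling v

      legal-tile : ∀ i k → i < n → k < n → legal (tile i k) (V i k) (H i k) ≡ true
      legal-tile i k i<n k<n with l ← ok .legal-all (fromℕ< i<n) (fromℕ< k<n)
        rewrite grid-lookup (fromℕ< i<n) (fromℕ< k<n) | Finₚ.toℕ-fromℕ< i<n | Finₚ.toℕ-fromℕ< k<n = l

      occ : Occupied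
      occ i k i<n k<n with oV , oH , _ ← legal⁻ (tile i k) (V i k) (H i k) (legal-tile i k i<n k<n) = oV , oH
      open WithOccupied occ

      reduced : Reduced
      reduced {i} {k} (i<n , k<n , px , h≢0 , v≢0) = proj₂
        (proj₂ (legal⁻ (tile i k) (V i k) (H i k) (legal-tile i k i<n k<n))) px h≢0 v≢0

      emptied′ : ∀ k → k < n → V n k ≡ 0
      emptied′ k k<n = trans (cong (V n) (sym (Finₚ.toℕ-fromℕ< k<n))) (ok .emptied (fromℕ< k<n))

      exit-label : ∀ {i} (i<n : i < n) → H i n ≡ suc (toℕ (π ⟨$⟩ʳ opposite (fromℕ< i<n)))
      exit-label i<n = trans (cong (λ z → H z n) (sym (Finₚ.toℕ-fromℕ< i<n)))
        (trans (ok .exits (fromℕ< i<n)) (cong suc (Vecₚ.lookup∘tabulate (λ i → toℕ (π ⟨$⟩ʳ opposite i))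
          (fromℕ< i<n))))

      -- Neighbouring tiles agree because both are compared with the one label of their common edge.
      -- The north border is empty because all pipes have left, and the east border is full because
      -- exit labels are successors.
      isBPD : IsBPD n D
      isBPD = row , col , top , bot , left , right′
        where
        at-row : ∀ {r} → r < n → ∀ k → tile (n ∸ suc r) k ≡ tAt D r k
        at-row r<n k = cong (λ z → tAt D z k) (∸-flip r<n)
        row : ∀ i j → i < n → suc j < n → hasE (tAt D i j) ≡ hasW (tAt D i (suc j))
        row r j r<n j<n = subst₂ _≡_ (cong hasE (at-row r<n j)) (cong hasW (at-row r<n (suc j)))
          (trans (sym (out-H i j (proj₁ o) (proj₂ o))) (proj₂ (occ i (suc j) (∸-flip< r<n) j<n)))
          where
          i = n ∸ suc r
          o = occ i j (∸-flip< r<n) (<⇒≤ j<n)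
        col : ∀ i j → suc i < n → j < n → hasS (tAt D i j) ≡ hasN (tAt D (suc i) j)
        col r j r<n j<n = subst₂ _≡_ (cong hasS (trans (cong (λ z → tile z j) i≡) (at-row (<⇒≤ r<n) j)))
          (cong hasN (at-row r<n j))
          (trans (sym (proj₁ (occ (suc i) j (subst (_< n) (sym i≡) (∸-flip< (<⇒≤ r<n))) j<n)))
            (out-V i j (proj₁ o) (proj₂ o)))
          where
          i = n ∸ suc (suc r)
          i≡ : suc i ≡ n ∸ suc r
          i≡ = sym (+-∸-assoc 1 r<n)
          o = occ i j (∸-flip< r<n) j<n
        top : ∀ j → j < n → hasN (tAt D 0 j) ≡ false
        top j j<n = trans (sym (V-top (≤-trans (s≤s z≤n) j<n) occ j j<n)) (cong occupied (emptied′ j j<n))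
        bot : ∀ j → j < n → hasS (tAt D (n ∸ 1) j) ≡ true
        bot j j<n = sym (proj₁ (occ 0 j (≤-trans (s≤s z≤n) j<n) j<n))
        left : ∀ i → i < n → hasW (tAt D i 0) ≡ false
        left r r<n = trans (cong hasW (sym (at-row r<n 0)))
          (sym (proj₂ (occ (n ∸ suc r) 0 (∸-flip< r<n) (≤-trans (s≤s z≤n) r<n))))
        right′ : ∀ i → i < n → hasE (tAt D i (n ∸ 1)) ≡ true
        right′ r r<n = trans (cong hasE (sym (at-row r<n (n ∸ 1)))) (trans (sym (out-H i (n ∸ 1) (proj₁ o) (proj₂ o)))
          (cong occupied (trans (cong (H i) (m+[n∸m]≡n (≤-trans (s≤s z≤n) r<n))) (exit-label (∸-flip< r<n)))))
          where
          i = n ∸ suc r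
          o = occ i (n ∸ 1) (∸-flip< r<n) (∸-monoʳ-< (s≤s z≤n) (≤-trans (s≤s z≤n) r<n))

      bpdReduced : BPDReducedWith D π
      bpdReduced = noDoubleCrossing⁺ reduced , exits′
        where
        exits′ : ∀ j → proj₂ (bpdPipe D j) ≡ just (toℕ (π ⟨$⟩ˡ j))
        exits′ j with ts , e , p , q ← pipePath j
                 with r , refl ← path-exits emptied′ p (Finₚ.toℕ<n j) (λ ())
                 with r<n ← path-exit-row p (≤-trans (s≤s z≤n) (Finₚ.toℕ<n j))
          = trans (cong proj₂ q) (cong just (trans (cong (λ z → n ∸ suc z) (sym (Finₚ.toℕ-fromℕ< r<n)))
              (trans (opposite-∸ (fromℕ< r<n)) (cong toℕ (trans (sym (inverseˡ π)) (cong (π ⟨$⟩ˡ_)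
                (sym (Finₚ.toℕ-injective (suc-injective (trans (sym (path-exit p)) (exit-label r<n)))))))))))

-- Alternating sign matrices

at-lookup : ∀ (d : A) (xs : Vec A n) i → at d xs (toℕ i) ≡ lookup xs i
at-lookup d (x ∷ xs) zero    = refl
at-lookup d (x ∷ xs) (suc i) = at-lookup d xs i

at-tabulate : ∀ (d : A) (f : ℕ → A) k → k < n → at d (tabulate {n = n} λ i → f (toℕ i)) k ≡ f k
at-tabulate {n = suc n} d f zero    _         = refl
at-tabulate {n = suc n} d f (suc k) (s≤s k<n) = at-tabulate d (f ∘ suc) k k<n

at-map : ∀ {E : Set} (f : A → E) d (xs : Vec A n) k → at (f d) (Vec.map f xs) k ≡ f (at d xs k)
at-map f d []       k       = refl
at-map f d (x ∷ xs) zero    = refl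
at-map f d (x ∷ xs) (suc k) = at-map f d xs k

lookup-ext : ∀ {xs ys : Vec A n} → (∀ i → lookup xs i ≡ lookup ys i) → xs ≡ ys
lookup-ext {xs = xs} {ys} e = trans (sym (Vecₚ.tabulate∘lookup xs)) (trans (Vecₚ.tabulate-cong e)
  (Vecₚ.tabulate∘lookup ys))

matrix-ext : ∀ {xs ys : Vec (Vec A m) n} → (∀ i j → lookup (lookup xs i) j ≡ lookup (lookup ys i) j) → xs ≡ ys
matrix-ext e = lookup-ext λ i → lookup-ext (e i)

∑<-suc : ∀ m (f : ℕ → ℕ) → ∑< (suc m) f ≡ f 0 + ∑< m (f ∘ suc)
∑<-suc m f = cong (λ z → f 0 + sum z) (trans (Listₚ.map-applyUpTo suc f m) (sym (Listₚ.map-upTo (f ∘ suc) m)))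

∑<-cong : ∀ m {f g : ℕ → ℕ} → (∀ k → k < m → f k ≡ g k) → ∑< m f ≡ ∑< m g
∑<-cong zero e = refl
∑<-cong (suc m) {f} {g} e = trans (∑<-suc m f) (trans
  (cong₂ _+_ (e 0 (s≤s z≤n)) (∑<-cong m λ k k<m → e (suc k) (s≤s k<m))) (sym (∑<-suc m g)))

∑<-0 : ∀ m {f : ℕ → ℕ} → (∀ k → k < m → f k ≡ 0) → ∑< m f ≡ 0
∑<-0 zero e = refl
∑<-0 (suc m) {f} e = trans (∑<-suc m f) (cong₂ _+_ (e 0 (s≤s z≤n)) (∑<-0 m λ k k<m → e (suc k) (s≤s k<m)))

∑<-+ : ∀ a b (f : ℕ → ℕ) → ∑< (a + b) f ≡ ∑< a f + ∑< b (λ t → f (a + t))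
∑<-+ zero    b f = refl
∑<-+ (suc a) b f = trans (∑<-suc (a + b) f) (trans (cong (f 0 +_) (∑<-+ a b (f ∘ suc)))
  (trans (sym (+-assoc (f 0) _ _)) (cong (_+ ∑< b (λ t → f (suc a + t))) (sym (∑<-suc a f)))))

∑<-snoc : ∀ m (f : ℕ → ℕ) → ∑< (suc m) f ≡ ∑< m f + f m
∑<-snoc m f = trans (cong (λ z → ∑< z f) (+-comm 1 m)) (trans (∑<-+ m 1 f)
  (cong (∑< m f +_) (trans (+-identityʳ (f (m + 0))) (cong f (+-identityʳ m)))))

∑<-reverse : ∀ m (f : ℕ → ℕ) → ∑< m f ≡ ∑< m (λ t → f (m ∸ suc t))
∑<-reverse zero    f = refl
∑<-reverse (suc m) f = trans (∑<-snoc m f) (trans (+-comm (∑< m f) (f m))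
  (trans (cong (f m +_) (∑<-reverse m f)) (sym (∑<-suc m (λ t → f (m ∸ t))))))

∑ℤ<-snoc : ∀ m (f : ℕ → ℤ) → ∑ℤ< (suc m) f ≡ ∑ℤ< m f ℤ.+ f m
∑ℤ<-snoc m f = trans (cong (foldr g 0ℤ) (sym (Listₚ.upTo-∷ʳ m)))
  (trans (Listₚ.foldr-++ g 0ℤ (upTo m) (m ∷ []))
  (trans (shift (upTo m) (f m ℤ.+ 0ℤ)) (cong (λ z → ∑ℤ< m f ℤ.+ z) (ℤₚ.+-identityʳ (f m)))))
  where
  g : ℕ → ℤ → ℤ
  g k s = f k ℤ.+ s
  shift : ∀ ks e → foldr g e ks ≡ foldr g 0ℤ ks ℤ.+ e
  shift []       e = sym (ℤₚ.+-identityˡ e)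
  shift (k ∷ ks) e = trans (cong (λ z → f k ℤ.+ z) (shift ks e)) (sym (ℤₚ.+-assoc (f k) (foldr g 0ℤ ks) e))

∑ℤ<-cong : ∀ m {f g : ℕ → ℤ} → (∀ k → k < m → f k ≡ g k) → ∑ℤ< m f ≡ ∑ℤ< m g
∑ℤ<-cong zero e = refl
∑ℤ<-cong (suc m) {f} {g} e = trans (∑ℤ<-snoc m f) (trans
  (cong₂ ℤ._+_ (∑ℤ<-cong m λ k k<m → e k (<-trans k<m ≤-refl)) (e m ≤-refl)) (sym (∑ℤ<-snoc m g)))

sign : Tile → ℤ
sign rT = 1ℤ
sign jT = -1ℤ
sign _  = 0ℤ

bit : Bool → ℤ
bit true  = 1ℤ
bit false = 0ℤ

bit-injective : ∀ {a b} → bit a ≡ bit b → a ≡ b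
bit-injective {true}  {true}  _ = refl
bit-injective {false} {false} _ = refl

-- Along a row or a column the partial sums of the signs record where a pipe runs.
module Line (inn out : Tile → Bool) (balance : ∀ t → bit (inn t) ℤ.+ sign t ≡ bit (out t))
            (t : ℕ → Tile) (n : ℕ) (start : 0 < n → inn (t 0) ≡ false)
            (next : ∀ k → suc k < n → out (t k) ≡ inn (t (suc k))) where

  prefix : ∀ k → k < n → ∑ℤ< (suc k) (λ k → sign (t k)) ≡ bit (out (t k))
  prefix zero 0<n = trans (ℤₚ.+-identityʳ (sign (t 0)))
    (trans (sym (ℤₚ.+-identityˡ (sign (t 0)))) (trans (cong (λ b → bit b ℤ.+ sign (t 0)) (sym (start 0<n)))
      (balance (t 0))))
  prefix (suc k) k<n = trans (∑ℤ<-snoc (suc k) (λ k → sign (t k)))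
    (trans (cong (λ z → z ℤ.+ sign (t (suc k))) (trans (prefix k (<⇒≤ k<n)) (cong bit (next k k<n))))
      (balance (t (suc k))))

  out≡inn : ∀ s → sign s ≡ 0ℤ → inn s ≡ out s
  out≡inn s e = bit-injective (trans (sym (ℤₚ.+-identityʳ (bit (inn s))))
    (trans (cong (λ z → bit (inn s) ℤ.+ z) (sym e)) (balance s)))

  reach : ∀ j j′ → j < j′ → j′ < n → (∀ k → j < k → k < j′ → sign (t k) ≡ 0ℤ) → out (t j) ≡ inn (t j′)
  reach j (suc j′) j<1+j′ j′<n zeros with m<1+n⇒m<n∨m≡n j<1+j′
  ... | inj₂ refl = next j j′<n
  ... | inj₁ j<j′ = trans (reach j j′ j<j′ (<⇒≤ j′<n) λ k j<k k<j′ → zeros k j<k (m≤n⇒m≤1+n k<j′))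
    (trans (out≡inn (t j′) (zeros j′ j<j′ ≤-refl)) (next j′ j′<n))

  turn : ∀ s → sign s ≢ 0ℤ → (sign s ≡ (if out s then 1ℤ else -1ℤ)) × (inn s ≡ not (out s))
  turn s ne with inn s | out s | balance s
  ... | true  | true  | e = contradiction (∙-cancelˡ 1ℤ (sign s) 0ℤ e) ne
  ... | true  | false | e = ∙-cancelˡ 1ℤ (sign s) -1ℤ e , refl
  ... | false | true  | e = trans (sym (ℤₚ.+-identityˡ (sign s))) e , refl
  ... | false | false | e = contradiction (trans (sym (ℤₚ.+-identityˡ (sign s))) e) ne

  -- The edges between two consecutive nonzero entries are all occupied, giving signs 1 and -1, or
  -- all empty, giving -1 and 1.
  alternate : ∀ j j′ → j < j′ → j′ < n → sign (t j) ≢ 0ℤ → sign (t j′) ≢ 0ℤ →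
    (∀ k → j < k → k < j′ → sign (t k) ≡ 0ℤ) → sign (t j) ≡ ℤ.- sign (t j′)
  alternate j j′ j<j′ j′<n ne ne′ zeros
    rewrite proj₁ (turn (t j) ne) | proj₁ (turn (t j′) ne′) | reach j j′ j<j′ j′<n zeros | proj₂ (turn (t j′) ne′)
    with out (t j′)
  ... | true  = refl
  ... | false = refl

row-balance : ∀ t → bit (hasW t) ℤ.+ sign t ≡ bit (hasE t)
row-balance cross = refl
row-balance hor   = refl
row-balance ver   = refl
row-balance rT    = refl
row-balance jT    = refl
row-balance blank = refl

column-balance : ∀ t → bit (hasN t) ℤ.+ sign t ≡ bit (hasS t)
column-balance cross = refl
column-balance hor   = refl
column-balance ver   = refl
column-balance rT    = refl
column-balance jT    = refl
column-balance blank = refl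

toASM : TileMat n → IntMat n
toASM = Vec.map (Vec.map sign)

aAt-toASM : ∀ (D : TileMat n) i j → aAt (toASM D) i j ≡ sign (tAt D i j)
aAt-toASM {n} D i j = trans (cong (λ r → at 0ℤ r j) (trans
    (cong (λ d → at d (toASM D) i) (sym (Vecₚ.map-replicate sign blank n)))
    (at-map (Vec.map sign) (replicate n blank) D i)))
  (at-map sign blank (at (replicate n blank) D i) j)

tAt-lookup : ∀ (D : TileMat n) i j → tAt D (toℕ i) (toℕ j) ≡ lookup (lookup D i) j
tAt-lookup {n} D i j = trans (cong (λ r → at blank r (toℕ j)) (at-lookup (replicate n blank) D i))
  (at-lookup blank (lookup D i) j)

toASM-lookup : ∀ (D : TileMat n) i j → toASM D ! i ! j ≡ sign (lookup (lookup D i) j)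
toASM-lookup D i j = trans (cong (λ r → lookup r j) (Vecₚ.lookup-map i (Vec.map sign) D))
  (Vecₚ.lookup-map j sign (lookup D i))

toASM-tAt : ∀ (D : TileMat n) i j → toASM D ! i ! j ≡ sign (tAt D (toℕ i) (toℕ j))
toASM-tAt D i j = trans (toASM-lookup D i j) (cong sign (sym (tAt-lookup D i j)))

toASM-BPDOf : ∀ (D : TileMat n) → BPDOf (toASM D) D
toASM-BPDOf D i j rewrite toASM-lookup D i j with lookup (lookup D i) j
... | cross = ((λ ()) , (λ ())) , ((λ ()) , (λ ()))
... | hor   = ((λ ()) , (λ ())) , ((λ ()) , (λ ()))
... | ver   = ((λ ()) , (λ ())) , ((λ ()) , (λ ()))
... | rT    = ((λ _ → refl) , (λ _ → refl)) , ((λ ()) , (λ ()))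
... | jT    = ((λ ()) , (λ ())) , ((λ _ → refl) , (λ _ → refl))
... | blank = ((λ ()) , (λ ())) , ((λ ()) , (λ ()))

toASM-unique : ∀ (A : IntMat n) D → IsASM n A → BPDOf A D → toASM D ≡ A
toASM-unique A D (entries , _) of = matrix-ext λ i j → trans (toASM-lookup D i j) (entry i j)
  where
  entry : ∀ i j → sign (lookup (lookup D i) j) ≡ A ! i ! j
  entry i j with entries i j | of i j
  ... | inj₁ e        | (r→ , _) , (j→ , _) with lookup (lookup D i) j
  ...   | cross = sym e
  ...   | hor   = sym e
  ...   | ver   = sym e
  ...   | blank = sym e
  ...   | rT    = sym (r→ refl)
  ...   | jT    = sym (j→ refl)
  entry i j | inj₂ (inj₁ e) | (_ , →r) , _ rewrite →r e = sym e
  entry i j | inj₂ (inj₂ e) | _ , (_ , →j) rewrite →j e = sym e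

module BPD {n : ℕ} (D : TileMat n) (bpd : IsBPD n D) where
  private
    row    = proj₁ bpd
    column = proj₁ (proj₂ bpd)
    north  = proj₁ (proj₂ (proj₂ bpd))
    south  = proj₁ (proj₂ (proj₂ (proj₂ bpd)))
    west   = proj₁ (proj₂ (proj₂ (proj₂ (proj₂ bpd))))
    east   = proj₂ (proj₂ (proj₂ (proj₂ (proj₂ bpd))))

  module Row (i : ℕ) (i<n : i < n) = Line hasW hasE row-balance (tAt D i) n
    (λ _ → west i i<n) (λ k k<n → row i k i<n k<n)
  module Column (j : ℕ) (j<n : j < n) = Line hasN hasS column-balance (λ i → tAt D i j) n
    (λ _ → north j j<n) (λ k k<n → column k j k<n j<n)

  row-sum : ∀ i k → i < n → k < n → ∑ℤ< (suc k) (λ j → aAt (toASM D) i j) ≡ bit (hasE (tAt D i k))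
  row-sum i k i<n k<n = trans (∑ℤ<-cong (suc k) λ j _ → aAt-toASM D i j) (Row.prefix i i<n k k<n)

  column-sum : ∀ k j → k < n → j < n → ∑ℤ< (suc k) (λ i → aAt (toASM D) i j) ≡ bit (hasS (tAt D k j))
  column-sum k j k<n j<n = trans (∑ℤ<-cong (suc k) λ i _ → aAt-toASM D i j) (Column.prefix j j<n k k<n)

  total-sum : ∀ (f : ℕ → ℤ) {b} → 0 < n → ∑ℤ< (suc (n ∸ 1)) f ≡ bit b → b ≡ true → ∑ℤ< n f ≡ 1ℤ
  total-sum f 0<n e refl = trans (cong (λ z → ∑ℤ< z f) (sym (m+[n∸m]≡n 0<n))) e

  last<n : ∀ {i} → i < n → n ∸ 1 < n
  last<n i<n = ∸-monoʳ-< (s≤s z≤n) (≤-trans (s≤s z≤n) i<n)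

  isASM : IsASM n (toASM D)
  isASM = entries
    , (λ i i<n → total-sum (λ j → aAt (toASM D) i j) (≤-trans (s≤s z≤n) i<n)
      (row-sum i (n ∸ 1) i<n (last<n i<n)) (east i i<n))
    , (λ j j<n → total-sum (λ i → aAt (toASM D) i j) (≤-trans (s≤s z≤n) j<n)
      (column-sum (n ∸ 1) j (last<n j<n) j<n) (south j j<n))
    , (λ i j j′ j<j′ ne ne′ zeros → subst₂ (λ a b → a ≡ ℤ.- b) (sym (toASM-tAt D i j)) (sym (toASM-tAt D i j′))
        (Row.alternate (toℕ i) (Finₚ.toℕ<n i) (toℕ j) (toℕ j′) j<j′ (Finₚ.toℕ<n j′)
          (λ e → ne (trans (toASM-tAt D i j) e)) (λ e → ne′ (trans (toASM-tAt D i j′) e))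
          λ k j<k k<j′ → let k<n = <-trans k<j′ (Finₚ.toℕ<n j′) in
            between (λ k → tAt D (toℕ i) k) (λ k → toASM D ! i ! k) (toASM-tAt D i) k<n
              (λ e → zeros (fromℕ< k<n) (subst (toℕ j <_) (sym e) j<k) (subst (_< toℕ j′) (sym e) k<j′))))
    , (λ j i i′ i<i′ ne ne′ zeros → subst₂ (λ a b → a ≡ ℤ.- b) (sym (toASM-tAt D i j)) (sym (toASM-tAt D i′ j))
        (Column.alternate (toℕ j) (Finₚ.toℕ<n j) (toℕ i) (toℕ i′) i<i′ (Finₚ.toℕ<n i′)
          (λ e → ne (trans (toASM-tAt D i j) e)) (λ e → ne′ (trans (toASM-tAt D i′ j) e))
          λ k i<k k<i′ → let k<n = <-trans k<i′ (Finₚ.toℕ<n i′) in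
            between (λ k → tAt D k (toℕ j)) (λ k → toASM D ! k ! j) (λ k → toASM-tAt D k j) k<n
              (λ e → zeros (fromℕ< k<n) (subst (toℕ i <_) (sym e) i<k) (subst (_< toℕ i′) (sym e) k<i′))))
    where
    entries : ∀ i j → (toASM D ! i ! j ≡ 0ℤ) ⊎ (toASM D ! i ! j ≡ 1ℤ) ⊎ (toASM D ! i ! j ≡ -1ℤ)
    entries i j rewrite toASM-lookup D i j with lookup (lookup D i) j
    ... | cross = inj₁ refl
    ... | hor   = inj₁ refl
    ... | ver   = inj₁ refl
    ... | rT    = inj₂ (inj₁ refl)
    ... | jT    = inj₂ (inj₂ refl)
    ... | blank = inj₁ refl
    between : ∀ (t : ℕ → Tile) (a : Fin n → ℤ) → (∀ k → a k ≡ sign (t (toℕ k))) → ∀ {k} (k<n : k < n) →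
      (toℕ (fromℕ< k<n) ≡ k → a (fromℕ< k<n) ≡ 0ℤ) → sign (t k) ≡ 0ℤ
    between t a e k<n z = trans (cong (sign ∘ t) (sym (Finₚ.toℕ-fromℕ< k<n))) (trans (sym (e (fromℕ< k<n)))
      (z (Finₚ.toℕ-fromℕ< k<n)))

  -- `blank` is the only tile of sign 0 with neither a south nor an east edge, and these edges are
  -- the two partial sums tested by `wtASM`.
  weight : wtASM (toASM D) ≡ tabulate
    (λ (i : Fin n) → ∑< n (λ j → b2n (TileSet.heavy bumplessTiles (tAt D (toℕ i) j))))
  weight = Vecₚ.tabulate-cong λ i → ∑<-cong n λ j j<n → entry (toℕ i) j (Finₚ.toℕ<n i) j<n
    where
    entry : ∀ i j → i < n → j < n →
      b2n (isZeroℤ (aAt (toASM D) i j) ∧ isZeroℤ (∑ℤ< (suc i) (λ i′ → aAt (toASM D) i′ j)) ∧ isZeroℤ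
        (∑ℤ< (suc j) (λ j′ → aAt (toASM D) i j′)))
      ≡ b2n (TileSet.heavy bumplessTiles (tAt D i j))
    entry i j i<n j<n rewrite aAt-toASM D i j | column-sum i j i<n j<n | row-sum i j i<n j<n with tAt D i j
    ... | cross = refl
    ... | hor   = refl
    ... | ver   = refl
    ... | rT    = refl
    ... | jT    = refl
    ... | blank = refl

-- The two edges are partial sums of the matrix, so this recovers a bumpless pipe dream from its
-- matrix in `toASM-injective`.
tile-ext : ∀ t t′ → sign t ≡ sign t′ → hasS t ≡ hasS t′ → hasE t ≡ hasE t′ → t ≡ t′
tile-ext cross cross _ _ _ = refl
tile-ext hor   hor   _ _ _ = refl
tile-ext ver   ver   _ _ _ = refl
tile-ext rT    rT    _ _ _ = refl
tile-ext jT    jT    _ _ _ = refl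
tile-ext blank blank _ _ _ = refl

toASM-injective : ∀ (D D′ : TileMat n) → IsBPD n D → IsBPD n D′ → toASM D ≡ toASM D′ → D ≡ D′
toASM-injective {n} D D′ bpd bpd′ e = matrix-ext λ i j →
  trans (sym (tAt-lookup D i j)) (trans (same (toℕ i) (toℕ j) (Finₚ.toℕ<n i) (Finₚ.toℕ<n j)) (tAt-lookup D′ i j))
  where
  same : ∀ i j → i < n → j < n → tAt D i j ≡ tAt D′ i j
  same i j i<n j<n = tile-ext _ _
    (trans (sym (aAt-toASM D i j)) (trans (cong (λ A → aAt A i j) e) (aAt-toASM D′ i j)))
    (bit-injective (trans (sym (BPD.column-sum D bpd i j i<n j<n))
      (trans (cong (λ A → ∑ℤ< (suc i) (λ i → aAt A i j)) e) (BPD.column-sum D′ bpd′ i j i<n j<n))))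
    (bit-injective (trans (sym (BPD.row-sum D bpd i j i<n j<n))
      (trans (cong (λ A → ∑ℤ< (suc j) (λ j → aAt A i j)) e) (BPD.row-sum D′ bpd′ i j i<n j<n))))

-- Boolean triangles

bool-ext : ∀ {a b} → (a ≡ true → b ≡ true) → (b ≡ true → a ≡ true) → a ≡ b
bool-ext {true}  f g = sym (f refl)
bool-ext {false} {true}  f g = g refl
bool-ext {false} {false} f g = refl

bAt-lookup : ∀ (T : BoolMat n) i j → bAt T (toℕ i) (toℕ j) ≡ lookup (lookup T i) j
bAt-lookup {n} T i j = trans (cong (λ r → at false r (toℕ j)) (at-lookup (replicate n false) T i))
  (at-lookup false (lookup T i) j)

bAt-tabulate : ∀ (f : ℕ → ℕ → Bool) i j → i < n → j < n →
  bAt (tabulate {n = n} λ i → tabulate {n = n} λ j → f (toℕ i) (toℕ j)) i j ≡ f i j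
bAt-tabulate {n} f i j i<n j<n = trans
  (cong (λ r → at false r j) (at-tabulate (replicate n false) (λ i → tabulate λ j → f i (toℕ j)) i i<n))
  (at-tabulate false (f i) j j<n)

bAt-ext : ∀ (T T′ : BoolMat n) → (∀ i j → i < n → j < n → bAt T i j ≡ bAt T′ i j) → T ≡ T′
bAt-ext T T′ e = matrix-ext λ i j → trans (sym (bAt-lookup T i j))
  (trans (e (toℕ i) (toℕ j) (Finₚ.toℕ<n i) (Finₚ.toℕ<n j)) (bAt-lookup T′ i j))

rowHeavy-tabulate : ∀ 𝕋 (g : ℕ → TileSet.Kind 𝕋) n →
  Rows.rowHeavy 𝕋 (tabulate {n = n} λ k → g (toℕ k)) ≡ ∑< n (λ k → b2n (TileSet.heavy 𝕋 (g k)))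
rowHeavy-tabulate 𝕋 g zero    = refl
rowHeavy-tabulate 𝕋 g (suc n) = trans (cong (b2n (TileSet.heavy 𝕋 (g 0)) +_) (rowHeavy-tabulate 𝕋 (g ∘ suc) n))
  (sym (∑<-suc n (λ k → b2n (TileSet.heavy 𝕋 (g k)))))

pass-value : ∀ (T : BoolMat n) i k → i < k → k < n → Classic.pass T i k ≡ bAt T (n ∸ suc i) (i + (n ∸ k))
pass-value {n} T i k i<k k<n
  rewrite ≤ᵇ-complete {suc i} {n ∸ 1} (≤-trans i<k (∸-monoˡ-≤ 1 k<n))
        | ≤ᵇ-complete {1} {n ∸ k} (m<n⇒0<n∸m k<n)
        | ≤ᵇ-complete {n ∸ k} {n ∸ suc i} (∸-monoʳ-≤ n i<k) = refl

bAt-grid : ∀ (T : BoolMat n) i k → i < n → k < n → bAt (Classic.grid T) i k ≡ Classic.pass T i k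
bAt-grid T i k = bAt-tabulate (Classic.pass T) i k

Support : BoolMat n → Set
Support {n} T = ∀ (i j : Fin n) → lookup (lookup T i) j ≡ true → (1 ≤ toℕ i) × (n ≤ toℕ i + toℕ j)

support : ∀ (T : BoolMat n) → Support T → ∀ a b → a < n → b < n → bAt T a b ≡ true → (1 ≤ a) × (n ≤ a + b)
support T s a b a<n b<n e =
  subst₂ (λ a b → (1 ≤ a) × (_ ≤ a + b)) (Finₚ.toℕ-fromℕ< a<n) (Finₚ.toℕ-fromℕ< b<n)
    (s (fromℕ< a<n) (fromℕ< b<n) (trans (sym (bAt-lookup T (fromℕ< a<n) (fromℕ< b<n)))
      (trans (cong₂ (bAt T) (Finₚ.toℕ-fromℕ< a<n) (Finₚ.toℕ-fromℕ< b<n)) e)))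

-- Entry (a , b) of a triangle is the tile in row n ∸ suc a and in the antidiagonal b.
column : ℕ → ℕ → ℕ → ℕ
column n a b = n ∸ (b ∸ (n ∸ suc a))

module Entry {n a b : ℕ} (a<n : a < n) (b<n : b < n) (1≤a : 1 ≤ a) (n≤a+b : n ≤ a + b) where
  i c : ℕ
  i = n ∸ suc a
  c = b ∸ i
  suc-i : suc i ≡ n ∸ a
  suc-i = sym (+-∸-assoc 1 a<n)
  i<b : i < b
  i<b = subst (_≤ b) (sym suc-i) (m≤n+o⇒m∸n≤o n a n≤a+b)
  c>0 : 0 < c
  c>0 = m<n⇒0<n∸m i<b
  c≤n : c ≤ n
  c≤n = ≤-trans (m∸n≤m b i) (<⇒≤ b<n)
  n∸col : n ∸ column n a b ≡ c
  n∸col = m∸[m∸n]≡n c≤n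
  col<n : column n a b < n
  col<n = ∸-monoʳ-< c>0 c≤n
  c≤a : c ≤ a
  c≤a = m≤n+o⇒m∸n≤o b i (s≤s⁻¹ (≤-trans b<n (≤-reflexive (trans (sym (m∸n+n≡m a<n)) (+-suc i a)))))
  i<col : i < column n a b
  i<col = ≤-trans (≤-reflexive suc-i) (∸-monoʳ-≤ n c≤a)

  triangle-pass : ∀ (T : BoolMat n) → bAt T a b ≡ Classic.pass T i (column n a b)
  triangle-pass T = sym (trans (pass-value T i (column n a b) i<col col<n)
    (cong₂ (bAt T) (∸-flip a<n) (trans (cong (i +_) n∸col) (m+[n∸m]≡n (<⇒≤ i<b)))))

-- The grid shows only the entries inside the triangular region; `Support` makes all others false.
grid-injective : ∀ (T T′ : BoolMat n) → Support T → Support T′ → Classic.grid T ≡ Classic.grid T′ → T ≡ T′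
grid-injective {n} T T′ s s′ e = bAt-ext T T′ λ a b a<n b<n →
  bool-ext (λ t → trans (sym (same a b a<n b<n (support T s a b a<n b<n t))) t)
           (λ t → trans (same a b a<n b<n (support T′ s′ a b a<n b<n t)) t)
  where
  same : ∀ a b → a < n → b < n → (1 ≤ a) × (n ≤ a + b) → bAt T a b ≡ bAt T′ a b
  same a b a<n b<n (1≤a , n≤a+b) = trans (triangle-pass T)
    (trans (sym (bAt-grid T i (column n a b) (∸-flip< a<n) col<n))
    (trans (cong (λ G → bAt G i (column n a b)) e) (trans (bAt-grid T′ i (column n a b) (∸-flip< a<n) col<n)
      (sym (triangle-pass T′)))))
    where open Entry a<n b<n 1≤a n≤a+b

toTriangle : Vec (Vec Bool n) n → BoolMat n
toTriangle {n} G = tabulate λ a → tabulate λ b → entry (toℕ a) (toℕ b)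
  where
  entry : ℕ → ℕ → Bool
  entry a b = (1 ≤ᵇ a) ∧ ((n ≤ᵇ a + b) ∧ bAt G (n ∸ suc a) (column n a b))

toTriangle-support : ∀ (G : Vec (Vec Bool n) n) → Support (toTriangle G)
toTriangle-support {n} G i j t
  with e₁ , e₂ ← ∧-true (1 ≤ᵇ toℕ i) (trans (sym (bAt-tabulate
         (λ a b → (1 ≤ᵇ a) ∧ ((n ≤ᵇ a + b) ∧ bAt G (n ∸ suc a) (column n a b))) (toℕ i) (toℕ j) (Finₚ.toℕ<n i)
           (Finₚ.toℕ<n j)))
       (trans (bAt-lookup (toTriangle G) i j) t))
  = ≤ᵇ-sound 1 (toℕ i) e₁ , ≤ᵇ-sound n (toℕ i + toℕ j) (proj₁ (∧-true (n ≤ᵇ toℕ i + toℕ j) e₂))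

grid-toTriangle : ∀ (G : Vec (Vec Bool n) n) → (∀ i k → i < n → k < n → bAt G i k ≡ true → i < k) →
  Classic.grid (toTriangle G) ≡ G
grid-toTriangle {n} G stair = bAt-ext (Classic.grid (toTriangle G)) G λ i k i<n k<n → trans
  (bAt-grid (toTriangle G) i k i<n k<n)
  (entry i k i<n k<n)
  where
  above : ∀ i k → i < k → k < n → Classic.pass (toTriangle G) i k ≡ bAt G i k
  above i k i<k k<n = trans (pass-value (toTriangle G) i k i<k k<n) (trans
    (bAt-tabulate (λ a b → (1 ≤ᵇ a) ∧ ((n ≤ᵇ a + b) ∧ bAt G (n ∸ suc a) (column n a b))) a b
      (∸-flip< (<-trans i<k k<n)) b<n)
    value)
    where
    i<n = <-trans i<k k<n
    a = n ∸ suc i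
    b = i + (n ∸ k)
    b<n : b < n
    b<n = ≤-trans (+-monoˡ-≤ (n ∸ k) i<k) (≤-reflexive (m+[n∸m]≡n (<⇒≤ k<n)))
    n≤a+b : n ≤ a + b
    n≤a+b = ≤-trans (≤-reflexive (trans (sym (m∸n+n≡m i<n))
      (cong (a +_) (sym (trans (+-suc i 0) (cong suc (+-identityʳ i)))))))
      (+-monoʳ-≤ a (+-monoʳ-≤ i (m<n⇒0<n∸m k<n)))
    value : (1 ≤ᵇ a) ∧ ((n ≤ᵇ a + b) ∧ bAt G (n ∸ suc a) (column n a b)) ≡ bAt G i k
    value rewrite ≤ᵇ-complete {1} {a} (m<n⇒0<n∸m (≤-<-trans i<k k<n)) | ≤ᵇ-complete n≤a+b | ∸-flip i<n
      | m+n∸m≡n i (n ∸ k) | m∸[m∸n]≡n (<⇒≤ k<n) = refl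
  entry : ∀ i k → i < n → k < n → Classic.pass (toTriangle G) i k ≡ bAt G i k
  entry i k i<n k<n = bool-ext
    (λ t → trans (sym (above i k (Classic.pass-staircase (toTriangle G) i k k<n t) k<n)) t)
    (λ t → trans (above i k (stair i k i<n k<n t) k<n) t)

-- The first `suc i` terms of both sums vanish. The remaining ones agree after a reversal, since
-- grid columns are counted from the right while antidiagonals grow to the right.
triangle-weight : ∀ (T : BoolMat n) → Support T → wtTri T ≡ Vec.map (Rows.rowHeavy classicTiles) (Classic.grid T)
triangle-weight {n} T s = trans (Vecₚ.tabulate-cong λ i → sym (trans
    (rowHeavy-tabulate classicTiles (Classic.pass T (toℕ i)) n) (reindex (toℕ i) (Finₚ.toℕ<n i))))
  (Vecₚ.tabulate-∘ (Rows.rowHeavy classicTiles) (λ i → tabulate λ k → Classic.pass T (toℕ i) (toℕ k)))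
  where
  b2n-0 : ∀ {b} → b ≢ true → b2n b ≡ 0
  b2n-0 {true}  ne = contradiction refl ne
  b2n-0 {false} ne = refl
  reindex : ∀ i → i < n → ∑< n (λ k → b2n (Classic.pass T i k)) ≡ ∑< n (λ j → bN T (n ∸ suc i) j)
  reindex i i<n = trans (split (λ k → b2n (Classic.pass T i k)) λ k k≤i → b2n-0 λ t →
        <⇒≱ (Classic.pass-staircase T i k (<-≤-trans k≤i i<n) t) (s≤s⁻¹ k≤i))
    (trans (∑<-cong rest term) (trans (sym (∑<-reverse rest (λ t → bN T (n ∸ suc i) (suc i + t))))
      (sym (split (bN T (n ∸ suc i)) λ j j≤i → b2n-0 λ t →
        <⇒≱ (<-≤-trans (+-monoʳ-< rest j≤i) (≤-reflexive (m∸n+n≡m i<n)))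
            (proj₂ (support T s rest j (∸-flip< i<n) (<-≤-trans j≤i i<n) t))))))
    where
    rest : ℕ
    rest = n ∸ suc i
    split : ∀ f → (∀ k → k < suc i → f k ≡ 0) → ∑< n f ≡ ∑< rest (λ t → f (suc i + t))
    split f z = trans (cong (λ n → ∑< n f) (sym (m+[n∸m]≡n i<n))) (trans (∑<-+ (suc i) rest f)
      (cong (_+ ∑< rest (λ t → f (suc i + t))) (∑<-0 (suc i) z)))
    term : ∀ t → t < rest → b2n (Classic.pass T i (suc i + t)) ≡ bN T (n ∸ suc i) (suc i + (rest ∸ suc t))
    term t t<m = cong b2n (trans (pass-value T i (suc i + t) (s≤s (m≤m+n i t))
      (<-≤-trans (+-monoʳ-< (suc i) t<m) (≤-reflexive (m+[n∸m]≡n i<n))))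
      (cong (bAt T (n ∸ suc i)) (trans (cong (i +_) (trans (sym (∸-+-assoc n (suc i) t)) (+-∸-assoc 1 t<m)))
        (+-suc i (rest ∸ suc t)))))

-- Avoidance of 1432

module Pattern {n : ℕ} (T : BoolMat n) (π : Permutation′ n) where
  open Classic T
  open Link classicTiles

  module _ (ok : Valid (exitLabels π) grid V H) where

    private
      red : Reduced
      red = Valid⇒Reduced π ok

    value : ∀ (i : Fin n) → H (toℕ i) n ≡ suc (toℕ (π ⟨$⟩ʳ i))
    value i = trans (ok .exits i) (cong suc (Vecₚ.lookup∘tabulate (λ i → toℕ (π ⟨$⟩ʳ i)) i))

    -- A pipe enters above the column of its own number and moves only left, and `n ∸ k` is the
    -- number of the column counted from the left.
    mutual
      V-bound : ∀ i k → k < n → V i k ≢ 0 → n ∸ k ≤ V i k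
      V-bound zero k _ _ = ≤-refl
      V-bound (suc i) k k<n ne with pass i k
      ... | true  = V-bound i k k<n ne
      ... | false = H-bound i k (<⇒≤ k<n) ne

      H-bound : ∀ i k → k ≤ n → H i k ≢ 0 → n ∸ k ≤ H i k
      H-bound i zero    _   ne = contradiction refl ne
      H-bound i (suc k) k<n ne with pass i k
      ... | true  = ≤-trans (∸-monoʳ-≤ n (n≤1+n k)) (H-bound i k (<⇒≤ k<n) ne)
      ... | false = ≤-trans (∸-monoʳ-≤ n (n≤1+n k)) (V-bound i k k<n ne)

    exit-row : ∀ d i k → i < n → k < n → port d i k ≢ 0 → ∃ λ (r : Fin n) → H (toℕ r) n ≡ port d i k
    exit-row inV i k i<n k<n ne with k₀ , k₀<n , e ← V-ancestor i k 0 z≤n k<n ne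
                                with p , refl ← idx-surjective k₀<n
      = π ⟨$⟩ˡ p , trans (value (π ⟨$⟩ˡ p)) (trans (cong (λ z → suc (toℕ z)) (inverseʳ π)) (trans (sym (n∸idx p)) e))
    exit-row inH i k i<n k<n ne with k₁ , k₁<n , e₁ ← H-ancestor i k (<⇒≤ k<n) ne
                                with r , e ← exit-row inV i k₁ i<n k₁<n (λ z → ne (trans (sym e₁) z)) = r , trans e e₁

    -- Otherwise the label would occur twice on the cut below row `r`: once leaving and once still
    -- in the grid.
    exit-later : ∀ i k r → r < n → k ≤ n → H i k ≢ 0 → H r n ≡ H i k → i ≤ r
    exit-later i k r r<n k≤n ne e = ≮⇒≥ λ r<i →
      let k₁ , k₁<n , e₁ = H-ancestor i k k≤n ne
          k₀ , k₀<n , e₀ = V-ancestor i k₁ (suc r) r<i k₁<n (λ z → ne (trans (sym e₁) z))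
      in distinct r n ≤-refl .done-H k₀<n (λ z → ne (trans (sym (trans e₀ e₁)) z)) (λ z → ne (trans (sym e) z))
           (trans e₀ (trans e₁ (sym e)))

    -- If no label up to p leaves in the rows up to r, then the leftmost p tiles of these rows are all
    -- crosses: the leftmost turn of a row decides which label leaves it.
    module Dominant (p r : ℕ) (large : ∀ i → i ≤ r → p < H i n) where

      H-small : ∀ i k → k < n → n ∸ k ≤ p → (∀ k → k < n → n ∸ k ≤ p → V i k ≤ p) → pass i k ≡ false →
        ∀ d → suc k + d ≤ n → H i (suc k + d) ≤ p
      H-small i k k<n l small e zero    b rewrite +-identityʳ k | e = small k k<n l
      H-small i k k<n l small e (suc d) b rewrite +-suc k d with pass i (suc (k + d))
      ... | true  = H-small i k k<n l small e d (<⇒≤ b)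
      ... | false = small (suc (k + d)) b (≤-trans (∸-monoʳ-≤ n (≤-trans (m≤m+n k d) (n≤1+n _))) l)

      row-passes : ∀ i → i ≤ r → (∀ k → k < n → n ∸ k ≤ p → V i k ≤ p) → ∀ k → k < n → n ∸ k ≤ p → pass i k ≡ true
      row-passes i i≤r small k k<n l with pass i k in e
      ... | true  = refl
      ... | false = contradiction
        (subst (λ z → H i z ≤ p) (m+[n∸m]≡n k<n) (H-small i k k<n l small e (n ∸ suc k)
          (≤-reflexive (m+[n∸m]≡n k<n))))
        (<⇒≱ (large i i≤r))

      V-small : ∀ i → i ≤ suc r → ∀ k → k < n → n ∸ k ≤ p → V i k ≤ p
      V-small zero    _   k k<n l = l
      V-small (suc i) i<r k k<n l rewrite row-passes i (s≤s⁻¹ i<r) (V-small i (<⇒≤ i<r)) k k<n l =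
        V-small i (<⇒≤ i<r) k k<n l

      all-pass : ∀ i → i ≤ r → ∀ k → k < n → n ∸ k ≤ p → pass i k ≡ true
      all-pass i i≤r = row-passes i i≤r (V-small i (m≤n⇒m≤1+n i≤r))

    module _ (av : Avoids1432 π) where

      -- Here `p`, `q`, `h` are `V i k`, `H i k`, `H i′ k′`, and they leave in the rows `d`, `c`,
      -- `b`. The tile where `q` turns lies in row `i`, at most `b`, and by `V-bound` in a column at
      -- most `p`; so it is one of the tiles that `Dominant` forces to be crosses.
      no-forbidden : ∀ {i k i′ k′} → Crossing i k → suc k < n → pass i (suc k) ≡ false →
        Crossing i′ k′ → i ≤ i′ → V i′ k′ ≡ H i k → ⊥
      no-forbidden {i} {k} {i′} {k′} X@(i<n , k<n , px , h≢0 , v≢0) 1+k<n e X′@(i′<n , k′<n , px′ , h′≢0 , v′≢0)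
        i≤i′ q≡
        with d , ed ← exit-row inV i k i<n k<n v≢0
        with c , ec ← exit-row inH i k i<n k<n h≢0
        with b , eb ← exit-row inH i′ k′ i′<n k′<n h′≢0
        = contradiction (trans (sym e) (all-pass i (≤-trans i≤i′ i′≤b) (suc k) 1+k<n col)) λ ()
        where
        i′≤b : i′ ≤ toℕ b
        i′≤b = exit-later i′ k′ (toℕ b) (Finₚ.toℕ<n b) (<⇒≤ k′<n) h′≢0 eb
        c<d : toℕ c < toℕ d
        c<d = exit-order red X (Finₚ.toℕ<n c) (Finₚ.toℕ<n d) ec ed
        b<c : toℕ b < toℕ c
        b<c = exit-order red X′ (Finₚ.toℕ<n b) (Finₚ.toℕ<n c) eb (trans ec (sym q≡))
        p<q : V i k < H i k
        p<q = red X
        q<h : H i k < H i′ k′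
        q<h = subst (_< H i′ k′) q≡ (red X′)
        π< : ∀ {a b : Fin n} {l m} → H (toℕ a) n ≡ l → H (toℕ b) n ≡ m → l < m → (π ⟨$⟩ʳ a) Fin.< (π ⟨$⟩ʳ b)
        π< {a} {b} el em l<m = s≤s⁻¹ (subst₂ _<_ (trans (sym el) (value a)) (trans (sym em) (value b)) l<m)
        large : ∀ a → a ≤ toℕ b → V i k < H a n
        large a a≤b with m≤n⇒m<n∨m≡n a≤b
        ... | inj₂ refl = subst (V i k <_) (sym eb) (<-trans p<q q<h)
        -- A label at most `p` leaving in row `a` differs from `p`, which leaves in row `d`; so the
        -- values in rows `a`, `b`, `c`, `d` are ordered as 1, 4, 3, 2.
        ... | inj₁ a<b  = ≰⇒> λ Ha≤p → av (a′ , b , c , d , subst (_< toℕ b) (sym a′≡) a<b , b<c , c<d ,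
            π< ea ed (≤∧≢⇒< Ha≤p λ Ha≡p → <-irrefl (row-unique (trans Ha≡p (sym ed)))
              (<-trans a<b (<-trans b<c c<d))) ,
            π< ed ec p<q , π< ec eb q<h)
          where
          a<n : a < n
          a<n = <-trans a<b (Finₚ.toℕ<n b)
          a′ : Fin n
          a′ = fromℕ< a<n
          a′≡ : toℕ a′ ≡ a
          a′≡ = Finₚ.toℕ-fromℕ< a<n
          ea : H (toℕ a′) n ≡ H a n
          ea = cong (λ z → H z n) a′≡
          row-unique : H a n ≡ H (toℕ d) n → a ≡ toℕ d
          row-unique z = trans (sym a′≡) (cong toℕ (trans (sym (inverseˡ π)) (trans (cong (π ⟨$⟩ˡ_)
            (Finₚ.toℕ-injective (suc-injective (trans (sym (value a′)) (trans ea (trans z (value d)))))))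
              (inverseˡ π))))
        open Dominant (V i k) (toℕ b) large
        col : n ∸ suc k ≤ V i k
        col = ≤-trans (∸-monoʳ-≤ n (n≤1+n k)) (V-bound i k k<n v≢0)

      module Ballot (j : ℕ) where

        -- x t and y t are the tiles in column t + 1 of two consecutive antidiagonals; y t is
        -- the left neighbour of x (suc t).
        x y : ℕ → Bool
        x t = pass (n ∸ suc (j + t)) (n ∸ suc t)
        y t = pass (n ∸ suc (suc j + t)) (n ∸ suc t)

        ∑x ∑y : ℕ → ℕ
        ∑x M = ∑< M (λ t → b2n (x t))
        ∑y M = ∑< M (λ t → b2n (y t))

        module Neighbour (M : ℕ) (j+M : j + suc M < n) where
          i k : ℕ
          i = n ∸ suc (j + suc M)
          k = n ∸ suc (suc M)
          1+M<n : suc M < n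
          1+M<n = ≤-<-trans (m≤n+m (suc M) j) j+M
          i<n : i < n
          i<n = ∸-flip< j+M
          k<n : k < n
          k<n = ∸-flip< 1+M<n
          suc-i : suc i ≡ n ∸ suc (j + M)
          suc-i = trans (sym (+-∸-assoc 1 j+M)) (cong (n ∸_) (+-suc j M))
          suc-k : suc k ≡ n ∸ suc M
          suc-k = sym (+-∸-assoc 1 1+M<n)
          suc-k<n : suc k < n
          suc-k<n = subst (_< n) (sym suc-k) (∸-flip< (<-trans ≤-refl 1+M<n))
          y≡ : y M ≡ pass i (suc k)
          y≡ = cong₂ pass (cong (λ z → n ∸ suc z) (sym (+-suc j M))) (sym suc-k)
          turn : y M ≡ false → V (n ∸ suc (j + M)) (n ∸ suc M) ≡ H i (suc k)
          turn e = trans (cong₂ V (sym suc-i) (sym suc-k)) V-turn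
            where
            V-turn : V (suc i) (suc k) ≡ H i (suc k)
            V-turn rewrite trans (sym y≡) e = refl

        mutual
          -- Passing to `suc M` adds `x (suc M)` on the left and its left neighbour `y M` on the
          -- right. The inequality can fail only if the first is a cross, the second is not, and
          -- equality held before.
          ballot : ∀ M → j + M < n → ∑x (suc M) ≤ suc (∑y M)
          ballot zero    j+M = ≤-trans (≤-reflexive (+-identityʳ (b2n (x 0)))) (b2n≤1 (x 0))
          ballot (suc M) j+M
            rewrite ∑<-snoc (suc M) (λ t → b2n (x t)) | ∑<-snoc M (λ t → b2n (y t))
            with x (suc M) in ex | y M in ey | ballot M (<-trans (+-monoʳ-< j ≤-refl) j+M)
          ... | false | b     | IH = ≤-trans (≤-reflexive (+-identityʳ _)) (≤-trans IH (s≤s (m≤m+n (∑y M) (b2n b))))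
          ... | true  | true  | IH = +-monoˡ-≤ 1 IH
          ... | true  | false | IH with m≤n⇒m<n∨m≡n IH
          ...   | inj₁ lt = ≤-trans (≤-reflexive (+-comm (∑x (suc M)) 1)) (≤-trans lt (s≤s (m≤m+n (∑y M) 0)))
          ...   | inj₂ eq
            -- The horizontal pipe at `x (suc M)` turns at `y M` and enters `x M` from above; from
            -- the equality `descent` finds the later crossing at which it is vertical.
            = let i′ , k′ , i≤i′ , i′<n , k′<n , px′ , q≡ = descent M (<-trans (+-monoʳ-< j ≤-refl) j+M) eq in
              ⊥-elim (no-forbidden (crossing i<n k<n ex) suc-k<n (trans (sym y≡) ey) (crossing i′<n k′<n px′)
                (≤-trans (≤-trans (n≤1+n i) (≤-reflexive suc-i)) i≤i′)
                (trans q≡ (trans (turn ey) (H-pass ex))))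
            where
            open Neighbour M j+M
            H-pass : pass i k ≡ true → H i (suc k) ≡ H i k
            H-pass e rewrite e = refl

          crossing : ∀ {i k} → i < n → k < n → pass i k ≡ true → Crossing i k
          crossing {i} {k} i<n k<n p = i<n , k<n , p , H≢0 i k i<k (<⇒≤ k<n) , V≢0 i k (<⇒≤ i<k) k<n
            where
            i<k : i < k
            i<k = pass-staircase i k k<n p

          -- A pipe entering x M from above runs down the antidiagonal, turning twice in each row,
          -- until it passes some tile vertically.
          descent : ∀ M → j + M < n → ∑x (suc M) ≡ suc (∑y M) → ∃₂ λ i k →
            (n ∸ suc (j + M) ≤ i) × (i < n) × (k < n) × (pass i k ≡ true) × (V i k ≡ V (n ∸ suc (j + M)) (n ∸ suc M))
          descent M j+M eq with x M in ex
          ... | true  = n ∸ suc (j + M) , n ∸ suc M , ≤-refl , ∸-flip< j+M , ∸-flip<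
            (≤-<-trans (m≤n+m M j) j+M) , ex , refl
          descent zero    j+M eq | false = contradiction (trans (sym eq) (trans (+-identityʳ _) (cong b2n ex))) λ ()
          descent (suc M) j+M eq | false =
            let i′ , k′ , i≤i′ , i′<n , k′<n , px′ , q≡ = descent M (<-trans (+-monoʳ-< j ≤-refl) j+M) eq′
            in i′ , k′ , ≤-trans (≤-trans (n≤1+n i) (≤-reflexive suc-i)) i≤i′ , i′<n , k′<n , px′ ,
               trans q≡ (trans (turn y-false) (H-turn ex))
            where
            open Neighbour M j+M
            ∑x≡ : ∑x (suc M) ≡ suc (∑y M + b2n (y M))
            ∑x≡ = trans (sym (trans (∑<-snoc (suc M) (λ t → b2n (x t)))
              (trans (cong (λ b → ∑x (suc M) + b2n b) ex) (+-identityʳ _))))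
              (trans eq (cong suc (∑<-snoc M (λ t → b2n (y t)))))
            -- A cross at `y M` would make the left sum exceed `∑y M` by 2, against `ballot`. So
            -- equality passes on to `M`, and the pipe turns down again at `y M`.
            y-false : y M ≡ false
            y-false with y M in ey
            ... | false = refl
            ... | true  = contradiction (≤-trans
              (≤-reflexive (sym (trans ∑x≡ (cong (λ b → suc (∑y M + b2n b)) ey))))
                (ballot M (<-trans (+-monoʳ-< j ≤-refl) j+M)))
              (<⇒≱ (s≤s (≤-reflexive (+-comm 1 (∑y M)))))
            eq′ : ∑x (suc M) ≡ suc (∑y M)
            eq′ = trans ∑x≡ (cong suc (trans (cong (λ b → ∑y M + b2n b) y-false) (+-identityʳ _)))
            H-turn : pass i k ≡ false → H i (suc k) ≡ V i k
            H-turn e rewrite e = refl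

      antidiagonal : ∀ j t → 1 ≤ j → j + t < n → bN T (j + t) (n ∸ j) ≡ b2n (pass (n ∸ suc (j + t)) (n ∸ suc t))
      antidiagonal j t 1≤j j+t<n = cong b2n (sym (trans (pass-value T (n ∸ suc (j + t)) (n ∸ suc t)
          (∸-monoʳ-< (s≤s (+-monoˡ-≤ t 1≤j)) j+t<n) (∸-flip< t<n))
        (cong₂ (bAt T) (∸-flip j+t<n) (trans (cong (n ∸ suc (j + t) +_) (m∸[m∸n]≡n t<n)) col))))
        where
        t<n : t < n
        t<n = ≤-<-trans (m≤n+m t j) j+t<n
        col : n ∸ suc (j + t) + suc t ≡ n ∸ j
        col = trans (cong (_+ suc t) (trans (cong (n ∸_) (sym (+-suc j t))) (sym (∸-+-assoc n j (suc t)))))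
          (m∸n+n≡m (m+n≤o⇒m≤o∸n′ ))
          where
          m+n≤o⇒m≤o∸n′ : suc t ≤ n ∸ j
          m+n≤o⇒m≤o∸n′ = m+n≤o⇒m≤o∸n (suc t) (subst (_≤ n) (cong suc (+-comm j t)) j+t<n)

      triangle-inequality : ∀ i j → 1 ≤ j → j < i → i ≤ n ∸ 1 →
        ∑[ j , i ] (λ k → bN T k (n ∸ j)) ≤ 1 + ∑[ suc j , i ] (λ k → bN T k (n ∸ j ∸ 1))
      triangle-inequality i j 1≤j j<i i≤n-1 = subst₂ (λ a b → a ≤ suc b) (sym left≡) (sym right≡) (ballot M j+M)
        where
        open Ballot j
        M : ℕ
        M = i ∸ j
        0<n : 0 < n
        0<n = ≤-trans (≤-trans (s≤s z≤n) j<i) (≤-trans i≤n-1 (m∸n≤m n 1))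
        j+M≡i : j + M ≡ i
        j+M≡i = m+[n∸m]≡n (<⇒≤ j<i)
        i<n : i < n
        i<n = ≤-trans (s≤s i≤n-1) (≤-reflexive (m+[n∸m]≡n 0<n))
        j+M : j + M < n
        j+M = subst (_< n) (sym j+M≡i) i<n
        left≡ : ∑[ j , i ] (λ k → bN T k (n ∸ j)) ≡ ∑x (suc M)
        left≡ = trans (cong (λ m → ∑< m (λ t → bN T (j + t) (n ∸ j))) (+-∸-assoc 1 (<⇒≤ j<i)))
          (∑<-cong (suc M) λ t t≤M → antidiagonal j t 1≤j (≤-<-trans (+-monoʳ-≤ j (s≤s⁻¹ t≤M)) j+M))
        right≡ : ∑[ suc j , i ] (λ k → bN T k (n ∸ j ∸ 1)) ≡ ∑y M
        right≡ = ∑<-cong M λ t t<M → trans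
          (cong (bN T (suc j + t)) (trans (∸-+-assoc n j 1) (cong (n ∸_) (+-comm j 1))))
          (antidiagonal (suc j) t (s≤s z≤n) (≤-<-trans (≤-trans (≤-reflexive (sym (+-suc j t)))
            (+-monoʳ-≤ j t<M)) j+M))

-- The weight-preserving injection

lookup-∷ʳ-inject₁ : ∀ (xs : Vec A n) x i → lookup (xs ∷ʳ x) (inject₁ i) ≡ lookup xs i
lookup-∷ʳ-inject₁ (y ∷ xs) x zero    = refl
lookup-∷ʳ-inject₁ (y ∷ xs) x (suc i) = lookup-∷ʳ-inject₁ xs x i

lookup-∷ʳ-last : ∀ (xs : Vec A n) x → lookup (xs ∷ʳ x) (fromℕ n) ≡ x
lookup-∷ʳ-last []       x = refl
lookup-∷ʳ-last (y ∷ xs) x = lookup-∷ʳ-last xs x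

lookup-reverse-opposite : ∀ (xs : Vec A n) i → lookup (reverse xs) (opposite i) ≡ lookup xs i
lookup-reverse-opposite (x ∷ xs) zero    rewrite Vecₚ.reverse-∷ x xs = lookup-∷ʳ-last (reverse xs) x
lookup-reverse-opposite (x ∷ xs) (suc i) rewrite Vecₚ.reverse-∷ x xs =
  trans (lookup-∷ʳ-inject₁ (reverse xs) x (opposite i)) (lookup-reverse-opposite xs i)

lookup-reverse : ∀ (xs : Vec A n) i → lookup (reverse xs) i ≡ lookup xs (opposite i)
lookup-reverse xs i = trans (cong (lookup (reverse xs)) (sym (Finₚ.opposite-involutive i)))
  (lookup-reverse-opposite xs (opposite i))

reverse-tabulate : ∀ (f : Fin n → A) → reverse (tabulate f) ≡ tabulate (f ∘ opposite)
reverse-tabulate f = lookup-ext λ i → trans (lookup-reverse (tabulate f) i)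
  (trans (Vecₚ.lookup∘tabulate f (opposite i)) (sym (Vecₚ.lookup∘tabulate (f ∘ opposite) i)))

reverse-injective : ∀ (xs ys : Vec A n) → reverse xs ≡ reverse ys → xs ≡ ys
reverse-injective xs ys e = trans (sym (Vecₚ.reverse-involutive xs))
  (trans (cong reverse e) (Vecₚ.reverse-involutive ys))

grid≡reverse : ∀ (D : TileMat n) → Bumpless.grid D ≡ reverse D
grid≡reverse {n} D = matrix-ext λ i k → trans (Bumpless.grid-lookup D i k)
  (trans (cong (λ z → tAt D z (toℕ k)) (sym (Finₚ.opposite-prop i)))
  (trans (tAt-lookup D (opposite i) k) (cong (λ r → lookup r k) (sym (lookup-reverse D i)))))

asm-weight : ∀ (D : TileMat n) → IsBPD n D → wtASM (toASM D) ≡ Vec.map (Rows.rowHeavy bumplessTiles) D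
asm-weight {n} D bpd = trans (BPD.weight D bpd) (lookup-ext λ i → trans (Vecₚ.lookup∘tabulate (λ i → row (toℕ i)) i)
  (sym (trans (Vecₚ.lookup-map i (Rows.rowHeavy bumplessTiles) D)
    (trans (cong (Rows.rowHeavy bumplessTiles) (row≡ i)) (rowHeavy-tabulate bumplessTiles (tAt D (toℕ i)) n)))))
  where
  row : ℕ → ℕ
  row i = ∑< n (λ j → b2n (TileSet.heavy bumplessTiles (tAt D i j)))
  row≡ : ∀ i → lookup D i ≡ tabulate λ k → tAt D (toℕ i) (toℕ k)
  row≡ i = lookup-ext λ k → trans (sym (tAt-lookup D i k))
    (sym (Vecₚ.lookup∘tabulate (λ k → tAt D (toℕ i) (toℕ k)) k))

rowHeavy≤ : ∀ 𝕋 (r : Vec (TileSet.Kind 𝕋) n) → Rows.rowHeavy 𝕋 r ≤ n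
rowHeavy≤ 𝕋 []      = z≤n
rowHeavy≤ 𝕋 (a ∷ r) = +-mono-≤ (b2n≤1 (TileSet.heavy 𝕋 a)) (rowHeavy≤ 𝕋 r)

rowHeavy-digits : ∀ 𝕋 (X : Vec (Vec (TileSet.Kind 𝕋) n) m) → VAll.All (_< suc n) (Vec.map (Rows.rowHeavy 𝕋) X)
rowHeavy-digits 𝕋 []      = []
rowHeavy-digits 𝕋 (r ∷ X) = s≤s (rowHeavy≤ 𝕋 r) ∷ rowHeavy-digits 𝕋 X

classic-kinds : ∀ a → a ∈ TileSet.kinds classicTiles
classic-kinds false = here refl
classic-kinds true  = there (here refl)

bumpless-kinds : ∀ a → a ∈ TileSet.kinds bumplessTiles
bumpless-kinds cross = here refl
bumpless-kinds hor   = there (here refl)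
bumpless-kinds ver   = there (there (here refl))
bumpless-kinds rT    = there (there (there (here refl)))
bumpless-kinds jT    = there (there (there (there (here refl))))
bumpless-kinds blank = there (there (there (there (there (here refl)))))

-- The enumeration runs over all square fillings. In row `i` the horizontal labels stay 0 up to
-- column `i`, and a cross there would need a label below 0; so an accepted filling has its crosses
-- inside the staircase and is the grid of a boolean triangle.
module Staircase {n : ℕ} (X : Vec (Vec Bool n) n) (es : Vec ℕ n)
                 (v : Rows.valid classicTiles es X (tabulate λ k → n ∸ toℕ k) ≡ true) where
  open Labels n (bAt X) (n ∸_)
  open Link classicTiles

  ok : Valid es X V H
  ok = valid⁻ {p = bAt X} es X (tabulate λ k → n ∸ toℕ k) (record
    { passes = bAt-lookup X
    ; top    = λ k → sym (Vecₚ.lookup∘tabulate (λ k → n ∸ toℕ k) k)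
    ; left   = λ _ → refl
    ; H-next = λ _ _ → refl
    ; V-next = λ _ _ → refl
    }) v

  increasing : ∀ i k → i < n → k < n → bAt X i k ≡ true → V i k < H i k
  increasing i k i<n k<n e with l ← ok .legal-all (fromℕ< i<n) (fromℕ< k<n)
    rewrite sym (bAt-lookup X (fromℕ< i<n) (fromℕ< k<n)) | Finₚ.toℕ-fromℕ< i<n | Finₚ.toℕ-fromℕ< k<n | e
    = <ᵇ-sound (V i k) (H i k) l

  mutual
    V≡0 : ∀ i k → i ≤ n → k < n → k < i → V i k ≡ 0
    V≡0 (suc i) k i<n k<n k≤i with bAt X i k in e
    ... | true  = contradiction (subst (V i k <_) (H≡0 i k i<n (<⇒≤ k<n) (s≤s⁻¹ k≤i)) (increasing i k i<n k<n e)) λ ()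
    ... | false = H≡0 i k i<n (<⇒≤ k<n) (s≤s⁻¹ k≤i)

    H≡0 : ∀ i k → i < n → k ≤ n → k ≤ i → H i k ≡ 0
    H≡0 i zero    i<n k≤n k≤i = refl
    H≡0 i (suc k) i<n k<n k<i with bAt X i k in e
    ... | true  = contradiction (subst (V i k <_) (H≡0 i k i<n (<⇒≤ k<n) (<⇒≤ k<i)) (increasing i k i<n k<n e)) λ ()
    ... | false = V≡0 i k (<⇒≤ i<n) k<n k<i

  staircase : ∀ i k → i < n → k < n → bAt X i k ≡ true → i < k
  staircase i k i<n k<n e = ≰⇒> λ k≤i →
    contradiction (subst (V i k <_) (H≡0 i k i<n (<⇒≤ k<n) k≤i) (increasing i k i<n k<n e)) λ ()

module Correspondence (n : ℕ) (π : Permutation′ n) where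

  ps : Vec ℕ n
  ps = powers (suc n) n

  exitData : Vec (ℕ × ℕ) n
  exitData = tabulate λ i → toℕ (π ⟨$⟩ʳ i) , lookup ps i

  top : Vec ℕ n
  top = tabulate λ k → suc (toℕ k)

  exitsClassic exitsBumpless : Vec ℕ n
  exitsClassic = tabulate λ i → toℕ (π ⟨$⟩ʳ i)
  exitsBumpless = tabulate λ i → toℕ (π ⟨$⟩ʳ opposite i)

  topClassic : Vec ℕ n
  topClassic = tabulate λ k → n ∸ toℕ k

  exitsClassic≡ : Vec.map proj₁ exitData ≡ exitsClassic
  exitsClassic≡ = sym (Vecₚ.tabulate-∘ proj₁ _)

  exitsBumpless≡ : Vec.map proj₁ (reverse exitData) ≡ exitsBumpless
  exitsBumpless≡ = trans (cong (Vec.map proj₁) (reverse-tabulate _)) (sym (Vecₚ.tabulate-∘ proj₁ _))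

  ps≡ : Vec.map proj₂ exitData ≡ ps
  ps≡ = trans (sym (Vecₚ.tabulate-∘ proj₂ _)) (Vecₚ.tabulate∘lookup ps)

  topClassic≡ : reverse top ≡ topClassic
  topClassic≡ = trans (reverse-tabulate _) (Vecₚ.tabulate-cong λ k →
    trans (cong suc (Finₚ.opposite-prop k)) (sym (+-∸-assoc 1 (Finₚ.toℕ<n k))))

  open Bijection (grids-bijection exitData top)

  classicGrids : List (Vec (Vec Bool n) n)
  classicGrids = Rows.grids classicTiles (Vec.map proj₁ exitData) (reverse top)

  bumplessGrids : List (Vec (Vec Tile n) n)
  bumplessGrids = Rows.grids bumplessTiles (Vec.map proj₁ (reverse exitData)) top

  classic-∈ : ∀ T → PDReducedWith T π → Classic.grid T ∈ classicGrids
  classic-∈ T red = ∈-grids⁺ classicTiles classic-kinds (Vec.map proj₁ exitData) (reverse top) (Classic.grid T)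
    (subst₂ (λ es v → Rows.valid classicTiles es (Classic.grid T) v ≡ true) (sym exitsClassic≡)
      (sym topClassic≡) (Classic.reduced⇒valid T π red))

  classic-valid : ∀ {X} → X ∈ classicGrids → Rows.valid classicTiles exitsClassic X topClassic ≡ true
  classic-valid {X} p = subst₂ (λ es v → Rows.valid classicTiles es X v ≡ true) exitsClassic≡ topClassic≡
    (∈-grids⁻ classicTiles (Vec.map proj₁ exitData) (reverse top) X p)

  bumpless-∈ : ∀ D → IsBPD n D → BPDReducedWith D π → Bumpless.grid D ∈ bumplessGrids
  bumpless-∈ D bpd red = ∈-grids⁺ bumplessTiles bumpless-kinds (Vec.map proj₁ (reverse exitData)) top
    (Bumpless.grid D)
    (subst (λ es → Rows.valid bumplessTiles es (Bumpless.grid D) top ≡ true) (sym exitsBumpless≡)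
      (Bumpless.reduced⇒valid D π bpd red))

  bumpless-valid : ∀ {Y} → Y ∈ bumplessGrids → Rows.valid bumplessTiles exitsBumpless
    (Bumpless.grid (reverse Y)) top ≡ true
  bumpless-valid {Y} p = subst₂ (λ es Y → Rows.valid bumplessTiles es Y top ≡ true) exitsBumpless≡
    (sym (trans (grid≡reverse (reverse Y)) (Vecₚ.reverse-involutive Y)))
      (∈-grids⁻ bumplessTiles (Vec.map proj₁ (reverse exitData)) top Y p)

  module Image (b : TSSCPPred n π) where
    triangle : BoolMat n
    triangle = proj₁ b
    T∈ : Classic.grid triangle ∈ classicGrids
    T∈ = classic-∈ triangle (proj₂ (proj₂ b))
    D : TileMat n
    D = reverse (to T∈)
    module D-valid = Bumpless.FromValid D π (bumpless-valid (to-∈ T∈))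

  φ : TSSCPPred n π → ASMred n π
  φ b = toASM D , BPD.isASM D D-valid.isBPD , D , D-valid.isBPD , toASM-BPDOf D , D-valid.bpdReduced
    where open Image b

  -- The bijection preserves only the number `code`. Row counts are digits in base `suc n`, so
  -- `powers-injective` recovers the exponent vectors. The reversals appear because bumpless rows
  -- are numbered from the bottom.
  φ-weight : ∀ b → wtASM (proj₁ (φ b)) ≡ wtTri (proj₁ b)
  φ-weight b = trans (asm-weight D D-valid.isBPD) (sym (trans (triangle-weight triangle (proj₁ (proj₁ (proj₂ b))))
    (powers-injective (suc n) _ _ (rowHeavy-digits classicTiles (Classic.grid triangle))
      (rowHeavy-digits bumplessTiles D) codes)))
    where
    open Image b
    codes : dot ps (Vec.map (Rows.rowHeavy classicTiles) (Classic.grid triangle)) ≡ dot ps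
      (Vec.map (Rows.rowHeavy bumplessTiles) D)
    codes = trans (cong (λ z → dot z (Vec.map (Rows.rowHeavy classicTiles) (Classic.grid triangle))) (sym ps≡))
      (trans (sym (to-value T∈))
      (trans (cong (λ z → dot z (Vec.map (Rows.rowHeavy bumplessTiles) (to T∈)))
               (trans (Vecₚ.map-reverse proj₂ exitData) (cong reverse ps≡)))
      (trans (sym (dot-reverse (reverse ps) _))
        (cong₂ dot (Vecₚ.reverse-involutive ps) (sym (Vecₚ.map-reverse (Rows.rowHeavy bumplessTiles) (to T∈)))))))

  φ-injective : ∀ b b′ → proj₁ (φ b) ≡ proj₁ (φ b′) → proj₁ b ≡ proj₁ b′
  φ-injective b b′ e = grid-injective I.triangle I′.triangle (proj₁ (proj₁ (proj₂ b))) (proj₁ (proj₁ (proj₂ b′)))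
    (injective I.T∈ I′.T∈ (reverse-injective _ _ (toASM-injective I.D I′.D I.D-valid.isBPD I′.D-valid.isBPD e)))
    where
    module I  = Image b
    module I′ = Image b′

  -- Every reduced bumpless pipe dream has a partner among the reduced pipe dreams; avoidance
  -- supplies the inequalities that make the partner a TSSCPP triangle.
  φ-surjective : Avoids1432 π → ∀ (A : ASMred n π) → Σ (TSSCPPred n π) λ b → proj₁ (φ b) ≡ proj₁ A
  φ-surjective av (A , asm , D , bpd , of , red) with X , X∈ , image ← surjective (bumpless-∈ D bpd red) =
    b , trans (cong toASM (trans (cong reverse D-image) (trans (cong reverse (grid≡reverse D))
      (Vecₚ.reverse-involutive D))))
      (toASM-unique A D asm of)
    where
    triangle : BoolMat n
    triangle = toTriangle X
    gridT : Classic.grid triangle ≡ X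
    gridT = grid-toTriangle X (Staircase.staircase X exitsClassic (classic-valid X∈))
    valid : Rows.valid classicTiles exitsClassic (Classic.grid triangle) topClassic ≡ true
    valid = subst (λ X → Rows.valid classicTiles exitsClassic X topClassic ≡ true) (sym gridT) (classic-valid X∈)
    b : TSSCPPred n π
    b = triangle , (toTriangle-support X , λ i j → Pattern.triangle-inequality triangle π
      (Classic.valid⇒Valid triangle π valid) av i j)
          , Classic.valid⇒reduced triangle π valid
    -- The proof inside `φ b` concerns `Classic.grid triangle`, which equals `X` only
    -- propositionally; therefore the statement about all membership proofs is transported.
    D-image : to (Image.T∈ b) ≡ Bumpless.grid D
    D-image = subst (λ X → ∀ (p : X ∈ classicGrids) → to p ≡ Bumpless.grid D) (sym gridT) image (Image.T∈ b)

theorem1p1 : (n : ℕ) → 1 ≤ n → (π : Permutation′ n) →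
    Σ (TSSCPPred n π → ASMred n π) λ φ →
    (∀ (b : TSSCPPred n π) → wtASM (proj₁ (φ b)) ≡ wtTri (proj₁ b))
    × (∀ (b b′ : TSSCPPred n π) → proj₁ (φ b) ≡ proj₁ (φ b′) → proj₁ b ≡ proj₁ b′)
    × (Avoids1432 π → ∀ (A : ASMred n π) → Σ (TSSCPPred n π) λ b → proj₁ (φ b) ≡ proj₁ A)
theorem1p1 n _ π = φ , φ-weight , φ-injective , φ-surjective
  where open Correspondence n π
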